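{- Let $\pi=\pi_1/\pi_2/\cdots/\pi_{\ell(\pi)}$ be a set partition of $[n]$ with $n\ge1$. Then $$\Theta_{\mathrm{NCSym}}(\mathbf p_\pi)=\begin{cases}2^{\ell(\pi)}\mathbf p_\pi&\text{if every block of }\pi\text{ has odd size},\\0&\text{otherwise.}\end{cases}$$ Consequently $\Theta_{\mathrm{NCSym}}\circ\omega=\omega\circ\Theta_{\mathrm{NCSym}}$ on $\mathrm{NCSym}$.
   Context: Let $\mathbf x_1,\mathbf x_2,\dots$ be noncommuting variables over $\mathbb Q$, $[m]=\{1,\dots,m\}$. A set partition $\pi$ of $[n]$ has blocks $\pi_1,\dots,\pi_{\ell(\pi)}$. $\mathbf m_\pi=\sum\mathbf x_{i_1}\cdots\mathbf x_{i_n}$ over tuples of positive integers with $i_j=i_k$ iff $j,k$ lie in the same block of $\pi$; $\mathbf p_\pi=\sum\mathbf x_{i_1}\cdots\mathbf x_{i_n}$ over tuples with $i_j=i_k$ whenever $j,k$ lie in the same block of $\pi$; $\mathbf e_\pi=\sum\mathbf x_{i_1}\cdots\mathbf x_{i_n}$ over tuples with $i_j\ne i_k$ whenever $j\ne k$ lie in the same block; $\mathbf h_\pi=\sum c\,\mathbf x_{i_1}\cdots\mathbf x_{i_n}$ where the coefficient $c$ of a tuple is $\prod_{b,v}(\#\{j\in\pi_b:i_j=v\})!$. $\mathrm{NCSym}$ is the span of all $\mathbf m_\pi$; $\omega:\mathrm{NCSym}\to\mathrm{NCSym}$ is the linear involution with $\omega(\mathbf h_\pi)=\mathbf e_\pi$.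 $\mathrm{NCSym}\subseteq\mathrm{NCQSym}$, where for a set composition $\phi$ of $[n]$ (sequence of disjoint nonempty blocks with union $[n]$) $\mathbf M_\phi=\sum\mathbf x_{i_1}\cdots\mathbf x_{i_n}$ over tuples with $i_j=i_k$ iff $j,k$ in the same block and $i_j<i_k$ iff the block of $j$ is left of that of $k$, and $\mathrm{NCQSym}$ is the span of all $\mathbf M_\phi$. For $A=\{a_1<\dots<a_k\}\subseteq[n-1]$ and $\sigma\in\mathfrak S_n$, $\mathbf F_{(A,\sigma)}=\sum_f\mathbf x_{f(\sigma^{ -1}(1))}\cdots\mathbf x_{f(\sigma^{ -1}(n))}$ over weakly increasing $f:[n]\to\{1,2,\dots\}$ with $f(i)<f(i+1)$ for $i\in A$; these with $\mathrm{Des}(\sigma)=\{i:\sigma(i)>\sigma(i+1)\}\subseteq A$ form a basis of $\mathrm{NCQSym}$. Order nonzero integers by $-1\prec1\prec-2\prec2\prec\cdots$; for $\gamma,\sigma\in\mathfrak S_n$, $\mathbf K_{(\gamma,\sigma)}=\sum_f\mathbf x_{|f(\sigma^{ -1}(1))|}\cdots\mathbf x_{|f(\sigma^{ -1}(n))|}$ over $f:[n]\to\mathbb Z\setminus\{0\}$, $f(1)\preceq\cdots\preceq f(n)$, with $f(i)=f(i+1)>0\Rightarrow\gamma(i)<\gamma(i+1)$ and $f(i)=f(i+1)<0\Rightarrow\gamma(i)>\gamma(i+1)$; it depends only on $\mathrm{Peak}(\gamma)=\{i:\gamma(i-1)<\gamma(i)>\gamma(i+1)\}$ and $\sigma$,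 so $\mathbf K_{(B,\sigma)}$ is defined for each peak set $B$ (subset of $\{2,\dots,n-1\}$ without consecutive integers). $\Theta_{\mathrm{NCQSym}}$ is the linear map on $\mathrm{NCQSym}$ with $\mathbf F_{(A,\sigma)}\mapsto\mathbf K_{(A\setminus((A+1)\cup\{1\}),\sigma)}$ for $\mathrm{Des}(\sigma)\subseteq A$ ($A+1=\{a+1:a\in A\}$), and $\Theta_{\mathrm{NCSym}}$ is its restriction to $\mathrm{NCSym}$. -}

module Defs where

open import Data.Bool using (Bool; true; false; if_then_else_)
open import Data.Nat as ℕ using (ℕ; zero; suc; _<_; _≤_; _!; _%_; _^_)
open import Data.Nat.Properties as ℕP using ()
open import Data.Fin using (Fin; toℕ; zero; suc)
open import Data.Fin.Properties using (all?; any?)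
open import Data.Fin.Permutation using (Permutation′; _⟨$⟩ʳ_)
open import Data.Integer using (+_)
open import Data.Rational using (ℚ; 0ℚ; _+_; _*_; _/_)
open import Data.List using (List; []; _∷_; map; allFin; upTo; foldr; length; filter)
open import Data.List.Relation.Unary.All using (All)
open import Data.Product using (Σ; _×_; _,_)
open import Relation.Nullary using (Dec; does; ¬_)
open import Relation.Nullary.Decidable using (_×-dec_; _→-dec_; _⊎-dec_; ¬?)
open import Relation.Binary.PropositionalEquality using (_≡_)

-- Conventions (0-indexed positions).
--  * Positions 1..n of the paper are Fin n (position i+1 ↦ i).
--  * Variable x_{k+1} is the letter k : ℕ.
--  * A homogeneous degree-n noncommutative series is its coefficient
--    function on words (Fin n → ℕ); two series are equal iff all
--    coefficients agree.

Word : ℕ → Set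
Word n = Fin n → ℕ

Series : ℕ → Set
Series n = Word n → ℚ

_≋_ : ∀ {n} → Series n → Series n → Set
x ≋ y = ∀ w → x w ≡ y w

infix 4 _≋_

ℕ→ℚ : ℕ → ℚ
ℕ→ℚ k = + k / 1

bool→ℚ : Bool → ℚ
bool→ℚ true  = ℕ→ℚ 1
bool→ℚ false = 0ℚ

sumℚ : List ℚ → ℚ
sumℚ = foldr _+_ 0ℚ

sumℕ : List ℕ → ℕ
sumℕ = foldr ℕ._+_ 0

prodℕ : List ℕ → ℕ
prodℕ = foldr ℕ._*_ 1

countFin : ∀ {n} {P : Fin n → Set} → ((i : Fin n) → Dec (P i)) → ℕ
countFin {n} P? = length (filter P? (allFin n))

Next : ∀ {n} → Fin n → Fin n → Set
Next i j = toℕ j ≡ suc (toℕ i)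

record SetPartition (n : ℕ) : Set where
  field
    ℓ    : ℕ
    blk  : Fin n → Fin ℓ
    surj : ∀ (b : Fin ℓ) → Σ (Fin n) λ j → blk j ≡ b

open SetPartition public

blockSize : ∀ {n} (π : SetPartition n) → Fin (ℓ π) → ℕ
blockSize π b = countFin (λ j → blk π j Data.Fin.≟ b)

AllBlocksOdd : ∀ {n} → SetPartition n → Set
AllBlocksOdd π = ∀ b → blockSize π b % 2 ≡ 1

mCoeff : ∀ {n} → SetPartition n → Series n
mCoeff π w = bool→ℚ (does (all? λ j → all? λ k →
  ((blk π j Data.Fin.≟ blk π k) →-dec (w j ℕ.≟ w k))
  ×-dec ((w j ℕ.≟ w k) →-dec (blk π j Data.Fin.≟ blk π k))))

pCoeff : ∀ {n} → SetPartition n → Series n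
pCoeff π w = bool→ℚ (does (all? λ j → all? λ k →
  (blk π j Data.Fin.≟ blk π k) →-dec (w j ℕ.≟ w k)))

eCoeff : ∀ {n} → SetPartition n → Series n
eCoeff π w = bool→ℚ (does (all? λ j → all? λ k →
  (¬? (j Data.Fin.≟ k) ×-dec (blk π j Data.Fin.≟ blk π k)) →-dec ¬? (w j ℕ.≟ w k)))

-- coefficient of w in h_π : ∏_{b,v} (#{j ∈ π_b : w_j = v})!
-- (v ranges over 0..Σ w, which contains every letter of w; other v give 0! = 1)
hCoeff : ∀ {n} → SetPartition n → Series n
hCoeff {n} π w = ℕ→ℚ (prodℕ (map (λ b → prodℕ (map (λ v →
  (countFin (λ j → (blk π j Data.Fin.≟ b) ×-dec (w j ℕ.≟ v))) !)
  (upTo (suc (sumℕ (map w (allFin n)))))))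
  (allFin (ℓ π))))

record PTerm (n : ℕ) : Set where
  field
    coef : ℚ
    part : SetPartition n

open PTerm public

combo : ∀ {n} → (SetPartition n → Series n) → List (PTerm n) → Series n
combo b ts w = sumℚ (map (λ t → coef t * b (part t) w) ts)

InNCSym : ∀ {n} → Series n → Set
InNCSym {n} x = Σ (List (PTerm n)) λ ts → x ≋ combo mCoeff ts

OmegaOf : ∀ {n} → Series n → Series n → Set
OmegaOf {n} x y =
  (Σ (List (PTerm n)) λ ts → x ≋ combo hCoeff ts) ×
  (∀ ts → x ≋ combo hCoeff ts → combo eCoeff ts ≋ y)

-- NCQSym: fundamental basis F_(A,σ) and enriched K_(γ,σ).
-- A ⊆ [n-1] is encoded as A : Fin n → Bool, A i = true meaning
-- (paper) i+1 ∈ A, i.e. a strict step between positions i and i+1.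

GapSet : ∀ {n} → (Fin n → Bool) → Set
GapSet {n} A = ∀ i → A i ≡ true → suc (toℕ i) < n

DesIn : ∀ {n} → Permutation′ n → (Fin n → Bool) → Set
DesIn σ A = ∀ i j → Next i j → σ ⟨$⟩ʳ j Data.Fin.< σ ⟨$⟩ʳ i → A i ≡ true

-- coefficient of w in F_(A,σ): the unique f with w_{σ(k)} = f(k) must be
-- weakly increasing, strictly across the gaps in A
FCoeff : ∀ {n} → (Fin n → Bool) → Permutation′ n → Series n
FCoeff A σ w = bool→ℚ (does (all? λ i → all? λ j →
  (toℕ j ℕ.≟ suc (toℕ i)) →-dec
    ((f i ℕ.≤? f j) ×-dec ((A i Data.Bool.≟ true) →-dec (f i ℕ.<? f j)))))
  where f = λ k → w (σ ⟨$⟩ʳ k)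

-- all sign vectors Fin n → Bool (true = positive)
signs : (n : ℕ) → List (Fin n → Bool)
signs zero    = (λ ()) ∷ []
signs (suc n) = Data.List.concatMap (λ s → ext true s ∷ ext false s ∷ []) (signs n)
  where
  ext : Bool → (Fin n → Bool) → Fin (suc n) → Bool
  ext b s zero    = b
  ext b s (suc i) = s i

-- the nonzero integer ±(v+1) is encoded as (v , sign); order
-- -1 ≺ 1 ≺ -2 ≺ 2 ≺ ⋯ ; this is the relation ⪯
_⪯?_ : (a b : ℕ × Bool) → Dec _
(v , s) ⪯? (v′ , s′) = (v ℕ.<? v′) ⊎-dec ((v ℕ.≟ v′) ×-dec
  ((s Data.Bool.≟ false) ⊎-dec (s′ Data.Bool.≟ true)))

-- coefficient of w in K_(γ,σ): number of f : [n] → ℤ∖0 with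
-- |f(k)| = w_{σ(k)} (i.e. x_{|f(σ⁻¹(j))|} at position j), f weakly
-- ⪯-increasing, ties positive ⇒ γ ascent, ties negative ⇒ γ descent
KCoeff : ∀ {n} → Permutation′ n → Permutation′ n → Series n
KCoeff {n} γ σ w = ℕ→ℚ (length (filter ok? (signs n)))
  where
  v : Fin n → ℕ
  v k = w (σ ⟨$⟩ʳ k)
  ok? : (s : Fin n → Bool) → Dec _
  ok? s = all? λ i → all? λ j →
    (toℕ j ℕ.≟ suc (toℕ i)) →-dec
      (((v i , s i) ⪯? (v j , s j)) ×-dec
       (((v i ℕ.≟ v j) ×-dec (s i Data.Bool.≟ true) ×-dec (s j Data.Bool.≟ true))
          →-dec (γ ⟨$⟩ʳ i Data.Fin.<? γ ⟨$⟩ʳ j)) ×-dec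
       (((v i ℕ.≟ v j) ×-dec (s i Data.Bool.≟ false) ×-dec (s j Data.Bool.≟ false))
          →-dec (γ ⟨$⟩ʳ j Data.Fin.<? γ ⟨$⟩ʳ i)))

IsPeak : ∀ {n} → Permutation′ n → Fin n → Set
IsPeak {n} γ p = Σ (Fin n) λ i → Σ (Fin n) λ j →
  Next i p × Next p j × γ ⟨$⟩ʳ i Data.Fin.< γ ⟨$⟩ʳ p × γ ⟨$⟩ʳ j Data.Fin.< γ ⟨$⟩ʳ p

-- p (0-indexed, paper position p+1) lies in A ∖ ((A+1) ∪ {1})
InPeakOf : ∀ {n} → (Fin n → Bool) → Fin n → Set
InPeakOf {n} A p = A p ≡ true × Σ (Fin n) λ i → Next i p × A i ≡ false

-- a term c·F_(A,σ) of an F-expansion, together with a permutation γ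
-- with Peak(γ) = A ∖ ((A+1) ∪ {1}) used to name its Θ-image K_(γ,σ)
record FTerm (n : ℕ) : Set where
  field
    fcoef : ℚ
    gaps  : Fin n → Bool
    perm  : Permutation′ n
    pkPerm : Permutation′ n

open FTerm public

ValidFTerm : ∀ {n} → FTerm n → Set
ValidFTerm t = GapSet (gaps t) × DesIn (perm t) (gaps t) ×
  (∀ p → (IsPeak (pkPerm t) p → InPeakOf (gaps t) p) × (InPeakOf (gaps t) p → IsPeak (pkPerm t) p))

FExpansion : ∀ {n} → Series n → List (FTerm n) → Set
FExpansion x ts = All ValidFTerm ts × (x ≋ λ w → sumℚ (map (λ t → fcoef t * FCoeff (gaps t) (perm t) w) ts))

ThetaImage : ∀ {n} → List (FTerm n) → Series n
ThetaImage ts w = sumℚ (map (λ t → fcoef t * KCoeff (pkPerm t) (perm t) w) ts)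

ThetaOf : ∀ {n} → Series n → Series n → Set
ThetaOf {n} x y =
  (Σ (List (FTerm n)) λ ts → FExpansion x ts) ×
  (∀ ts → FExpansion x ts → ThetaImage ts ≋ y)

-- Θ and ω are both values at N = −1 of polynomial substitutions. Replace every letter by
-- N ordered copies of weight −1, followed (for Θ) by one copy of weight +1, and take the
-- coefficient of w in the resulting series; for the series at hand it is a polynomial in N.
-- On p_π it factors over the blocks: a block of size e contributes 1 + (−1)^e N for Θ and
-- (−1)^e N for ω. Hence p_π is an eigenvector of both operators, the eigenvalue of Θ being
-- ∏ (1 − (−1)^e), and Θ and ω commute. On F_(A,σ) the polynomial is computed one position
-- at a time, and reciprocity (a weak inequality at N becomes a strict one at −N) turns the
-- N negative copies into the negative letters of K_(γ,σ). On h_π it is ∏_i (c_i + N) up to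
-- the sign (−1)^n, where c_i counts the later positions in the block of i carrying the same
-- letter, so its value at −1 is e_π. Since both operators are linear in the coefficients,
-- they do not depend on the chosen F- or h-expansion. Such expansions exist by Möbius
-- inversion over gap sets, respectively because h_π is a positive multiple of p_π plus p's
-- of finer partitions.

module Submission where

open import Algebra.Bundles using (CommutativeRing)
open import Algebra.Structures using (IsCommutativeRing)
open import Data.Bool as Bool using (Bool; true; false; if_then_else_; not; _∧_)
import Data.Bool.Properties as Boolₚ
open import Data.Fin as Fin using (Fin; zero; suc; toℕ; fromℕ; fromℕ<; punchIn; punchOut)
open import Data.Fin.Permutation as Perm using (Permutation′; permutation; _⟨$⟩ʳ_; _⟨$⟩ˡ_)
open import Data.Fin.Properties as Finₚ using (all?; any?; injective⇒≤)
import Data.Integer as ℤ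
import Data.Integer.Properties as ℤₚ
open import Data.List using (List; []; _∷_; _++_; map; filter; length; foldr; concatMap; tabulate; allFin; upTo; downFrom;
  cartesianProduct; cartesianProductWith)
open import Data.List.Membership.Propositional using (_∈_; find; lose)
open import Data.List.Membership.Propositional.Properties using (∈-downFrom⁻; ∈-downFrom⁺; ∈-upTo⁺; ∈-allFin; ∈-filter⁺;
  ∈-map⁺; ∈-concatMap⁺; ∈-cartesianProduct⁺)
open import Data.List.Properties using (length-tabulate; filter-notAll)
open import Data.List.Relation.Unary.All as All using (All; []; _∷_)
import Data.List.Relation.Unary.All.Properties as Allₚ
open import Data.List.Relation.Unary.AllPairs using ([]; _∷_)
open import Data.List.Relation.Unary.Any as Any using (Any; here; there)
open import Data.List.Relation.Unary.Unique.Propositional using (Unique)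
open import Data.List.Relation.Unary.Unique.Propositional.Properties using (downFrom⁺; upTo⁺; allFin⁺; cartesianProduct⁺)
open import Data.Nat as ℕ using (ℕ; zero; suc; 2+; _≤_; _<_; _^_; _!; _%_; z≤n; s≤s)
open import Data.Nat.Coprimality as Coprimality using (Coprime)
open import Data.Nat.Induction using (<-wellFounded)
import Data.Nat.Properties as ℕₚ
open import Data.Product using (Σ; _×_; _,_; proj₁; proj₂; ∃; ∃-syntax)
open import Data.Rational using (ℚ; 0ℚ; 1ℚ; _*_)
import Data.Rational as Rat
import Data.Rational.Properties as Ratₚ
open import Data.Sum using (_⊎_; inj₁; inj₂)
import Data.Vec.Functional as F
open import Defs
open import Function using (_∘_; mk⇔; Injective)
open import Induction.WellFounded using (Acc; acc)
open import Relation.Binary.Definitions using (DecidableEquality; tri<; tri≈; tri>)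
open import Relation.Binary.PropositionalEquality
open import Relation.Nullary using (Dec; yes; no; does; ¬_; contradiction)
open import Relation.Nullary.Decidable using (_×-dec_; _→-dec_; ¬?; dec-true; dec-false; decidable-stable)

-- N copies of weight -1 have e-th power sum (-1)^e N, which at N = -1 becomes -(-1)^e: the power
-- sum of a single letter of a superalphabet. With the positive copy placed after them, each letter
-- v turns into the pair -v ≺ v, which is the order used in K. The obstacle is that polynomiality in
-- N is available only for special series such as p, F and h, while independence of the chosen
-- expansion asks for one linear map on all series. Evaluation at -1 is therefore defined by
-- iterated differences of the values at N = 0, ..., n. This is linear on arbitrary sequences and
-- exact on polynomials of degree at most n, so each of the three families must meet that degree
-- bound. A sequence that includes its value at -1 is shifted by one: index i stands for N = i - 1.

private variable
  A B C P Q : Set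
  m n d e : ℕ
  p q : ℕ → ℚ

infixl 6 _+_
infixl 7 _·_
infix  8 -_

-- The operations of ℚ compute by matching on normalised fractions, which
-- makes them useless to the unifier; sealing them makes them injective.
opaque
  _+_ _·_ : ℚ → ℚ → ℚ
  _+_ = Rat._+_
  _·_ = Rat._*_

  -_ : ℚ → ℚ
  -_ = Rat.-_

  ·+-isCommutativeRing : IsCommutativeRing _≡_ _+_ _·_ -_ 0ℚ 1ℚ
  ·+-isCommutativeRing = Ratₚ.+-*-isCommutativeRing

  1-coprime : ∀ k → Coprime k 1
  1-coprime k = Coprimality.sym (Coprimality.1-coprimeTo k)

  ℕ→ℚ-suc : ∀ k → ℕ→ℚ (suc k) ≡ 1ℚ + ℕ→ℚ k
  ℕ→ℚ-suc k rewrite Ratₚ.normalize-coprime (1-coprime k) | ℕₚ.*-identityʳ k | ℤₚ.+◃n≡+n k = refl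

  ℕ→ℚ-invertible : ∀ k → ∃[ r ] r · ℕ→ℚ (suc k) ≡ 1ℚ
  ℕ→ℚ-invertible k = Rat.1/ 1+k , trans (cong (Rat.1/ 1+k Rat.*_) (Ratₚ.normalize-coprime (1-coprime (suc k)))) (Ratₚ.*-inverseˡ 1+k)
    where
    1+k : ℚ
    1+k = Rat.mkℚ (ℤ.+ suc k) 0 (1-coprime (suc k))

ℚ-ring : CommutativeRing _ _
ℚ-ring = record { isCommutativeRing = ·+-isCommutativeRing }

module Q = CommutativeRing ℚ-ring
open import Algebra.Solver.Ring.NaturalCoefficients.Default Q.commutativeSemiring
  using (solve; _:+_; _:*_; _:=_; con)
open import Algebra.Properties.Ring Q.ring
  using (-‿distribˡ-*; -‿distribʳ-*; -‿involutive; -‿+-comm)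
open import Algebra.Properties.Semiring.Exp Q.semiring using () renaming (_^_ to _^ℚ_)
open import Algebra.Properties.CommutativeMonoid.Sum Q.*-commutativeMonoid
  using () renaming (sum to ∏; ∑-comm to ∏-swap; sum-permute to ∏-permute; sum-cong-≗ to ∏-cong)
open import Algebra.Properties.CommutativeMonoid.Sum Q.+-commutativeMonoid
  using () renaming (sum to ∑ᶠ; sum-cong-≗ to ∑ᶠ-cong)
open ≡-Reasoning

-- Indicators, finite sums and finite products

ι : Dec P → ℚ
ι d = bool→ℚ (does d)

ι-true : (d : Dec P) → P → ι d ≡ 1ℚ
ι-true d p = cong bool→ℚ (dec-true d p)

ι-false : (d : Dec P) → ¬ P → ι d ≡ 0ℚ
ι-false d ¬p = cong bool→ℚ (dec-false d ¬p)

ι-cong : (d : Dec P) (e : Dec Q) → (P → Q) → (Q → P) → ι d ≡ ι e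
ι-cong (yes p) e f g = sym (ι-true e (f p))
ι-cong (no ¬p) e f g = sym (ι-false e (¬p ∘ g))

ι-× : (d : Dec P) (e : Dec Q) → ι (d ×-dec e) ≡ ι d · ι e
ι-× (yes _) e = sym (Q.*-identityˡ _)
ι-× (no _)  e = sym (Q.zeroˡ _)

∑ : List A → (A → ℚ) → ℚ
∑ xs f = foldr _+_ 0ℚ (map f xs)

∑-cong∈ : ∀ (xs : List A) {f g} → (∀ {x} → x ∈ xs → f x ≡ g x) → ∑ xs f ≡ ∑ xs g
∑-cong∈ []       eq = refl
∑-cong∈ (x ∷ xs) eq = cong₂ _+_ (eq (here refl)) (∑-cong∈ xs (eq ∘ there))

∑-cong : ∀ (xs : List A) {f g} → (∀ x → f x ≡ g x) → ∑ xs f ≡ ∑ xs g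
∑-cong xs eq = ∑-cong∈ xs (λ {x} _ → eq x)

∑-0 : ∀ (xs : List A) → ∑ xs (λ _ → 0ℚ) ≡ 0ℚ
∑-0 []       = refl
∑-0 (x ∷ xs) = trans (Q.+-identityˡ _) (∑-0 xs)

∑-+ : ∀ (xs : List A) f g → ∑ xs (λ x → f x + g x) ≡ ∑ xs f + ∑ xs g
∑-+ []       f g = sym (Q.+-identityˡ 0ℚ)
∑-+ (x ∷ xs) f g = trans (cong (f x + g x +_) (∑-+ xs f g))
  (solve 4 (λ a b c d → (a :+ b) :+ (c :+ d) := (a :+ c) :+ (b :+ d)) refl (f x) (g x) (∑ xs f) (∑ xs g))

·-∑ : ∀ c (xs : List A) f → c · ∑ xs f ≡ ∑ xs (λ x → c · f x)
·-∑ c []       f = Q.zeroʳ c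
·-∑ c (x ∷ xs) f = trans (Q.distribˡ c _ _) (cong (c · f x +_) (·-∑ c xs f))

∑-· : ∀ c (xs : List A) f → ∑ xs f · c ≡ ∑ xs (λ x → f x · c)
∑-· c []       f = Q.zeroˡ c
∑-· c (x ∷ xs) f = trans (Q.distribʳ c _ _) (cong (f x · c +_) (∑-· c xs f))

∑-swap : ∀ (xs : List A) (ys : List B) (f : A → B → ℚ) →
  ∑ xs (λ x → ∑ ys (f x)) ≡ ∑ ys (λ y → ∑ xs (λ x → f x y))
∑-swap []       ys f = sym (∑-0 ys)
∑-swap (x ∷ xs) ys f = trans (cong (∑ ys (f x) +_) (∑-swap xs ys f)) (sym (∑-+ ys _ _))

∑-++ : ∀ (xs ys : List A) f → ∑ (xs ++ ys) f ≡ ∑ xs f + ∑ ys f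
∑-++ []       ys f = sym (Q.+-identityˡ _)
∑-++ (x ∷ xs) ys f = trans (cong (f x +_) (∑-++ xs ys f)) (sym (Q.+-assoc (f x) _ _))

∑-map : ∀ (h : A → B) xs f → ∑ (map h xs) f ≡ ∑ xs (f ∘ h)
∑-map h []       f = refl
∑-map h (x ∷ xs) f = cong (f (h x) +_) (∑-map h xs f)

∑-concatMap : ∀ (h : A → List B) xs f → ∑ (concatMap h xs) f ≡ ∑ xs (λ x → ∑ (h x) f)
∑-concatMap h []       f = refl
∑-concatMap h (x ∷ xs) f = trans (∑-++ (h x) _ f) (cong (∑ (h x) f +_) (∑-concatMap h xs f))

∑-product : ∀ (h : A → B → C) xs ys f →
  ∑ (cartesianProductWith h xs ys) f ≡ ∑ xs (λ x → ∑ ys (λ y → f (h x y)))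
∑-product h []       ys f = refl
∑-product h (x ∷ xs) ys f = trans (∑-++ (map (h x) ys) _ f)
  (cong₂ _+_ (∑-map (h x) ys f) (∑-product h xs ys f))

∑-δ : ∀ {A : Set} {xs : List A} {a} (≟a : ∀ x → Dec (x ≡ a)) → Unique xs → a ∈ xs → ∀ (g : A → ℚ) →
  ∑ xs (λ x → ι (≟a x) · g x) ≡ g a
∑-δ {xs = x ∷ xs} ≟a (x∉ ∷ _) (here refl) g = begin
  ι (≟a x) · g x + ∑ xs (λ y → ι (≟a y) · g y)
    ≡⟨ cong₂ (λ c s → c · g x + s) (ι-true (≟a x) refl)
         (∑-cong∈ xs (λ {y} y∈ → trans (cong (_· g y) (ι-false (≟a y) (λ y≡x → All.lookup x∉ y∈ (sym y≡x)))) (Q.zeroˡ (g y)))) ⟩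
  1ℚ · g x + ∑ xs (λ _ → 0ℚ)
    ≡⟨ cong₂ _+_ (Q.*-identityˡ (g x)) (∑-0 xs) ⟩
  g x + 0ℚ
    ≡⟨ Q.+-identityʳ (g x) ⟩
  g x ∎
∑-δ {xs = x ∷ xs} {a} ≟a (x∉ ∷ u) (there a∈) g = begin
  ι (≟a x) · g x + ∑ xs (λ y → ι (≟a y) · g y)
    ≡⟨ cong₂ (λ c s → c · g x + s) (ι-false (≟a x) (All.lookup x∉ a∈)) (∑-δ ≟a u a∈ g) ⟩
  0ℚ · g x + g a
    ≡⟨ trans (cong (_+ g a) (Q.zeroˡ (g x))) (Q.+-identityˡ (g a)) ⟩
  g a ∎

∏-1 : ∀ {f : Fin n → ℚ} → (∀ i → f i ≡ 1ℚ) → ∏ f ≡ 1ℚ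
∏-1 {zero}  eq = refl
∏-1 {suc n} eq = trans (cong₂ _·_ (eq zero) (∏-1 (eq ∘ suc))) (Q.*-identityˡ 1ℚ)

∏-0 : ∀ {f : Fin n → ℚ} i → f i ≡ 0ℚ → ∏ f ≡ 0ℚ
∏-0 {suc n} {f} zero    eq = trans (cong (_· ∏ (f ∘ suc)) eq) (Q.zeroˡ _)
∏-0 {suc n} {f} (suc i) eq = trans (cong (f zero ·_) (∏-0 i eq)) (Q.zeroʳ _)

ι-all : {P : Fin n → Set} (P? : ∀ i → Dec (P i)) → ι (all? P?) ≡ ∏ (λ i → ι (P? i))
ι-all {zero}  P? = ι-true (all? P?) (λ ())
ι-all {suc n} P? = trans
  (ι-cong (all? P?) (P? zero ×-dec all? (P? ∘ suc)) (λ p → p zero , p ∘ suc) (λ { (p , q) zero → p ; (p , q) (suc i) → q i }))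
  (trans (ι-× (P? zero) (all? (P? ∘ suc))) (cong (ι (P? zero) ·_) (ι-all (P? ∘ suc))))

-- Sums over all words on a finite alphabet

funs : List A → ∀ n → List (Fin n → A)
funs xs zero    = F.[] ∷ []
funs xs (suc n) = cartesianProductWith F._∷_ xs (funs xs n)

∑-funs-suc : ∀ (xs : List A) n g → ∑ (funs xs (suc n)) g ≡ ∑ xs (λ x → ∑ (funs xs n) (λ d → g (x F.∷ d)))
∑-funs-suc xs n g = ∑-product F._∷_ xs (funs xs n) g

-- `funs` lists one representative of each function up to pointwise equality, so a summand can be
-- moved along a change of variable only if it respects that equality.
Extensional : ((Fin n → A) → ℚ) → Set
Extensional g = ∀ {d d′} → (∀ i → d i ≡ d′ i) → g d ≡ g d′

∑-funs-cong∈ : ∀ (xs : List A) n {f g : (Fin n → A) → ℚ} → (∀ d → (∀ i → d i ∈ xs) → f d ≡ g d) →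
  ∑ (funs xs n) f ≡ ∑ (funs xs n) g
∑-funs-cong∈ xs zero    eq = cong (_+ 0ℚ) (eq F.[] (λ ()))
∑-funs-cong∈ xs (suc n) {f} {g} eq = trans (∑-funs-suc xs n f) (trans
  (∑-cong∈ xs (λ {x} x∈ → ∑-funs-cong∈ xs n (λ d d∈ → eq (x F.∷ d) (λ { zero → x∈ ; (suc i) → d∈ i }))))
  (sym (∑-funs-suc xs n g)))

∑-funs-∏ : ∀ (xs : List A) n (φ : Fin n → A → ℚ) →
  ∑ (funs xs n) (λ d → ∏ (λ i → φ i (d i))) ≡ ∏ (λ i → ∑ xs (φ i))
∑-funs-∏ xs zero    φ = Q.+-identityʳ 1ℚ
∑-funs-∏ xs (suc n) φ = begin
  ∑ (funs xs (suc n)) (λ d → ∏ (λ i → φ i (d i)))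
    ≡⟨ ∑-funs-suc xs n _ ⟩
  ∑ xs (λ x → ∑ (funs xs n) (λ d → φ zero x · ∏ (λ i → φ (suc i) (d i))))
    ≡⟨ ∑-cong xs (λ x → sym (·-∑ (φ zero x) (funs xs n) _)) ⟩
  ∑ xs (λ x → φ zero x · ∑ (funs xs n) (λ d → ∏ (λ i → φ (suc i) (d i))))
    ≡⟨ ∑-cong xs (λ x → cong (φ zero x ·_) (∑-funs-∏ xs n (φ ∘ suc))) ⟩
  ∑ xs (λ x → φ zero x · ∏ (λ i → ∑ xs (φ (suc i))))
    ≡⟨ sym (∑-· _ xs (φ zero)) ⟩
  ∑ xs (φ zero) · ∏ (λ i → ∑ xs (φ (suc i))) ∎

module _ (_≟_ : DecidableEquality A) where

  infix 4 _≗?_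
  _≗?_ : (d e : Fin n → A) → Dec (∀ i → d i ≡ e i)
  d ≗? e = all? (λ i → d i ≟ e i)

  -- Changes of variable on words insert this delta and swap the two sums, which replaces bijections
  -- between lists.
  ∑-funs-δ : ∀ {xs : List A} → Unique xs → ∀ {n} (e : Fin n → A) → (∀ i → e i ∈ xs) →
    ∀ {g} → Extensional g → ∑ (funs xs n) (λ d → ι (d ≗? e) · g d) ≡ g e
  ∑-funs-δ u {zero} e e∈ {g} ext = begin
    ι (F.[] ≗? e) · g F.[] + 0ℚ ≡⟨ Q.+-identityʳ _ ⟩
    ι (F.[] ≗? e) · g F.[]      ≡⟨ cong (_· g F.[]) (ι-true (F.[] ≗? e) (λ ())) ⟩
    1ℚ · g F.[]                 ≡⟨ Q.*-identityˡ _ ⟩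
    g F.[]                      ≡⟨ ext (λ ()) ⟩
    g e                         ∎
  ∑-funs-δ {xs} u {suc n} e e∈ {g} ext = begin
    ∑ (funs xs (suc n)) (λ d → ι (d ≗? e) · g d)
      ≡⟨ ∑-funs-suc xs n _ ⟩
    ∑ xs (λ x → ∑ (funs xs n) (λ d → ι ((x F.∷ d) ≗? e) · g (x F.∷ d)))
      ≡⟨ ∑-cong xs (λ x → ∑-cong (funs xs n) (λ d → trans (cong (_· g (x F.∷ d)) (split x d)) (Q.*-assoc (ι (x ≟ e zero)) _ _))) ⟩
    ∑ xs (λ x → ∑ (funs xs n) (λ d → ι (x ≟ e zero) · (ι (d ≗? (e ∘ suc)) · g (x F.∷ d))))
      ≡⟨ ∑-cong xs (λ x → trans (sym (·-∑ (ι (x ≟ e zero)) (funs xs n) _))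
           (cong (ι (x ≟ e zero) ·_) (∑-funs-δ u (e ∘ suc) (e∈ ∘ suc) (λ eq → ext (λ { zero → refl ; (suc i) → eq i }))))) ⟩
    ∑ xs (λ x → ι (x ≟ e zero) · g (x F.∷ (e ∘ suc)))
      ≡⟨ ∑-δ (_≟ e zero) u (e∈ zero) (λ x → g (x F.∷ (e ∘ suc))) ⟩
    g (e zero F.∷ (e ∘ suc))
      ≡⟨ ext (λ { zero → refl ; (suc i) → refl }) ⟩
    g e ∎
    where
    split : ∀ x d → ι ((x F.∷ d) ≗? e) ≡ ι (x ≟ e zero) · ι (d ≗? (e ∘ suc))
    split x d = trans
      (ι-cong ((x F.∷ d) ≗? e) ((x ≟ e zero) ×-dec (d ≗? (e ∘ suc)))
        (λ eq → eq zero , eq ∘ suc) (λ { (p , q) zero → p ; (p , q) (suc i) → q i }))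
      (ι-× (x ≟ e zero) (d ≗? (e ∘ suc)))

-- Polynomial sequences and extrapolation

Δ : (ℕ → ℚ) → ℕ → ℚ
Δ q i = q (suc i) + - q i

-- q is the restriction of a polynomial of degree at most d.
Poly : ℕ → (ℕ → ℚ) → Set
Poly zero    q = ∀ i → q (suc i) ≡ q i
Poly (suc d) q = Poly d (Δ q)

-- The value at −1 of the polynomial of degree at most d through q 0, …, q d.
extrapolate : ℕ → (ℕ → ℚ) → ℚ
extrapolate zero    q = q 0
-- For a polynomial, q(-1) = q(0) - Δq(-1), and Δ lowers the degree by one.
extrapolate (suc d) q = q 0 + - extrapolate d (Δ q)

+-cancel-neg : ∀ a b → a + - (a + - b) ≡ b
+-cancel-neg a b = begin
  a + - (a + - b)     ≡⟨ cong (a +_) (sym (-‿+-comm a (- b))) ⟩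
  a + (- a + - - b)   ≡⟨ sym (Q.+-assoc a (- a) _) ⟩
  a + - a + - - b     ≡⟨ cong₂ _+_ (Q.-‿inverseʳ a) (-‿involutive b) ⟩
  0ℚ + b              ≡⟨ Q.+-identityˡ b ⟩
  b                   ∎

-- Sequences are read with an index shift: q 0 is the value at −1.
extrapolate-Poly : ∀ d → Poly d q → extrapolate d (q ∘ suc) ≡ q 0
extrapolate-Poly         zero    h = h 0
extrapolate-Poly {q = q} (suc d) h = trans (cong (λ t → q 1 + - t) (extrapolate-Poly d h)) (+-cancel-neg (q 1) (q 0))

extrapolate-cong : ∀ d → (∀ i → p i ≡ q i) → extrapolate d p ≡ extrapolate d q
extrapolate-cong zero    eq = eq 0
extrapolate-cong (suc d) eq = cong₂ (λ a b → a + - b) (eq 0)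
  (extrapolate-cong d (λ i → cong₂ (λ a b → a + - b) (eq (suc i)) (eq i)))

+-interchange-neg : ∀ a b c d → (a + b) + - (c + d) ≡ (a + - c) + (b + - d)
+-interchange-neg a b c d = trans (cong (a + b +_) (sym (-‿+-comm c d)))
  (solve 4 (λ a b c d → (a :+ b) :+ (c :+ d) := (a :+ c) :+ (b :+ d)) refl a b (- c) (- d))

·-distribˡ-neg : ∀ c a b → c · (a + - b) ≡ c · a + - (c · b)
·-distribˡ-neg c a b = trans (Q.distribˡ c a (- b)) (cong (c · a +_) (sym (-‿distribʳ-* c b)))

extrapolate-+ : ∀ d p q → extrapolate d (λ i → p i + q i) ≡ extrapolate d p + extrapolate d q
extrapolate-+ zero    p q = refl
extrapolate-+ (suc d) p q = begin
  p 0 + q 0 + - extrapolate d (Δ (λ i → p i + q i))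
    ≡⟨ cong (λ t → p 0 + q 0 + - t) (trans (extrapolate-cong d (λ i → +-interchange-neg (p (suc i)) _ _ _)) (extrapolate-+ d (Δ p) (Δ q))) ⟩
  p 0 + q 0 + - (extrapolate d (Δ p) + extrapolate d (Δ q))
    ≡⟨ +-interchange-neg (p 0) (q 0) _ _ ⟩
  extrapolate (suc d) p + extrapolate (suc d) q ∎

extrapolate-· : ∀ d c q → extrapolate d (λ i → c · q i) ≡ c · extrapolate d q
extrapolate-· zero    c q = refl
extrapolate-· (suc d) c q = begin
  c · q 0 + - extrapolate d (Δ (λ i → c · q i))
    ≡⟨ cong (λ t → c · q 0 + - t) (trans (extrapolate-cong d (λ i → sym (·-distribˡ-neg c (q (suc i)) (q i)))) (extrapolate-· d c (Δ q))) ⟩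
  c · q 0 + - (c · extrapolate d (Δ q))
    ≡⟨ sym (·-distribˡ-neg c (q 0) _) ⟩
  c · extrapolate (suc d) q ∎

extrapolate-0 : ∀ d → extrapolate d (λ _ → 0ℚ) ≡ 0ℚ
extrapolate-0 d = trans (extrapolate-cong d (λ _ → sym (Q.zeroˡ 0ℚ))) (trans (extrapolate-· d 0ℚ (λ _ → 0ℚ)) (Q.zeroˡ _))

-- Holds for arbitrary sequences, polynomial or not; this makes the operators linear on all series.
extrapolate-∑ : ∀ {A : Set} d (xs : List A) (c : A → ℚ) (f : A → ℕ → ℚ) →
  extrapolate d (λ i → ∑ xs (λ x → c x · f x i)) ≡ ∑ xs (λ x → c x · extrapolate d (f x))
extrapolate-∑ d []       c f = extrapolate-0 d
extrapolate-∑ d (x ∷ xs) c f = trans (extrapolate-+ d _ _) (cong₂ _+_ (extrapolate-· d (c x) (f x)) (extrapolate-∑ d xs c f))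

Poly-cong : ∀ d → (∀ i → p i ≡ q i) → Poly d p → Poly d q
Poly-cong zero    eq h i = trans (sym (eq (suc i))) (trans (h i) (eq i))
Poly-cong (suc d) eq h = Poly-cong d (λ i → cong₂ (λ a b → a + - b) (eq (suc i)) (eq i)) h

Poly-shift : ∀ d → Poly d q → Poly d (q ∘ suc)
Poly-shift zero    h = h ∘ suc
Poly-shift {q = q} (suc d) h = Poly-shift {q = Δ q} d h

Poly-suc : ∀ d → Poly d q → Poly (suc d) q
Poly-suc {q = q} zero    h i = trans (Δ≡0 (suc i)) (sym (Δ≡0 i))
  where
  Δ≡0 : ∀ i → Δ q i ≡ 0ℚ
  Δ≡0 i = trans (cong (_+ - q i) (h i)) (Q.-‿inverseʳ (q i))
Poly-suc {q = q} (suc d) h = Poly-suc {q = Δ q} d h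

Poly-≤ : d ≤ e → Poly d q → Poly e q
Poly-≤ = Poly-≤′ ∘ ℕₚ.≤⇒≤′
  where
  Poly-≤′ : ∀ {d e q} → d ℕ.≤′ e → Poly d q → Poly e q
  Poly-≤′ (ℕ.≤′-reflexive refl) h = h
  Poly-≤′ {d} {suc e} {q} (ℕ.≤′-step d≤e) h = Poly-suc {q} e (Poly-≤′ {d} {e} {q} d≤e h)

Poly-+ : ∀ d → Poly d p → Poly d q → Poly d (λ i → p i + q i)
Poly-+ zero    g h i = cong₂ _+_ (g i) (h i)
Poly-+ {p} (suc d) g h = Poly-cong d (λ i → sym (+-interchange-neg (p (suc i)) _ _ _)) (Poly-+ d g h)

Poly-scale : ∀ d c → Poly d q → Poly d (λ i → c · q i)
Poly-scale zero    c h i = cong (c ·_) (h i)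
Poly-scale (suc d) c h = Poly-cong d (λ i → ·-distribˡ-neg c _ _) (Poly-scale d c h)

Poly-const : ∀ d c → Poly d (λ _ → c)
Poly-const d c = Poly-≤ {0} {d} ℕ.z≤n (λ _ → refl)

Poly-0-const : Poly 0 q → ∀ i → q i ≡ q 0
Poly-0-const h zero    = refl
Poly-0-const h (suc i) = trans (h i) (Poly-0-const h i)

Δ-· : ∀ p q i → Δ (λ j → p j · q j) i ≡ p (suc i) · Δ q i + Δ p i · q i
Δ-· p q i = begin
  p′ · q′ + - (p₀ · q₀)
    ≡⟨ cong (_+ - (p₀ · q₀)) (sym (trans (cong (p′ · q′ +_) (Q.-‿inverseˡ (p′ · q₀))) (Q.+-identityʳ _))) ⟩
  p′ · q′ + (- (p′ · q₀) + p′ · q₀) + - (p₀ · q₀)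
    ≡⟨ solve 4 (λ a b c d → (a :+ (b :+ c)) :+ d := (a :+ b) :+ (c :+ d)) refl (p′ · q′) _ _ _ ⟩
  (p′ · q′ + - (p′ · q₀)) + (p′ · q₀ + - (p₀ · q₀))
    ≡⟨ cong₂ _+_ (sym (·-distribˡ-neg p′ q′ q₀)) (trans (cong (p′ · q₀ +_) (-‿distribˡ-* p₀ q₀)) (sym (Q.distribʳ q₀ p′ (- p₀)))) ⟩
  p′ · (q′ + - q₀) + (p′ + - p₀) · q₀ ∎
  where
  p′ = p (suc i)
  p₀ = p i
  q′ = q (suc i)
  q₀ = q i

-- By the product rule for Δ, one factor loses a degree in each summand, while the shifted factor
-- keeps its own.
Poly-· : ∀ d e → Poly d p → Poly e q → Poly (d ℕ.+ e) (λ i → p i · q i)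
Poly-· {p} {q} zero e g h = Poly-cong e (λ i → cong (_· q i) (sym (Poly-0-const g i))) (Poly-scale e (p 0) h)
Poly-· {p} {q} (suc d) zero g h = Poly-cong (suc d ℕ.+ 0)
  (λ i → trans (Q.*-comm (q 0) (p i)) (cong (p i ·_) (sym (Poly-0-const h i))))
  (subst (λ k → Poly k (λ i → q 0 · p i)) (sym (ℕₚ.+-identityʳ (suc d))) (Poly-scale {p} (suc d) (q 0) g))
Poly-· {p} {q} (suc d) (suc e) g h = Poly-cong (d ℕ.+ suc e) (λ i → sym (Δ-· p q i))
  (Poly-+ (d ℕ.+ suc e)
    (subst (λ k → Poly k (λ i → p (suc i) · Δ q i)) (sym (ℕₚ.+-suc d e)) (Poly-· (suc d) e (Poly-shift {p} (suc d) g) h))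
    (Poly-· d (suc e) g h))

Poly-∏ : ∀ n {q : Fin n → ℕ → ℚ} → (∀ b → Poly 1 (q b)) → Poly n (λ i → ∏ (λ b → q b i))
Poly-∏ zero    h i = refl
Poly-∏ (suc n) h = Poly-· 1 n (h zero) (Poly-∏ n (h ∘ suc))

-- Normalised to vanish at index 1, the argument 0, where a sum over smaller letters is empty. One
-- step further left, at the argument -1, its value is -f(-1); this sign is the source of
-- reciprocity.
antidifference : (ℕ → ℚ) → ℕ → ℚ
antidifference f i = ∑ (downFrom i) f + - f 0

Δ-antidifference : ∀ f i → Δ (antidifference f) i ≡ f i
Δ-antidifference f i = begin
  (f i + s + - f 0) + - (s + - f 0)   ≡⟨ cong (_+ - (s + - f 0)) (Q.+-assoc (f i) s _) ⟩
  (f i + (s + - f 0)) + - (s + - f 0) ≡⟨ Q.+-assoc (f i) _ _ ⟩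
  f i + ((s + - f 0) + - (s + - f 0)) ≡⟨ cong (f i +_) (Q.-‿inverseʳ _) ⟩
  f i + 0ℚ                            ≡⟨ Q.+-identityʳ (f i) ⟩
  f i                                 ∎
  where s = ∑ (downFrom i) f

antidifference-0 : ∀ f → antidifference f 0 ≡ - f 0
antidifference-0 f = Q.+-identityˡ _

antidifference-1 : ∀ f → antidifference f 1 ≡ 0ℚ
antidifference-1 f = trans (cong (_+ - f 0) (Q.+-identityʳ (f 0))) (Q.-‿inverseʳ (f 0))

Poly-antidifference : ∀ d {f} → Poly d f → Poly (suc d) (antidifference f)
Poly-antidifference d {f} h = Poly-cong d (λ i → sym (Δ-antidifference f i)) h

-- In the shifted indexing `a` is the value at N = -1 and `c` the slope.
affine : ℚ → ℚ → ℕ → ℚ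
affine a c i = a + ℕ→ℚ i · c

affine-suc : ∀ a c i → affine a c (suc i) ≡ c + affine a c i
affine-suc a c i = begin
  a + ℕ→ℚ (suc i) · c       ≡⟨ cong (λ t → a + t · c) (ℕ→ℚ-suc i) ⟩
  a + (1ℚ + ℕ→ℚ i) · c      ≡⟨ solve 3 (λ a c t → a :+ (con 1 :+ t) :* c := c :+ (a :+ t :* c)) refl a c (ℕ→ℚ i) ⟩
  c + (a + ℕ→ℚ i · c)       ∎

affine-0 : ∀ a c → affine a c 0 ≡ a
affine-0 a c = trans (cong (a +_) (Q.zeroˡ c)) (Q.+-identityʳ a)

Poly-affine : ∀ a c → Poly 1 (affine a c)
Poly-affine a c i = trans (Δ≡c (suc i)) (sym (Δ≡c i))
  where
  Δ≡c : ∀ i → Δ (affine a c) i ≡ c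
  Δ≡c i = trans (cong (_+ - affine a c i) (affine-suc a c i)) (trans (Q.+-assoc c _ _)
    (trans (cong (c +_) (Q.-‿inverseʳ _)) (Q.+-identityʳ c)))

-- Substitution operators and their action on the p-basis

-- Copy d of the letter a is coded as a K + d, so that order and equality of refined letters are
-- lexicographic as long as copies stay below K.
lex-< : ∀ K {a b c d} → a < c → b < K → a ℕ.* K ℕ.+ b < c ℕ.* K ℕ.+ d
lex-< K {a} {b} {c} {d} a<c b<K = ℕₚ.<-≤-trans
  (ℕₚ.+-monoʳ-< (a ℕ.* K) b<K)
  (ℕₚ.≤-trans (ℕₚ.≤-reflexive (ℕₚ.+-comm (a ℕ.* K) K))
    (ℕₚ.≤-trans (ℕₚ.*-monoˡ-≤ K a<c) (ℕₚ.m≤m+n (c ℕ.* K) d)))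

lex-injective : ∀ K {a b c d} → b < K → d < K → a ℕ.* K ℕ.+ b ≡ c ℕ.* K ℕ.+ d → a ≡ c × b ≡ d
lex-injective K {a} {b} {c} {d} b<K d<K eq with ℕₚ.<-cmp a c
... | tri< a<c _ _ = contradiction eq (ℕₚ.<⇒≢ (lex-< K a<c b<K))
... | tri> _ _ c<a = contradiction (sym eq) (ℕₚ.<⇒≢ (lex-< K c<a d<K))
... | tri≈ _ refl _ = refl , ℕₚ.+-cancelˡ-≡ (a ℕ.* K) b d eq

∏-indicator : ∀ (a : Fin n → ℚ) c → ∏ (λ b → if does (c Fin.≟ b) then a b else 1ℚ) ≡ a c
∏-indicator {suc n} a zero    = trans (cong (a zero ·_) (∏-1 {n} (λ _ → refl))) (Q.*-identityʳ _)
∏-indicator {suc n} a (suc c) = trans (Q.*-identityˡ _) (∏-indicator (a ∘ suc) c)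

∏-count : ∀ {A : Set} {P : A → Set} (P? : ∀ x → Dec (P x)) (f : Fin n → A) c →
  ∏ (λ j → if does (P? (f j)) then c else 1ℚ) ≡ c ^ℚ length (filter P? (tabulate f))
∏-count {zero}  P? f c = refl
∏-count {suc n} P? f c with P? (f zero)
... | yes _ = cong (c ·_) (∏-count P? (f ∘ suc) c)
... | no  _ = trans (Q.*-identityˡ _) (∏-count P? (f ∘ suc) c)

∏-blocks : ∀ (π : SetPartition n) (a : Fin (ℓ π) → ℚ) → ∏ (λ j → a (blk π j)) ≡ ∏ (λ b → a b ^ℚ blockSize π b)
∏-blocks π a = begin
  ∏ (λ j → a (blk π j))
    ≡⟨ ∏-cong (λ j → sym (∏-indicator a (blk π j))) ⟩
  ∏ (λ j → ∏ (λ b → if does (blk π j Fin.≟ b) then a b else 1ℚ))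
    ≡⟨ ∏-swap (λ j b → if does (blk π j Fin.≟ b) then a b else 1ℚ) ⟩
  ∏ (λ b → ∏ (λ j → if does (blk π j Fin.≟ b) then a b else 1ℚ))
    ≡⟨ ∏-cong (λ b → ∏-count (λ j → blk π j Fin.≟ b) (λ j → j) (a b)) ⟩
  ∏ (λ b → a b ^ℚ blockSize π b) ∎

module _ {n} (π : SetPartition n) where

  rep : Fin (ℓ π) → Fin n
  rep b = proj₁ (surj π b)

  blk-rep : ∀ b → blk π (rep b) ≡ b
  blk-rep b = proj₂ (surj π b)

  Constant : Word n → Set
  Constant w = ∀ j k → blk π j ≡ blk π k → w j ≡ w k

  constant? : ∀ w → Dec (Constant w)
  constant? w = all? λ j → all? λ k → (blk π j Fin.≟ blk π k) →-dec (w j ℕ.≟ w k)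

  -- Bounds the degree in N of a product with one affine factor per block, so that extrapolation of
  -- degree n is exact on it.
  ℓ≤n : ℓ π ≤ n
  ℓ≤n = injective⇒≤ {f = rep} (λ {b} {c} eq → trans (sym (blk-rep b)) (trans (cong (blk π) eq) (blk-rep c)))

  -- A word constant on the blocks is a free choice of one letter per block, so the weighted sum
  -- factors into power sums.
  ∑-pCoeff : ∀ K (φ : ℕ → ℚ) →
    ∑ (funs (downFrom K) n) (λ d → pCoeff π d · ∏ (λ j → φ (d j)))
      ≡ ∏ (λ b → ∑ (downFrom K) (λ k → φ k ^ℚ blockSize π b))
  ∑-pCoeff K φ = begin
    ∑ (funs L n) (λ d → pCoeff π d · G d)
      ≡⟨ ∑-funs-cong∈ L n expand ⟩
    ∑ (funs L n) (λ d → ∑ (funs L (ℓ π)) (λ c → ι (_≗?_ ℕ._≟_ d (c ∘ blk π)) · G d))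
      ≡⟨ ∑-swap (funs L n) (funs L (ℓ π)) _ ⟩
    ∑ (funs L (ℓ π)) (λ c → ∑ (funs L n) (λ d → ι (_≗?_ ℕ._≟_ d (c ∘ blk π)) · G d))
      ≡⟨ ∑-funs-cong∈ L (ℓ π) (λ c c∈ → ∑-funs-δ ℕ._≟_ (downFrom⁺ K) (c ∘ blk π) (c∈ ∘ blk π) G-ext) ⟩
    ∑ (funs L (ℓ π)) (λ c → G (c ∘ blk π))
      ≡⟨ ∑-cong (funs L (ℓ π)) (λ c → ∏-blocks π (φ ∘ c)) ⟩
    ∑ (funs L (ℓ π)) (λ c → ∏ (λ b → φ (c b) ^ℚ blockSize π b))
      ≡⟨ ∑-funs-∏ L (ℓ π) (λ b k → φ k ^ℚ blockSize π b) ⟩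
    ∏ (λ b → ∑ L (λ k → φ k ^ℚ blockSize π b)) ∎
    where
    L : List ℕ
    L = downFrom K
    G : (Fin n → ℕ) → ℚ
    G d = ∏ (λ j → φ (d j))
    G-ext : Extensional G
    G-ext eq = ∏-cong (λ j → cong φ (eq j))
    expand : ∀ d → (∀ j → d j ∈ L) →
      pCoeff π d · G d ≡ ∑ (funs L (ℓ π)) (λ c → ι (_≗?_ ℕ._≟_ d (c ∘ blk π)) · G d)
    expand d d∈ = go (constant? d)
      where
      go : (c : Dec (Constant d)) → ι c · G d ≡ ∑ (funs L (ℓ π)) (λ c → ι (_≗?_ ℕ._≟_ d (c ∘ blk π)) · G d)
      go (yes const) = sym (begin
        ∑ (funs L (ℓ π)) (λ c → ι (_≗?_ ℕ._≟_ d (c ∘ blk π)) · G d)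
          -- For d constant on the blocks, `d ∘ rep` is the only choice of letters that induces d.
          ≡⟨ ∑-cong (funs L (ℓ π)) (λ c → cong (_· G d) (ι-cong (_≗?_ ℕ._≟_ d (c ∘ blk π)) (_≗?_ ℕ._≟_ c (d ∘ rep))
               (λ eq b → sym (trans (eq (rep b)) (cong c (blk-rep b))))
               (λ eq j → trans (const j (rep (blk π j)) (sym (blk-rep (blk π j)))) (sym (eq (blk π j)))))) ⟩
        ∑ (funs L (ℓ π)) (λ c → ι (_≗?_ ℕ._≟_ c (d ∘ rep)) · G d)
          ≡⟨ ∑-funs-δ ℕ._≟_ (downFrom⁺ K) (d ∘ rep) (d∈ ∘ rep) {λ _ → G d} (λ _ → refl) ⟩
        G d
          ≡⟨ sym (Q.*-identityˡ (G d)) ⟩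
        1ℚ · G d ∎)
      go (no ¬const) = trans (Q.zeroˡ (G d)) (sym (trans
        (∑-cong (funs L (ℓ π)) (λ c → trans (cong (_· G d) (ι-false (_≗?_ ℕ._≟_ d (c ∘ blk π))
          (λ eq → ¬const (λ j k jk → trans (eq j) (trans (cong c jk) (sym (eq k)))))))
          (Q.zeroˡ (G d))))
        (∑-0 (funs L (ℓ π)))))

-- The words on an alphabet in which every letter is replaced by K N ordered
-- copies carrying the weights wt N; the total weight is a polynomial in N on
-- the series of interest, and the operator takes its value at N = −1.
module Substitution (K : ℕ → ℕ) (wt : ℕ → ℕ → ℚ) where

  refine : ℕ → (w d : Word n) → Word n
  refine N w d i = w i ℕ.* K N ℕ.+ d i

  substituteAt : ℕ → Series n → Series n
  substituteAt {n} N x w = ∑ (funs (downFrom (K N)) n) (λ d → ∏ (λ j → wt N (d j)) · x (refine N w d))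

  substitute : Series n → Series n
  substitute {n} x w = extrapolate n (λ N → substituteAt N x w)

  substitute-cong : ∀ {x y : Series n} → x ≋ y → substitute x ≋ substitute y
  substitute-cong {n} x≋y w = extrapolate-cong n (λ N →
    ∑-cong (funs (downFrom (K N)) n) (λ d → cong (∏ (λ j → wt N (d j)) ·_) (x≋y _)))

  substitute-∑ : ∀ {A : Set} (ts : List A) (c : A → ℚ) (f : A → Series n) →
    substitute (λ w → ∑ ts (λ t → c t · f t w)) ≋ λ w → ∑ ts (λ t → c t · substitute (f t) w)
  substitute-∑ {n} ts c f w = trans (extrapolate-cong n at) (extrapolate-∑ n ts c (λ t N → substituteAt N (f t) w))
    where
    at : ∀ N → substituteAt N (λ w → ∑ ts (λ t → c t · f t w)) w ≡ ∑ ts (λ t → c t · substituteAt N (f t) w)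
    at N = begin
      ∑ ds (λ d → weight d · ∑ ts (λ t → c t · f t (refine N w d)))
        ≡⟨ ∑-cong ds (λ d → trans (·-∑ (weight d) ts _) (∑-cong ts (λ t →
             solve 3 (λ a b c → a :* (b :* c) := b :* (a :* c)) refl (weight d) (c t) (f t (refine N w d))))) ⟩
      ∑ ds (λ d → ∑ ts (λ t → c t · (weight d · f t (refine N w d))))
        ≡⟨ ∑-swap ds ts _ ⟩
      ∑ ts (λ t → ∑ ds (λ d → c t · (weight d · f t (refine N w d))))
        ≡⟨ ∑-cong ts (λ t → sym (·-∑ (c t) ds _)) ⟩
      ∑ ts (λ t → c t · substituteAt N (f t) w) ∎
      where
      ds : List (Word n)
      ds = funs (downFrom (K N)) n
      weight : Word n → ℚ
      weight d = ∏ (λ j → wt N (d j))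

  substitute-Poly : ∀ {x : Series n} {w} q → Poly n q → (∀ N → substituteAt N x w ≡ q (suc N)) → substitute x w ≡ q 0
  substitute-Poly {n} q h eq = trans (extrapolate-cong n eq) (extrapolate-Poly n h)

  pCoeff-refine : ∀ (π : SetPartition n) N w d → (∀ i → d i < K N) →
    pCoeff π (refine N w d) ≡ pCoeff π w · pCoeff π d
  pCoeff-refine π N w d d< = trans
    (ι-cong (constant? π (refine N w d)) (constant? π w ×-dec constant? π d)
      (λ h → (λ j k jk → proj₁ (lex-injective (K N) {w j} {d j} {w k} {d k} (d< j) (d< k) (h j k jk)))
           , (λ j k jk → proj₂ (lex-injective (K N) {w j} {d j} {w k} {d k} (d< j) (d< k) (h j k jk))))
      (λ { (h , g) j k jk → cong₂ (λ a b → a ℕ.* K N ℕ.+ b) (h j k jk) (g j k jk) }))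
    (ι-× (constant? π w) (constant? π d))

  -- a e is the value at N = −1 of the e-th power sum of the weights.
  substitute-pCoeff : (a c : ℕ → ℚ) → (∀ N e → ∑ (downFrom (K N)) (λ k → wt N k ^ℚ e) ≡ affine (a e) (c e) (suc N)) →
    ∀ (π : SetPartition n) → substitute (pCoeff π) ≋ λ w → ∏ (λ b → a (blockSize π b)) · pCoeff π w
  substitute-pCoeff {n} a c power π w = trans
    (substitute-Poly {x = pCoeff π} {w} (λ i → pCoeff π w · ∏ (λ b → factor b i))
      (Poly-scale n (pCoeff π w) (Poly-≤ {q = λ i → ∏ (λ b → factor b i)} (ℓ≤n π) (Poly-∏ (ℓ π) (λ b → Poly-affine (a (blockSize π b)) _))))
      at)
    (trans (Q.*-comm (pCoeff π w) _) (cong (_· pCoeff π w) (∏-cong (λ b → affine-0 (a (blockSize π b)) _))))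
    where
    factor : Fin (ℓ π) → ℕ → ℚ
    factor b = affine (a (blockSize π b)) (c (blockSize π b))
    at : ∀ N → substituteAt N (pCoeff π) w ≡ pCoeff π w · ∏ (λ b → factor b (suc N))
    at N = begin
      ∑ (funs L n) (λ d → G d · pCoeff π (refine N w d))
        ≡⟨ ∑-funs-cong∈ L n (λ d d∈ → trans (cong (G d ·_) (pCoeff-refine π N w d (∈-downFrom⁻ ∘ d∈)))
             (solve 3 (λ a b c → a :* (b :* c) := b :* (c :* a)) refl (G d) (pCoeff π w) (pCoeff π d))) ⟩
      ∑ (funs L n) (λ d → pCoeff π w · (pCoeff π d · G d))
        ≡⟨ sym (·-∑ (pCoeff π w) (funs L n) _) ⟩
      pCoeff π w · ∑ (funs L n) (λ d → pCoeff π d · G d)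
        ≡⟨ cong (pCoeff π w ·_) (trans (∑-pCoeff π (K N) (wt N)) (∏-cong (λ b → power N (blockSize π b)))) ⟩
      pCoeff π w · ∏ (λ b → factor b (suc N)) ∎
      where
      L : List ℕ
      L = downFrom (K N)
      G : Word n → ℚ
      G d = ∏ (λ j → wt N (d j))

-- Transfer along the gaps of a word

chain : (Fin n → Fin n → ℚ) → ℚ
chain {zero}        X = 1ℚ
chain {suc zero}    X = 1ℚ
chain {suc (suc n)} X = X zero (suc zero) · chain (λ i j → X (suc i) (suc j))

chain-cong : {X Y : Fin n → Fin n → ℚ} → (∀ i j → Next i j → X i j ≡ Y i j) → chain X ≡ chain Y
chain-cong {zero}        eq = refl
chain-cong {suc zero}    eq = refl
chain-cong {suc (suc n)} eq = cong₂ _·_ (eq zero (suc zero) refl) (chain-cong (λ i j i→j → eq (suc i) (suc j) (cong suc i→j)))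

ι-chain : {P : Fin n → Fin n → Set} (P? : ∀ i j → Dec (P i j)) →
  ι (all? λ i → all? λ j → (toℕ j ℕ.≟ suc (toℕ i)) →-dec P? i j) ≡ chain (λ i j → ι (P? i j))
ι-chain {zero}        P? = ι-true (all? λ i → all? λ j → (toℕ j ℕ.≟ suc (toℕ i)) →-dec P? i j) (λ ())
ι-chain {suc zero}    P? = ι-true (all? λ i → all? λ j → (toℕ j ℕ.≟ suc (toℕ i)) →-dec P? i j) (λ { zero zero () })
ι-chain {suc (suc n)} {P} P? = trans
  (ι-cong (all? λ i → all? λ j → (toℕ j ℕ.≟ suc (toℕ i)) →-dec P? i j) (P? zero (suc zero) ×-dec tail?)
    (λ h → h zero (suc zero) refl , (λ i j i→j → h (suc i) (suc j) (cong suc i→j)))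
    (λ { (p , q) → join p q }))
  (trans (ι-× (P? zero (suc zero)) tail?) (cong (ι (P? zero (suc zero)) ·_) (ι-chain (λ i j → P? (suc i) (suc j)))))
  where
  tail? : Dec (∀ i j → Next i j → P (suc i) (suc j))
  tail? = all? λ i → all? λ j → (toℕ j ℕ.≟ suc (toℕ i)) →-dec P? (suc i) (suc j)
  join : P zero (suc zero) → (∀ i j → Next i j → P (suc i) (suc j)) → ∀ i j → Next i j → P i j
  join p q zero (suc zero) _ = p
  join p q (suc i) (suc j) i→j = q i j (ℕₚ.suc-injective i→j)

-- Each weight but the first moves into the gap on its left, so that a transfer step carries the
-- weight of the letter it adds.
∏-chain : ∀ (a : Fin (suc n) → ℚ) X → ∏ a · chain X ≡ a zero · chain (λ i j → a j · X i j)
∏-chain {zero}  a X = solve 1 (λ a → (a :* con 1) :* con 1 := a :* con 1) refl (a zero)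
∏-chain {suc n} a X = begin
  (a zero · ∏ (a ∘ suc)) · (X₀₁ · chain X′)
    ≡⟨ solve 4 (λ a b c d → (a :* b) :* (c :* d) := a :* (c :* (b :* d))) refl (a zero) (∏ (a ∘ suc)) X₀₁ (chain X′) ⟩
  a zero · (X₀₁ · (∏ (a ∘ suc) · chain X′))
    ≡⟨ cong (λ t → a zero · (X₀₁ · t)) (∏-chain (a ∘ suc) X′) ⟩
  a zero · (X₀₁ · (a (suc zero) · chain (λ i j → a (suc j) · X′ i j)))
    ≡⟨ solve 4 (λ a b c d → a :* (b :* (c :* d)) := a :* ((c :* b) :* d)) refl (a zero) X₀₁ (a (suc zero)) _ ⟩
  a zero · ((a (suc zero) · X₀₁) · chain (λ i j → a (suc j) · X′ i j)) ∎
  where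
  X₀₁ = X zero (suc zero)
  X′ = λ i j → X (suc i) (suc j)

-- The flag of a tie says that the gap lies in A, in the case of F, or that it is a descent of γ, in
-- the case of K. Both sides of Θ(F) = K thus become functions of one list of gaps.
data Gap : Set where
  drop jump : Gap
  tie : Bool → Gap

gap : ℕ → ℕ → Bool → Gap
gap a b δ with ℕₚ.<-cmp a b
... | tri< _ _ _ = jump
... | tri≈ _ _ _ = tie δ
... | tri> _ _ _ = drop

gapList : (Fin (suc n) → ℕ) → (Fin (suc n) → Fin (suc n) → Bool) → List Gap
gapList {zero}  v δ = []
gapList {suc n} v δ = gap (v zero) (v (suc zero)) (δ zero (suc zero)) ∷ gapList (v ∘ suc) (λ i j → δ (suc i) (suc j))

length-gapList : ∀ (v : Fin (suc n) → ℕ) δ → length (gapList v δ) ≡ n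
length-gapList {zero}  v δ = refl
length-gapList {suc n} v δ = cong suc (length-gapList (v ∘ suc) _)

-- The transfer matrix method: `g a` is the total weight of the prefixes that end in `a`.
transfer : List A → (Gap → A → A → ℚ) → List Gap → (A → ℚ) → ℚ
transfer xs ok []       g = ∑ xs g
transfer xs ok (t ∷ ts) g = transfer xs ok ts (λ b → ∑ xs (λ a → g a · ok t a b))

∑-chain : ∀ (xs : List A) ok (v : Fin (suc n) → ℕ) δ g →
  ∑ (funs xs (suc n)) (λ d → g (d zero) · chain (λ i j → ok (gap (v i) (v j) (δ i j)) (d i) (d j)))
    ≡ transfer xs ok (gapList v δ) g
∑-chain {n = zero} xs ok v δ g = trans (∑-funs-suc xs 0 _)
  (∑-cong xs (λ x → trans (Q.+-identityʳ _) (Q.*-identityʳ (g x))))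
∑-chain {n = suc n} xs ok v δ g = begin
  ∑ (funs xs (suc (suc n))) (λ d → g (d zero) · (X d · Y (d ∘ suc)))
    ≡⟨ ∑-funs-suc xs (suc n) _ ⟩
  ∑ xs (λ x → ∑ (funs xs (suc n)) (λ d → g x · (ok t x (d zero) · Y d)))
    ≡⟨ ∑-swap xs (funs xs (suc n)) _ ⟩
  ∑ (funs xs (suc n)) (λ d → ∑ xs (λ x → g x · (ok t x (d zero) · Y d)))
    ≡⟨ ∑-cong (funs xs (suc n)) (λ d → trans (∑-cong xs (λ x → sym (Q.*-assoc (g x) _ _))) (sym (∑-· (Y d) xs _))) ⟩
  ∑ (funs xs (suc n)) (λ d → ∑ xs (λ x → g x · ok t x (d zero)) · Y d)
    ≡⟨ ∑-chain xs ok (v ∘ suc) (λ i j → δ (suc i) (suc j)) (λ b → ∑ xs (λ a → g a · ok t a b)) ⟩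
  transfer xs ok (gapList v δ) g ∎
  where
  t = gap (v zero) (v (suc zero)) (δ zero (suc zero))
  X : (Fin (suc (suc n)) → _) → ℚ
  X d = ok t (d zero) (d (suc zero))
  Y : (Fin (suc n) → _) → ℚ
  Y d = chain (λ i j → ok (gap (v (suc i)) (v (suc j)) (δ (suc i) (suc j))) (d i) (d j))

-- Counts the sign vectors admissible for K_(γ,σ) position by position: a and b are the
-- numbers of those on the current prefix ending in a negative, respectively positive sign.
signCount : List Gap → ℚ → ℚ → ℚ
signCount []               a b = a + b
signCount (drop ∷ ts)      a b = signCount ts 0ℚ 0ℚ
signCount (jump ∷ ts)      a b = signCount ts (a + b) (a + b)
signCount (tie true ∷ ts)  a b = signCount ts a a
signCount (tie false ∷ ts) a b = signCount ts 0ℚ (a + b)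

-- Right after a jump or a tie at a descent the two counts agree; after a tie at an
-- ascent only positive signs survive. The total changes within a run only at a peak.
negCount posCount : Bool → ℚ → ℚ
negCount true  c = c
negCount false c = 0ℚ
posCount true  c = c
posCount false c = c + c

total : ∀ p c → negCount p c + posCount p c ≡ c + c
total true  c = refl
total false c = Q.+-identityˡ (c + c)

-- The two flag systems may pass through different states p₁ and p₂, but they share the parameter c
-- throughout: within a run of equal letters c is altered only by an ascent tie followed by a
-- descent tie, and the hypotheses make these occur at the same places.
signCount-peaks : ∀ (v : Fin (suc n) → ℕ) δ₁ δ₂ p₁ p₂ c →
  (∀ j → Next zero j → (not p₁ ∧ δ₁ zero j) ≡ (not p₂ ∧ δ₂ zero j)) →
  (∀ i j k → Next i j → Next j k → (not (δ₁ i j) ∧ δ₁ j k) ≡ (not (δ₂ i j) ∧ δ₂ j k)) →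
  signCount (gapList v δ₁) (negCount p₁ c) (posCount p₁ c) ≡ signCount (gapList v δ₂) (negCount p₂ c) (posCount p₂ c)
signCount-peaks {zero}  v δ₁ δ₂ p₁ p₂ c h hs = trans (total p₁ c) (sym (total p₂ c))
signCount-peaks {suc n} v δ₁ δ₂ p₁ p₂ c h hs
  with IH ← (λ q₁ q₂ c′ h′ → signCount-peaks (v ∘ suc) (λ i j → δ₁ (suc i) (suc j)) (λ i j → δ₂ (suc i) (suc j)) q₁ q₂ c′ h′
         (λ i j k i→j j→k → hs (suc i) (suc j) (suc k) (cong suc i→j) (cong suc j→k)))
  with ℕₚ.<-cmp (v zero) (v (suc zero))
... | tri> _ _ _ = IH true true 0ℚ (λ _ _ → refl)
... | tri< _ _ _ rewrite total p₁ c | total p₂ c = IH true true (c + c) (λ _ _ → refl)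
... | tri≈ _ _ _ = run p₁ (δ₁ zero (suc zero)) p₂ (δ₂ zero (suc zero)) (h (suc zero) refl)
      (λ j 0→j → hs zero (suc zero) (suc j) refl (cong suc 0→j))
  where
  run : ∀ p₁ x₁ p₂ x₂ → (not p₁ ∧ x₁) ≡ (not p₂ ∧ x₂) →
    (∀ j → Next zero j → (not x₁ ∧ δ₁ (suc zero) (suc j)) ≡ (not x₂ ∧ δ₂ (suc zero) (suc j))) →
    signCount (tie x₁ ∷ gapList (v ∘ suc) (λ i j → δ₁ (suc i) (suc j))) (negCount p₁ c) (posCount p₁ c)
      ≡ signCount (tie x₂ ∷ gapList (v ∘ suc) (λ i j → δ₂ (suc i) (suc j))) (negCount p₂ c) (posCount p₂ c)
  run p₁    false p₂    false _ h rewrite total p₁ c | total p₂ c = IH false false c h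
  run true  true  true  true  _ h = IH true true c h
  -- The peak: only positive signs survived the ascent, and at a descent a positive sign can be
  -- followed neither by a positive nor by a negative one.
  run false true  false true  _ h = IH true true 0ℚ h
  run p₁    false true  true  _ h rewrite total p₁ c = IH false true c h
  run true  true  p₂    false _ h rewrite total p₂ c = IH true false c h
  run p₁    false false true eq h = contradiction (trans (sym (Boolₚ.∧-zeroʳ (not p₁))) eq) λ ()
  run false true  p₂    false eq h = contradiction (trans eq (Boolₚ.∧-zeroʳ (not p₂))) λ ()
  run true true false true () h
  run false true true true () h

okSign : Gap → Bool → Bool → ℚ
okSign drop     _     _     = 0ℚ
okSign jump     _     _     = 1ℚ
okSign (tie δ)  false false = bool→ℚ δ
okSign (tie _)  false true  = 1ℚ
okSign (tie _)  true  false = 0ℚ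
okSign (tie δ)  true  true  = bool→ℚ (not δ)

bools : List Bool
bools = true ∷ false ∷ []

transfer-signs : ∀ ts g → transfer bools okSign ts g ≡ signCount ts (g false) (g true)
transfer-signs [] g = solve 2 (λ a b → b :+ (a :+ con 0) := a :+ b) refl (g false) (g true)
transfer-signs (drop ∷ ts) g = trans (transfer-signs ts _) (cong₂ (signCount ts) eq eq)
  where
  eq : g true · 0ℚ + (g false · 0ℚ + 0ℚ) ≡ 0ℚ
  eq = solve 2 (λ a b → b :* con 0 :+ (a :* con 0 :+ con 0) := con 0) refl (g false) (g true)
transfer-signs (jump ∷ ts) g = trans (transfer-signs ts _) (cong₂ (signCount ts) eq eq)
  where
  eq : g true · 1ℚ + (g false · 1ℚ + 0ℚ) ≡ g false + g true
  eq = solve 2 (λ a b → b :* con 1 :+ (a :* con 1 :+ con 0) := a :+ b) refl (g false) (g true)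
transfer-signs (tie true ∷ ts) g = trans (transfer-signs ts _) (cong₂ (signCount ts)
  (solve 2 (λ a b → b :* con 0 :+ (a :* con 1 :+ con 0) := a) refl (g false) (g true))
  (solve 2 (λ a b → b :* con 0 :+ (a :* con 1 :+ con 0) := a) refl (g false) (g true)))
transfer-signs (tie false ∷ ts) g = trans (transfer-signs ts _) (cong₂ (signCount ts)
  (solve 2 (λ a b → b :* con 0 :+ (a :* con 0 :+ con 0) := con 0) refl (g false) (g true))
  (solve 2 (λ a b → b :* con 1 :+ (a :* con 1 :+ con 0) := a :+ b) refl (g false) (g true)))

ℕ→ℚ-count : ∀ {P : A → Set} (P? : ∀ x → Dec (P x)) xs → ℕ→ℚ (length (filter P? xs)) ≡ ∑ xs (λ x → ι (P? x))
ℕ→ℚ-count P? []       = refl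
ℕ→ℚ-count P? (x ∷ xs) with P? x
... | yes _ = trans (ℕ→ℚ-suc (length (filter P? xs))) (cong (1ℚ +_) (ℕ→ℚ-count P? xs))
... | no  _ = trans (ℕ→ℚ-count P? xs) (sym (Q.+-identityˡ _))

∑-signs : ∀ n {f : (Fin n → Bool) → ℚ} → Extensional f → ∑ (signs n) f ≡ ∑ (funs bools n) f
∑-signs zero    ext = cong (_+ 0ℚ) (ext (λ ()))
-- The function that prepends a sign is local to `signs`; it enters `step` as arbitrary t and u,
-- which `refl` determines.
∑-signs (suc n) {f} ext = step _ _ refl
    (λ s → ext (λ { zero → refl ; (suc i) → refl })) (λ s → ext (λ { zero → refl ; (suc i) → refl }))
  where
  step : (t u : (Fin n → Bool) → (Fin (suc n) → Bool)) → signs (suc n) ≡ concatMap (λ s → t s ∷ u s ∷ []) (signs n) →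
    (∀ s → f (t s) ≡ f (true F.∷ s)) → (∀ s → f (u s) ≡ f (false F.∷ s)) → ∑ (signs (suc n)) f ≡ ∑ (funs bools (suc n)) f
  step t u eq t≡ u≡ = begin
    ∑ (signs (suc n)) f
      ≡⟨ trans (cong (λ xs → ∑ xs f) eq) (∑-concatMap _ (signs n) f) ⟩
    ∑ (signs n) (λ s → f (t s) + (f (u s) + 0ℚ))
      ≡⟨ ∑-cong (signs n) (λ s → cong₂ (λ a b → a + (b + 0ℚ)) (t≡ s) (u≡ s)) ⟩
    ∑ (signs n) (λ s → ∑ bools (λ b → f (b F.∷ s)))
      ≡⟨ ∑-signs n (λ eq → cong₂ (λ a b → a + (b + 0ℚ)) (ext (λ { zero → refl ; (suc i) → eq i })) (ext (λ { zero → refl ; (suc i) → eq i }))) ⟩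
    ∑ (funs bools n) (λ s → ∑ bools (λ b → f (b F.∷ s)))
      ≡⟨ ∑-swap (funs bools n) bools (λ s b → f (b F.∷ s)) ⟩
    ∑ bools (λ b → ∑ (funs bools n) (λ s → f (b F.∷ s)))
      ≡⟨ sym (∑-funs-suc bools n f) ⟩
    ∑ (funs bools (suc n)) f ∎

perm-injective : ∀ (σ : Permutation′ n) {i j} → σ ⟨$⟩ʳ i ≡ σ ⟨$⟩ʳ j → i ≡ j
perm-injective σ eq = trans (sym (Perm.inverseˡ σ)) (trans (cong (σ ⟨$⟩ˡ_) eq) (Perm.inverseˡ σ))

Next-≢ : ∀ {i j : Fin n} → Next i j → i ≢ j
Next-≢ {i = i} i→j i≡j = ℕₚ.1+n≢n (trans (sym i→j) (cong toℕ (sym i≡j)))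

descent : Permutation′ n → Fin n → Fin n → Bool
descent γ i j = does (γ ⟨$⟩ʳ j Fin.<? γ ⟨$⟩ʳ i)

-- Injectivity of γ turns both tie conditions into one flag per gap, its descent bit. The first sign
-- is free, so both counts start at 1.
KCoeff-signCount : ∀ (γ σ : Permutation′ (suc n)) w →
  KCoeff γ σ w ≡ signCount (gapList (λ k → w (σ ⟨$⟩ʳ k)) (descent γ)) 1ℚ 1ℚ
KCoeff-signCount {n} γ σ w = begin
  KCoeff γ σ w
    ≡⟨ ℕ→ℚ-count _ (signs (suc n)) ⟩
  ∑ (signs (suc n)) (λ s → ι (all? λ i → all? λ j → (toℕ j ℕ.≟ suc (toℕ i)) →-dec ok? (v i) (v j) (s i) (s j) (γ ⟨$⟩ʳ i) (γ ⟨$⟩ʳ j)))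
    ≡⟨ ∑-cong (signs (suc n)) (λ s → trans (ι-chain (λ i j → ok? (v i) (v j) (s i) (s j) (γ ⟨$⟩ʳ i) (γ ⟨$⟩ʳ j)))
         (trans (chain-cong (λ i j i→j → ok?-okSign (v i) (v j) (s i) (s j) (Next-≢ i→j ∘ perm-injective γ)))
           (sym (Q.*-identityˡ _)))) ⟩
  ∑ (signs (suc n)) (λ s → 1ℚ · chain (X s))
    ≡⟨ ∑-signs (suc n) (λ eq → cong (1ℚ ·_) (chain-cong (λ i j _ → cong₂ (okSign (gap (v i) (v j) (descent γ i j))) (eq i) (eq j)))) ⟩
  ∑ (funs bools (suc n)) (λ s → 1ℚ · chain (X s))
    ≡⟨ ∑-chain bools okSign v (descent γ) (λ _ → 1ℚ) ⟩
  transfer bools okSign (gapList v (descent γ)) (λ _ → 1ℚ)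
    ≡⟨ transfer-signs (gapList v (descent γ)) (λ _ → 1ℚ) ⟩
  signCount (gapList v (descent γ)) 1ℚ 1ℚ ∎
  where
  v : Fin (suc n) → ℕ
  v k = w (σ ⟨$⟩ʳ k)
  X : (Fin (suc n) → Bool) → Fin (suc n) → Fin (suc n) → ℚ
  X s i j = okSign (gap (v i) (v j) (descent γ i j)) (s i) (s j)
  ok? : ∀ a b s t (c d : Fin (suc n)) → Dec _
  ok? a b s t c d = ((a , s) ⪯? (b , t)) ×-dec
    (((a ℕ.≟ b) ×-dec (s Bool.≟ true) ×-dec (t Bool.≟ true)) →-dec (c Fin.<? d)) ×-dec
    (((a ℕ.≟ b) ×-dec (s Bool.≟ false) ×-dec (t Bool.≟ false)) →-dec (d Fin.<? c))
  ok?-okSign : ∀ a b s t {c d} → c ≢ d → ι (ok? a b s t c d) ≡ okSign (gap a b (does (d Fin.<? c))) s t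
  ok?-okSign a b s t {c} {d} c≢d with ℕₚ.<-cmp a b
  ... | tri< a<b a≢b _ = ι-true (ok? a b s t c d) (inj₁ a<b , (λ (a≡b , _) → contradiction a≡b a≢b) , (λ (a≡b , _) → contradiction a≡b a≢b))
  ... | tri> a≮b a≢b _ = ι-false (ok? a b s t c d) λ { (inj₁ a<b , _) → a≮b a<b ; (inj₂ (a≡b , _) , _) → a≢b a≡b }
  ok?-okSign a b false false {c} {d} c≢d | tri≈ _ a≡b _ = ι-cong (ok? a b false false c d) (d Fin.<? c)
    (λ (_ , _ , h) → h (a≡b , refl , refl)) (λ d<c → inj₂ (a≡b , inj₁ refl) , (λ ()) , λ _ → d<c)
  ok?-okSign a b false true  {c} {d} c≢d | tri≈ _ a≡b _ = ι-true (ok? a b false true c d) (inj₂ (a≡b , inj₁ refl) , (λ ()) , λ ())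
  ok?-okSign a b true  false {c} {d} c≢d | tri≈ a≮b a≡b _ = ι-false (ok? a b true false c d)
    λ { (inj₁ a<b , _) → a≮b a<b ; (inj₂ (_ , inj₁ ()) , _) ; (inj₂ (_ , inj₂ ()) , _) }
  ok?-okSign a b true  true  {c} {d} c≢d | tri≈ _ a≡b _ = ι-cong (ok? a b true true c d) (¬? (d Fin.<? c))
    (λ (_ , h , _) d<c → ℕₚ.<-asym d<c (h (a≡b , refl , refl)))
    (λ d≮c → inj₂ (a≡b , inj₂ refl) , (λ _ → Finₚ.≤∧≢⇒< (ℕₚ.≮⇒≥ d≮c) c≢d) , λ ())

-- The operator Θ on fundamental series

∑-funs-permute : (_≟_ : DecidableEquality A) → ∀ {xs : List A} → Unique xs → ∀ {n} (σ : Permutation′ n)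
  {g : (Fin n → A) → ℚ} → Extensional g → ∑ (funs xs n) (λ d → g (λ i → d (σ ⟨$⟩ʳ i))) ≡ ∑ (funs xs n) g
∑-funs-permute _≟_ {xs} u {n} σ {g} ext = begin
  ∑ ds (λ d → g (λ i → d (σ ⟨$⟩ʳ i)))
    ≡⟨ ∑-funs-cong∈ xs n (λ d d∈ → sym (∑-funs-δ _≟_ u (λ i → d (σ ⟨$⟩ʳ i)) (λ i → d∈ (σ ⟨$⟩ʳ i)) ext)) ⟩
  ∑ ds (λ d → ∑ ds (λ e → ι (_≗?_ _≟_ e (λ i → d (σ ⟨$⟩ʳ i))) · g e))
    ≡⟨ ∑-swap ds ds _ ⟩
  ∑ ds (λ e → ∑ ds (λ d → ι (_≗?_ _≟_ e (λ i → d (σ ⟨$⟩ʳ i))) · g e))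
    ≡⟨ ∑-cong ds (λ e → ∑-cong ds (λ d → cong (_· g e) (ι-cong (_≗?_ _≟_ e (λ i → d (σ ⟨$⟩ʳ i))) (_≗?_ _≟_ d (λ i → e (σ ⟨$⟩ˡ i)))
         (λ eq i → trans (cong d (sym (Perm.inverseʳ σ))) (sym (eq (σ ⟨$⟩ˡ i))))
         (λ eq i → trans (cong e (sym (Perm.inverseˡ σ))) (sym (eq (σ ⟨$⟩ʳ i))))))) ⟩
  ∑ ds (λ e → ∑ ds (λ d → ι (_≗?_ _≟_ d (λ i → e (σ ⟨$⟩ˡ i))) · g e))
    ≡⟨ ∑-funs-cong∈ xs n (λ e e∈ → ∑-funs-δ _≟_ u (λ i → e (σ ⟨$⟩ˡ i)) (λ i → e∈ (σ ⟨$⟩ˡ i)) {λ _ → g e} (λ _ → refl)) ⟩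
  ∑ ds g ∎
  where
  ds = funs xs n

ι-≤ : ∀ a b → ι (a ℕ.≤? b) ≡ ι (a ℕ.<? suc b)
ι-≤ a b = ι-cong (a ℕ.≤? b) (a ℕ.<? suc b) s≤s ℕ.s≤s⁻¹

∑-below : ∀ {b} K (g : ℕ → ℚ) → b ≤ K → ∑ (downFrom K) (λ e → g e · ι (e ℕ.<? b)) ≡ ∑ (downFrom b) g
∑-below {b} K g b≤K with ℕₚ.m≤n⇒m<n∨m≡n b≤K
... | inj₂ refl = ∑-cong∈ (downFrom K) (λ {e} e∈ → trans (cong (g e ·_) (ι-true (e ℕ.<? K) (∈-downFrom⁻ e∈))) (Q.*-identityʳ (g e)))
∑-below {b} (suc K) g b≤K | inj₁ b<K = trans
  (cong (_+ ∑ (downFrom K) (λ e → g e · ι (e ℕ.<? b))) (trans (cong (g K ·_) (ι-false (K ℕ.<? b) (ℕₚ.≤⇒≯ (ℕ.s≤s⁻¹ b<K)))) (Q.zeroʳ (g K))))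
  (trans (Q.+-identityˡ _) (∑-below K g (ℕ.s≤s⁻¹ b<K)))

∑-telescope : ∀ (R : ℕ → ℚ) b → R 1 ≡ 0ℚ → ∑ (downFrom b) (λ e → Δ R (suc e)) ≡ R (suc b)
∑-telescope R zero    R1 = sym R1
∑-telescope R (suc b) R1 = begin
  (R (suc (suc b)) + - R (suc b)) + ∑ (downFrom b) (λ e → Δ R (suc e))
    ≡⟨ cong (R (suc (suc b)) + - R (suc b) +_) (∑-telescope R b R1) ⟩
  (R (suc (suc b)) + - R (suc b)) + R (suc b)
    ≡⟨ trans (Q.+-assoc (R (suc (suc b))) _ _) (cong (R (suc (suc b)) +_) (Q.-‿inverseˡ (R (suc b)))) ⟩
  R (suc (suc b)) + 0ℚ
    ≡⟨ Q.+-identityʳ _ ⟩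
  R (suc (suc b)) ∎

-- Every letter is split into N negative copies followed by a positive one.
wtΘ : ℕ → ℕ → ℚ
wtΘ N k = if does (k ℕ.≟ N) then 1ℚ else - 1ℚ

open Substitution suc wtΘ using () renaming (substitute to Θ; substituteAt to ΘAt; refine to refineΘ)
module ΘSubst = Substitution suc wtΘ

wtΘ-pos : ∀ N → wtΘ N N ≡ 1ℚ
wtΘ-pos N = cong (if_then 1ℚ else - 1ℚ) (dec-true (N ℕ.≟ N) refl)

wtΘ-neg : ∀ {N k} → k < N → wtΘ N k ≡ - 1ℚ
wtΘ-neg {N} {k} k<N = cong (if_then 1ℚ else - 1ℚ) (dec-false (k ℕ.≟ N) (ℕₚ.<⇒≢ k<N))

okLetter : Gap → ℕ → ℕ → ℚ
okLetter drop        d e = 0ℚ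
okLetter jump        d e = 1ℚ
okLetter (tie false) d e = ι (d ℕ.≤? e)
okLetter (tie true)  d e = ι (d ℕ.<? e)

okΘ : ℕ → Gap → ℕ → ℕ → ℚ
okΘ N t d e = wtΘ N e · okLetter t d e

neg-· : ∀ x → - 1ℚ · x ≡ - x
neg-· x = trans (sym (-‿distribˡ-* 1ℚ x)) (cong -_ (Q.*-identityˡ x))

neg-0 : - 0ℚ ≡ 0ℚ
neg-0 = trans (sym (Q.+-identityˡ _)) (Q.-‿inverseʳ 0ℚ)

transferΘ : ℕ → List Gap → (ℕ → ℚ) → ℚ
transferΘ N = transfer (downFrom (suc N)) (okΘ N)

-- The reciprocity step: the weighted number of words with last letter below e is
-- C N · R e with R and C polynomial, and with last letter N it is Y N; at N = −1
-- the products C · R and Y obey the recursion of signCount.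
transfer-reciprocity : ∀ ts {a b d} (C R Y : ℕ → ℚ) → Poly a C → Poly b R → Poly d Y → a ℕ.+ b ≤ d → R 1 ≡ 0ℚ →
  ∃[ q ] Poly (length ts ℕ.+ d) q × q 0 ≡ signCount ts (C 0 · R 0) (Y 0) ×
    (∀ N g → (∀ {e} → e < N → g e ≡ C (suc N) · Δ R (suc e)) → g N ≡ Y (suc N) → transferΘ N ts g ≡ q (suc N))
transfer-reciprocity ts {a} {b} {d} C R Y hC hR hY a+b≤d R1 = go ts
  where
  -- The sum over all N negative copies is the partial sum on the diagonal e = N, so C and R receive
  -- the same argument and reach -1 together.
  S : ℕ → ℚ
  S i = C i · R i + Y i

  Poly-C·R : Poly d (λ i → C i · R i)
  Poly-C·R = Poly-≤ {q = λ i → C i · R i} a+b≤d (Poly-· {C} {R} a b hC hR)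

  Poly-S : Poly d S
  Poly-S = Poly-+ {λ i → C i · R i} {Y} d Poly-C·R hY

  Admissible : ℕ → (ℕ → ℚ) → Set
  Admissible N g = (∀ {e} → e < N → g e ≡ C (suc N) · Δ R (suc e)) × g N ≡ Y (suc N)

  ∑-partial : ∀ {N g b} → Admissible N g → b ≤ N → ∑ (downFrom b) g ≡ C (suc N) · R (suc b)
  ∑-partial {N} {g} {b} (hg , _) b≤N = begin
    ∑ (downFrom b) g
      ≡⟨ ∑-cong∈ (downFrom b) (λ e∈ → hg (ℕₚ.<-≤-trans (∈-downFrom⁻ e∈) b≤N)) ⟩
    ∑ (downFrom b) (λ e → C (suc N) · Δ R (suc e))
      ≡⟨ sym (·-∑ (C (suc N)) (downFrom b) _) ⟩
    C (suc N) · ∑ (downFrom b) (λ e → Δ R (suc e))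
      ≡⟨ cong (C (suc N) ·_) (∑-telescope R b R1) ⟩
    C (suc N) · R (suc b) ∎

  ∑-total : ∀ {N g} → Admissible N g → ∑ (downFrom (suc N)) g ≡ S (suc N)
  ∑-total {N} {g} hg = trans (cong₂ _+_ (proj₂ hg) (∑-partial hg ℕₚ.≤-refl)) (Q.+-comm _ _)

  ∑-step : ∀ N t e (g : ℕ → ℚ) → ∑ (downFrom (suc N)) (λ d → g d · okΘ N t d e) ≡ wtΘ N e · ∑ (downFrom (suc N)) (λ d → g d · okLetter t d e)
  ∑-step N t e g = trans (∑-cong (downFrom (suc N)) (λ d → solve 3 (λ a b c → a :* (b :* c) := b :* (a :* c)) refl (g d) (wtΘ N e) (okLetter t d e)))
    (sym (·-∑ (wtΘ N e) (downFrom (suc N)) _))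

  ∑-weak : ∀ {N e g} → Admissible N g → e < N → ∑ (downFrom (suc N)) (λ d → g d · okLetter (tie false) d e) ≡ C (suc N) · R (suc (suc e))
  ∑-weak {N} {e} {g} hg e<N = trans (∑-cong (downFrom (suc N)) (λ d → cong (g d ·_) (ι-≤ d e)))
    (trans (∑-below (suc N) g (ℕₚ.m≤n⇒m≤1+n e<N)) (∑-partial hg e<N))

  ∑-strict : ∀ {N e g} → Admissible N g → e ≤ N → ∑ (downFrom (suc N)) (λ d → g d · okLetter (tie true) d e) ≡ C (suc N) · R (suc e)
  ∑-strict {N} {e} {g} hg e≤N = trans (∑-below (suc N) g (ℕₚ.m≤n⇒m≤1+n e≤N)) (∑-partial hg e≤N)

  ∑-pos : ∀ N t {g : ℕ → ℚ} {s} → ∑ (downFrom (suc N)) (λ d → g d · okLetter t d N) ≡ s → ∑ (downFrom (suc N)) (λ d → g d · okΘ N t d N) ≡ s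
  ∑-pos N t {g} {s} eq = trans (∑-step N t N g) (trans (cong₂ _·_ (wtΘ-pos N) eq) (Q.*-identityˡ s))

  ∑-neg : ∀ {N e} {g : ℕ → ℚ} t (f : ℕ → ℚ) c {s} → e < N → ∑ (downFrom (suc N)) (λ d → g d · okLetter t d e) ≡ s →
    c · f (suc e) ≡ - s → ∑ (downFrom (suc N)) (λ d → g d · okΘ N t d e) ≡ c · Δ (antidifference f) (suc e)
  ∑-neg {N} {e} {g} t f c {s} e<N eq eq′ = begin
    ∑ (downFrom (suc N)) (λ d → g d · okΘ N t d e) ≡⟨ ∑-step N t e g ⟩
    wtΘ N e · ∑ (downFrom (suc N)) (λ d → g d · okLetter t d e) ≡⟨ cong₂ _·_ (wtΘ-neg e<N) eq ⟩
    - 1ℚ · s                                       ≡⟨ neg-· s ⟩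
    - s                                            ≡⟨ sym eq′ ⟩
    c · f (suc e)                                  ≡⟨ cong (c ·_) (sym (Δ-antidifference f (suc e))) ⟩
    c · Δ (antidifference f) (suc e)               ∎

  ∑-jump : ∀ N (g : ℕ → ℚ) e → ∑ (downFrom (suc N)) (λ d → g d · okLetter jump d e) ≡ ∑ (downFrom (suc N)) g
  ∑-jump N g e = ∑-cong (downFrom (suc N)) (λ d → Q.*-identityʳ (g d))

  go : ∀ ts → ∃[ q ] Poly (length ts ℕ.+ d) q × q 0 ≡ signCount ts (C 0 · R 0) (Y 0) ×
    (∀ N g → (∀ {e} → e < N → g e ≡ C (suc N) · Δ R (suc e)) → g N ≡ Y (suc N) → transferΘ N ts g ≡ q (suc N))
  go [] = S , Poly-S , refl , λ N g hg hN → ∑-total (hg , hN)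
  go (drop ∷ ts)
    with q , hq , q0 , h ← transfer-reciprocity ts {0} {0} {suc d} (λ _ → 0ℚ) (λ _ → 0ℚ) (λ _ → 0ℚ)
           (λ _ → refl) (λ _ → refl) (Poly-const (suc d) 0ℚ) z≤n refl
    = q , subst (λ k → Poly k q) (ℕₚ.+-suc (length ts) d) hq
    , trans q0 (cong (λ t → signCount ts t 0ℚ) (Q.zeroˡ 0ℚ))
    , λ N g hg hN → h N _ (λ {e} e<N → trans (zero-sum N g e) (sym (Q.zeroˡ _))) (zero-sum N g N)
    where
    zero-sum : ∀ N (g : ℕ → ℚ) e → ∑ (downFrom (suc N)) (λ d → g d · okΘ N drop d e) ≡ 0ℚ
    zero-sum N g e = trans (∑-cong (downFrom (suc N)) (λ d → trans (cong (g d ·_) (Q.zeroʳ _)) (Q.zeroʳ (g d)))) (∑-0 (downFrom (suc N)))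
  -- After a jump every negative copy carries minus the old total, wherever it stands. The partial
  -- sums are that total times -e, and -e is 1 at e = -1: both counts become the total.
  go (jump ∷ ts)
    with q , hq , q0 , h ← transfer-reciprocity ts {d} {1} {suc d} S (antidifference (λ _ → - 1ℚ)) S
           Poly-S (Poly-antidifference 0 {λ _ → - 1ℚ} (λ _ → refl)) (Poly-suc {S} d Poly-S) (ℕₚ.≤-reflexive (ℕₚ.+-comm d 1))
           (antidifference-1 (λ _ → - 1ℚ))
    = q , subst (λ k → Poly k q) (ℕₚ.+-suc (length ts) d) hq
    , trans q0 (cong (λ t → signCount ts t (S 0)) (trans (cong (S 0 ·_) (trans (antidifference-0 (λ _ → - 1ℚ)) (-‿involutive 1ℚ))) (Q.*-identityʳ (S 0))))
    , λ N g hg hN → h N _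
        (λ {e} e<N → ∑-neg jump (λ _ → - 1ℚ) (S (suc N)) e<N (trans (∑-jump N g e) (∑-total (hg , hN)))
          (trans (Q.*-comm _ _) (neg-· (S (suc N)))))
        (∑-pos N jump (trans (∑-jump N g N) (∑-total (hg , hN))))
  -- A weak tie reads the old partial sum below e + 1. At e = -1 this is the empty sum `R 1`, so no
  -- negative sign survives, while the positive copy collects the total.
  go (tie false ∷ ts)
    with q , hq , q0 , h ← transfer-reciprocity ts {a} {suc b} {suc d} C (antidifference (λ i → - R (suc i))) S
           hC (Poly-antidifference b {λ i → - R (suc i)} (Poly-cong b (λ i → neg-· (R (suc i))) (Poly-scale b (- 1ℚ) (Poly-shift {R} b hR))))
           (Poly-suc {S} d Poly-S)
           (ℕₚ.≤-trans (ℕₚ.≤-reflexive (ℕₚ.+-suc a b)) (s≤s a+b≤d))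
           (antidifference-1 (λ i → - R (suc i)))
    = q , subst (λ k → Poly k q) (ℕₚ.+-suc (length ts) d) hq
    , trans q0 (cong (λ t → signCount ts t (S 0)) (trans (cong (C 0 ·_)
        (trans (antidifference-0 (λ i → - R (suc i))) (trans (-‿involutive (R 1)) R1))) (Q.zeroʳ (C 0))))
    , λ N g hg hN → h N _
        (λ {e} e<N → ∑-neg (tie false) (λ i → - R (suc i)) (C (suc N)) e<N (∑-weak (hg , hN) e<N)
          (sym (-‿distribʳ-* (C (suc N)) _)))
        (∑-pos N (tie false) (trans (∑-cong (downFrom (suc N)) (λ d → cong (g d ·_) (ι-≤ d N))) (trans (∑-below (suc N) g ℕₚ.≤-refl) (∑-total (hg , hN)))))
  -- A strict tie reads the old partial sum below e. At e = -1 the sign of the weight cancels that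
  -- of the antidifference and `R 0` reappears. The positive copy collects only the negative ones,
  -- so both counts become the old negative count.
  go (tie true ∷ ts)
    with q , hq , q0 , h ← transfer-reciprocity ts {a} {suc b} {suc d} C (antidifference (λ i → - R i)) (λ i → C i · R i)
           hC (Poly-antidifference b {λ i → - R i} (Poly-cong b (λ i → neg-· (R i)) (Poly-scale {R} b (- 1ℚ) hR)))
           (Poly-suc {λ i → C i · R i} d Poly-C·R)
           (ℕₚ.≤-trans (ℕₚ.≤-reflexive (ℕₚ.+-suc a b)) (s≤s a+b≤d))
           (antidifference-1 (λ i → - R i))
    = q , subst (λ k → Poly k q) (ℕₚ.+-suc (length ts) d) hq
    , trans q0 (cong (λ t → signCount ts t (C 0 · R 0)) (cong (C 0 ·_)
        (trans (antidifference-0 (λ i → - R i)) (-‿involutive (R 0)))))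
    , λ N g hg hN → h N _
        (λ {e} e<N → ∑-neg (tie true) (λ i → - R i) (C (suc N)) e<N (∑-strict (hg , hN) (ℕₚ.<⇒≤ e<N))
          (sym (-‿distribʳ-* (C (suc N)) _)))
        (∑-pos N (tie true) (∑-strict (hg , hN) ℕₚ.≤-refl))

ascent? : ∀ δ a b → Dec (a ≤ b × (δ ≡ true → a < b))
ascent? δ a b = (a ℕ.≤? b) ×-dec ((δ Bool.≟ true) →-dec (a ℕ.<? b))

ascent-okLetter : ∀ K δ a b {d e} → d < K → e < K →
  ι (ascent? δ (a ℕ.* K ℕ.+ d) (b ℕ.* K ℕ.+ e)) ≡ okLetter (gap a b δ) d e
ascent-okLetter K δ a b {d} {e} d<K e<K with ℕₚ.<-cmp a b
... | tri< a<b _ _ = ι-true (ascent? δ (a ℕ.* K ℕ.+ d) (b ℕ.* K ℕ.+ e)) (ℕₚ.<⇒≤ ad<be , λ _ → ad<be)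
  where
  ad<be : a ℕ.* K ℕ.+ d < b ℕ.* K ℕ.+ e
  ad<be = lex-< K a<b d<K
... | tri> _ _ b<a = ι-false (ascent? δ (a ℕ.* K ℕ.+ d) (b ℕ.* K ℕ.+ e)) (λ (ad≤be , _) → ℕₚ.<⇒≱ (lex-< K b<a e<K) ad≤be)
ascent-okLetter K false a b {d} {e} d<K e<K | tri≈ _ refl _ =
  ι-cong (ascent? false (a ℕ.* K ℕ.+ d) (a ℕ.* K ℕ.+ e)) (d ℕ.≤? e)
    (λ (le , _) → ℕₚ.+-cancelˡ-≤ (a ℕ.* K) d e le) (λ le → ℕₚ.+-monoʳ-≤ (a ℕ.* K) le , λ ())
ascent-okLetter K true a b {d} {e} d<K e<K | tri≈ _ refl _ =
  ι-cong (ascent? true (a ℕ.* K ℕ.+ d) (a ℕ.* K ℕ.+ e)) (d ℕ.<? e)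
    (λ (_ , lt) → ℕₚ.+-cancelˡ-< (a ℕ.* K) d e (lt refl))
    (λ lt → ℕₚ.<⇒≤ (ℕₚ.+-monoʳ-< (a ℕ.* K) lt) , λ _ → ℕₚ.+-monoʳ-< (a ℕ.* K) lt)

ΘAt-FCoeff : ∀ N (A : Fin (suc n) → Bool) (σ : Permutation′ (suc n)) w →
  ΘAt N (FCoeff A σ) w ≡ transferΘ N (gapList (λ k → w (σ ⟨$⟩ʳ k)) (λ i j → A i)) (wtΘ N)
ΘAt-FCoeff {n} N A σ w = begin
  ∑ ds (λ d → ∏ (λ j → wtΘ N (d j)) · FCoeff A σ (refineΘ N w d))
    -- The product of the weights is invariant under σ, so the copies may be summed in the order in
    -- which σ reads the positions.
    ≡⟨ ∑-cong ds (λ d → cong₂ _·_ (∏-permute (λ j → wtΘ N (d j)) σ) (ι-chain (λ i j → ascent? (A i) (f (λ i → d (σ ⟨$⟩ʳ i)) i) (f (λ i → d (σ ⟨$⟩ʳ i)) j)))) ⟩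
  ∑ ds (λ d → g (λ i → d (σ ⟨$⟩ʳ i)))
    ≡⟨ ∑-funs-permute ℕ._≟_ (downFrom⁺ (suc N)) σ
         (λ {d} {e} eq → cong₂ _·_ (∏-cong (λ j → cong (wtΘ N) (eq j)))
           (chain-cong (λ i j _ → cong₂ (λ a b → ι (ascent? (A i) a b)) (f-cong eq i) (f-cong eq j)))) ⟩
  ∑ ds g
    ≡⟨ ∑-funs-cong∈ (downFrom (suc N)) (suc n) (λ d d∈ → trans
         (cong (∏ (λ j → wtΘ N (d j)) ·_) (chain-cong (λ i j _ → ascent-okLetter (suc N) (A i) (v i) (v j) (∈-downFrom⁻ (d∈ i)) (∈-downFrom⁻ (d∈ j)))))
         (∏-chain (λ j → wtΘ N (d j)) _)) ⟩
  ∑ ds (λ d → wtΘ N (d zero) · chain (λ i j → okΘ N (gap (v i) (v j) (A i)) (d i) (d j)))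
    ≡⟨ ∑-chain (downFrom (suc N)) (okΘ N) v (λ i j → A i) (wtΘ N) ⟩
  transferΘ N (gapList v (λ i j → A i)) (wtΘ N) ∎
  where
  ds : List (Word (suc n))
  ds = funs (downFrom (suc N)) (suc n)
  v : Fin (suc n) → ℕ
  v k = w (σ ⟨$⟩ʳ k)
  f : Word (suc n) → Word (suc n)
  f d k = v k ℕ.* suc N ℕ.+ d k
  f-cong : ∀ {d e : Word (suc n)} → (∀ i → d i ≡ e i) → ∀ i → f d i ≡ f e i
  f-cong eq i = cong (v i ℕ.* suc N ℕ.+_) (eq i)
  g : Word (suc n) → ℚ
  g d = ∏ (λ j → wtΘ N (d j)) · chain (λ i j → ι (ascent? (A i) (f d i) (f d j)))

Θ-FCoeff-signCount : ∀ (A : Fin (suc n) → Bool) (σ : Permutation′ (suc n)) w →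
  Θ (FCoeff A σ) w ≡ signCount (gapList (λ k → w (σ ⟨$⟩ʳ k)) (λ i j → A i)) 1ℚ 1ℚ
Θ-FCoeff-signCount {n} A σ w
  -- The initial weights -1 and 1 have the shape of the state after a jump with total 1.
  with q , hq , q0 , h ← transfer-reciprocity (gapList (λ k → w (σ ⟨$⟩ʳ k)) (λ i j → A i)) {0} {1} {1}
         (λ _ → 1ℚ) (antidifference (λ _ → - 1ℚ)) (λ _ → 1ℚ)
         (λ _ → refl) (Poly-antidifference 0 {λ _ → - 1ℚ} (λ _ → refl)) (Poly-const 1 1ℚ) ℕₚ.≤-refl
         (antidifference-1 (λ _ → - 1ℚ))
  = trans
    (ΘSubst.substitute-Poly {x = FCoeff A σ} {w} q
      (subst (λ k → Poly k q) (trans (ℕₚ.+-comm _ 1) (cong suc (length-gapList (λ k → w (σ ⟨$⟩ʳ k)) (λ i j → A i)))) hq)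
      (λ N → trans (ΘAt-FCoeff N A σ w) (h N (wtΘ N)
        (λ {e} e<N → trans (wtΘ-neg e<N) (sym (trans (Q.*-identityˡ _) (Δ-antidifference (λ _ → - 1ℚ) (suc e)))))
        (wtΘ-pos N))))
    (trans q0 (cong (λ t → signCount (gapList (λ k → w (σ ⟨$⟩ʳ k)) (λ i j → A i)) t 1ℚ)
      (trans (Q.*-identityˡ _) (trans (antidifference-0 (λ _ → - 1ℚ)) (-‿involutive 1ℚ)))))

does-true : ∀ {P : Set} (d : Dec P) → does d ≡ true → P
does-true (yes p) _ = p

does-false : ∀ {P : Set} (d : Dec P) → does d ≡ false → ¬ P
does-false (no ¬p) _ = ¬p

-- Both sides run the sign recursion, once with A and once with the descents of γ as tie flags.
-- These may differ, but they have the same peaks, which by `signCount-peaks` determine the result.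
Θ-FCoeff : ∀ (A : Fin n → Bool) (σ γ : Permutation′ n) →
  (∀ p → (IsPeak γ p → InPeakOf A p) × (InPeakOf A p → IsPeak γ p)) → Θ (FCoeff A σ) ≋ KCoeff γ σ
Θ-FCoeff {zero} A σ γ _ w = trans (Q.+-identityʳ _) (Q.*-identityˡ 1ℚ)
Θ-FCoeff {suc n} A σ γ peaks w = begin
  Θ (FCoeff A σ) w
    ≡⟨ Θ-FCoeff-signCount A σ w ⟩
  signCount (gapList v (λ i j → A i)) 1ℚ 1ℚ
    ≡⟨ signCount-peaks v (λ i j → A i) (descent γ) true true 1ℚ (λ _ _ → refl)
         (λ i j k i→j j→k → Boolₚ.⇔→≡ (mk⇔ (there-peak i→j j→k) (back-peak i→j j→k))) ⟩
  signCount (gapList v (descent γ)) 1ℚ 1ℚ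
    ≡⟨ sym (KCoeff-signCount γ σ w) ⟩
  KCoeff γ σ w ∎
  where
  v : Fin (suc n) → ℕ
  v k = w (σ ⟨$⟩ʳ k)
  there-peak : ∀ {i j k} → Next i j → Next j k → not (A i) ∧ A j ≡ true → not (descent γ i j) ∧ descent γ j k ≡ true
  there-peak {i} {j} {k} i→j j→k eq with A i in Ai | A j in Aj
  ... | false | true with i′ , k′ , i′→j , j→k′ , γi<γj , γk<γj ← proj₂ (peaks j) (Aj , i , i→j , Ai)
    with refl ← Finₚ.toℕ-injective (ℕₚ.suc-injective (trans (sym i′→j) i→j))
    with refl ← Finₚ.toℕ-injective (trans j→k′ (sym j→k))
    = cong₂ (λ a b → not a ∧ b) (dec-false (γ ⟨$⟩ʳ j Fin.<? γ ⟨$⟩ʳ i) (ℕₚ.<-asym γi<γj)) (dec-true (γ ⟨$⟩ʳ k Fin.<? γ ⟨$⟩ʳ j) γk<γj)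
  split : ∀ x y → not x ∧ y ≡ true → x ≡ false × y ≡ true
  split false y eq = refl , eq
  back-peak : ∀ {i j k} → Next i j → Next j k → not (descent γ i j) ∧ descent γ j k ≡ true → not (A i) ∧ A j ≡ true
  back-peak {i} {j} {k} i→j j→k eq
    with desc-ij , desc-jk ← split (descent γ i j) (descent γ j k) eq
    with Aj , i′ , i′→j , Ai ← proj₁ (peaks j)
           (i , k , i→j , j→k
           , Finₚ.≤∧≢⇒< (ℕₚ.≮⇒≥ (does-false (γ ⟨$⟩ʳ j Fin.<? γ ⟨$⟩ʳ i) desc-ij)) (Next-≢ i→j ∘ perm-injective γ)
           , does-true (γ ⟨$⟩ʳ k Fin.<? γ ⟨$⟩ʳ j) desc-jk)
    with refl ← Finₚ.toℕ-injective (ℕₚ.suc-injective (trans (sym i′→j) i→j))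
    = cong₂ (λ a b → not a ∧ b) Ai Aj

-- Order patterns and fundamental expansions

module _ {P Q : A → Set} (P? : ∀ x → Dec (P x)) (Q? : ∀ x → Dec (Q x)) (P⇒Q : ∀ x → P x → Q x) where

  count-≤ : ∀ xs → length (filter P? xs) ≤ length (filter Q? xs)
  count-≤ [] = z≤n
  count-≤ (x ∷ xs) with P? x | Q? x
  ... | yes _ | yes _ = s≤s (count-≤ xs)
  ... | yes p | no ¬q = contradiction (P⇒Q x p) ¬q
  ... | no _  | yes _ = ℕₚ.m≤n⇒m≤1+n (count-≤ xs)
  ... | no _  | no _  = count-≤ xs

  count-< : ∀ {x} xs → x ∈ xs → ¬ P x → Q x → length (filter P? xs) < length (filter Q? xs)
  count-< (x ∷ xs) (here refl) ¬p q with P? x | Q? x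
  ... | yes p | _     = contradiction p ¬p
  ... | no _  | yes _ = s≤s (count-≤ xs)
  ... | no _  | no ¬q = contradiction q ¬q
  count-< (y ∷ xs) (there x∈) ¬p q with P? y | Q? y
  ... | yes _ | yes _ = s≤s (count-< xs x∈ ¬p q)
  ... | yes p | no ¬q = contradiction (P⇒Q y p) ¬q
  ... | no _  | yes _ = ℕₚ.m≤n⇒m≤1+n (count-< xs x∈ ¬p q)
  ... | no _  | no _  = count-< xs x∈ ¬p q

-- The canonical word of an order pattern: its letters stay below n, so the patterns are found in a
-- finite list.
rank : Word n → Word n
rank w i = countFin (λ j → w j ℕ.<? w i)

rank<n : ∀ (w : Word n) i → rank w i < n
rank<n {n} w i = ℕₚ.<-≤-trans
  (filter-notAll (λ j → w j ℕ.<? w i) (allFin n) (lose (∈-allFin i) (ℕₚ.<-irrefl refl)))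
  (ℕₚ.≤-reflexive (length-tabulate (λ j → j)))

rank-mono-< : ∀ (w : Word n) {i j} → w i < w j → rank w i < rank w j
rank-mono-< {n} w {i} {j} wi<wj = count-< (λ k → w k ℕ.<? w i) (λ k → w k ℕ.<? w j)
  (λ k wk<wi → ℕₚ.<-trans wk<wi wi<wj) (allFin n) (∈-allFin i) (ℕₚ.<-irrefl refl) wi<wj

rank-cong-≡ : ∀ (w : Word n) {i j} → w i ≡ w j → rank w i ≡ rank w j
rank-cong-≡ {n} w {i} {j} eq = cong (λ a → countFin (λ k → w k ℕ.<? a)) eq

SameOrder : Word n → Word n → Set
SameOrder w w′ = (∀ i j → w i < w j → w′ i < w′ j) × (∀ i j → w i ≡ w j → w′ i ≡ w′ j)

SameOrder-rank : ∀ (w : Word n) → SameOrder w (rank w)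
SameOrder-rank w = (λ i j → rank-mono-< w) , (λ i j → rank-cong-≡ w)

SameOrder-reflects-< : ∀ {w w′ : Word n} → SameOrder w w′ → ∀ i j → w′ i < w′ j → w i < w j
SameOrder-reflects-< {w = w} (lt , eq) i j w′i<w′j with ℕₚ.<-cmp (w i) (w j)
... | tri< wi<wj _ _ = wi<wj
... | tri≈ _ wi≡wj _ = contradiction w′i<w′j (ℕₚ.<-irrefl (eq i j wi≡wj))
... | tri> _ _ wj<wi = contradiction w′i<w′j (ℕₚ.<-asym (lt j i wj<wi))

rank-cong : ∀ {w w′ : Word n} → SameOrder w w′ → ∀ i → rank w i ≡ rank w′ i
rank-cong {n} {w} {w′} same i = ℕₚ.≤-antisym
  (count-≤ (λ k → w k ℕ.<? w i) (λ k → w′ k ℕ.<? w′ i) (λ k → proj₁ same k i) (allFin n))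
  (count-≤ (λ k → w′ k ℕ.<? w′ i) (λ k → w k ℕ.<? w i) (λ k → SameOrder-reflects-< same k i) (allFin n))

≗⇒SameOrder : ∀ {w w′ : Word n} → (∀ i → w i ≡ w′ i) → SameOrder w w′
≗⇒SameOrder eq = (λ i j → subst₂ _<_ (eq i) (eq j)) , (λ i j e → trans (sym (eq i)) (trans e (eq j)))

-- The basis-free form of membership in NCQSym.
OrderInvariant : Series n → Set
OrderInvariant x = ∀ w w′ → SameOrder w w′ → x w ≡ x w′

injective⇒surjective : ∀ {f : Fin n → Fin n} → Injective _≡_ _≡_ f → ∀ y → ∃[ x ] f x ≡ y
injective⇒surjective {suc n} {f} inj y with any? (λ x → f x Fin.≟ y)
... | yes found = found
... | no ¬found = contradiction
  (injective⇒≤ {f = λ x → punchOut (λ y≡fx → ¬found (x , sym y≡fx))}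
    (λ {a} {b} eq → inj (Finₚ.punchOut-injective (λ y≡fx → ¬found (a , sym y≡fx)) (λ y≡fx → ¬found (b , sym y≡fx)) eq)))
  ℕₚ.1+n≰n

injective⇒permutation : ∀ (f : Fin n → Fin n) → Injective _≡_ _≡_ f → ∃ λ (σ : Permutation′ n) → ∀ i → σ ⟨$⟩ˡ i ≡ f i
injective⇒permutation {n} f inj = permutation f⁻¹ f
  (λ x → inj (proj₂ (surj′ (f x)))) (λ y → proj₂ (surj′ y)) , λ _ → refl
  where
  surj′ : ∀ y → ∃[ x ] f x ≡ y
  surj′ = injective⇒surjective inj
  f⁻¹ : Fin n → Fin n
  f⁻¹ y = proj₁ (surj′ y)

-- Ties are broken by position, so σ is the stable sorting permutation of u.
stableSort : ∀ (u : Word n) → ∃ λ (σ : Permutation′ n) → ∀ {a b} → a Fin.< b →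
  u (σ ⟨$⟩ʳ a) ≤ u (σ ⟨$⟩ʳ b) × (u (σ ⟨$⟩ʳ a) ≡ u (σ ⟨$⟩ʳ b) → σ ⟨$⟩ʳ a Fin.< σ ⟨$⟩ʳ b)
stableSort {n} u = σ , sorted
  where
  -- The keys are pairwise distinct, so their ranks form a permutation.
  key : Word n
  key i = u i ℕ.* n ℕ.+ toℕ i
  r : Fin n → Fin n
  r i = fromℕ< (rank<n key i)
  toℕ-r : ∀ i → toℕ (r i) ≡ rank key i
  toℕ-r i = Finₚ.toℕ-fromℕ< (rank<n key i)
  r-injective : Injective _≡_ _≡_ r
  r-injective {i} {j} eq with ℕₚ.<-cmp (key i) (key j)
  ... | tri≈ _ ki≡kj _ = Finₚ.toℕ-injective
    (proj₂ (lex-injective n {u i} {toℕ i} {u j} {toℕ j} (Finₚ.toℕ<n i) (Finₚ.toℕ<n j) ki≡kj))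
  ... | tri< ki<kj _ _ = contradiction (trans (sym (toℕ-r i)) (trans (cong toℕ eq) (toℕ-r j))) (ℕₚ.<⇒≢ (rank-mono-< key ki<kj))
  ... | tri> _ _ kj<ki = contradiction (trans (sym (toℕ-r j)) (trans (cong toℕ (sym eq)) (toℕ-r i))) (ℕₚ.<⇒≢ (rank-mono-< key kj<ki))
  σ : Permutation′ n
  σ = proj₁ (injective⇒permutation r r-injective)
  position : ∀ a → toℕ a ≡ rank key (σ ⟨$⟩ʳ a)
  position a = trans (cong toℕ (trans (sym (Perm.inverseˡ σ)) (proj₂ (injective⇒permutation r r-injective) (σ ⟨$⟩ʳ a)))) (toℕ-r (σ ⟨$⟩ʳ a))
  key-sorted : ∀ {a b} → a Fin.< b → key (σ ⟨$⟩ʳ a) < key (σ ⟨$⟩ʳ b)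
  key-sorted {a} {b} a<b = SameOrder-reflects-< (SameOrder-rank key) _ _ (subst₂ _<_ (position a) (position b) a<b)
  sorted : ∀ {a b} → a Fin.< b → u (σ ⟨$⟩ʳ a) ≤ u (σ ⟨$⟩ʳ b) × (u (σ ⟨$⟩ʳ a) ≡ u (σ ⟨$⟩ʳ b) → σ ⟨$⟩ʳ a Fin.< σ ⟨$⟩ʳ b)
  sorted {a} {b} a<b =
    ℕₚ.≮⇒≥ (λ ub<ua → ℕₚ.<-asym (key-sorted a<b) (lex-< n ub<ua (Finₚ.toℕ<n (σ ⟨$⟩ʳ b)))) ,
    (λ ua≡ub → ℕₚ.+-cancelˡ-< (u (σ ⟨$⟩ʳ b) ℕ.* n) _ _ (subst (λ c → c ℕ.* n ℕ.+ toℕ (σ ⟨$⟩ʳ a) < key (σ ⟨$⟩ʳ b)) ua≡ub (key-sorted a<b)))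

punchIn-mono-< : ∀ (k : Fin (suc n)) {i j} → i Fin.< j → punchIn k i Fin.< punchIn k j
punchIn-mono-< k {i} {j} i<j = Finₚ.≤∧≢⇒< (Finₚ.punchIn-mono-≤ k i j (ℕₚ.<⇒≤ i<j)) (λ eq → ℕₚ.<⇒≢ i<j (cong toℕ (Finₚ.punchIn-injective k i j eq)))

HasDescents : Permutation′ n → (Fin n → Bool) → Set
HasDescents γ A = ∀ i j → Next i j →
  (A i ≡ true → γ ⟨$⟩ʳ j Fin.< γ ⟨$⟩ʳ i) × (A i ≡ false → γ ⟨$⟩ʳ i Fin.< γ ⟨$⟩ʳ j)

-- The first value is placed above or below all later ones as A prescribes, which leaves the
-- descents of the rest unchanged. This supplies the permutation γ that names the Θ-image of a term.
descents-realisable : ∀ (A : Fin n → Bool) → ∃ λ γ → HasDescents γ A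
descents-realisable {zero}  A = Perm.id , λ ()
descents-realisable {suc n} A with descents-realisable (A ∘ suc)
... | γ , hγ = Perm.insert zero top γ , go
  where
  top : Fin (suc n)
  top = if A zero then fromℕ n else zero
  at-suc : ∀ k → Perm.insert zero top γ ⟨$⟩ʳ suc k ≡ punchIn top (γ ⟨$⟩ʳ k)
  at-suc k = Perm.insert-punchIn zero top γ k
  go : HasDescents (Perm.insert zero top γ) A
  go (suc i) (suc j) i→j rewrite at-suc i | at-suc j with hγ i j (ℕₚ.suc-injective i→j)
  ... | desc , asc = punchIn-mono-< top ∘ desc , punchIn-mono-< top ∘ asc
  go zero (suc j) _ rewrite at-suc j with A zero
  ... | true  = (λ _ → Finₚ.≤∧≢⇒< (Finₚ.≤fromℕ _) (Finₚ.punchInᵢ≢i (fromℕ n) (γ ⟨$⟩ʳ j))) , λ ()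
  ... | false = (λ ()) , λ _ → s≤s z≤n

descents⇒peaks : ∀ {A : Fin n → Bool} {γ : Permutation′ n} → GapSet A → HasDescents γ A →
  ∀ p → (IsPeak γ p → InPeakOf A p) × (InPeakOf A p → IsPeak γ p)
descents⇒peaks {n} {A} {γ} gapSet h p = there-peak , back-peak
  where
  there-peak : IsPeak γ p → InPeakOf A p
  there-peak (i , j , i→p , p→j , γi<γp , γj<γp) with A p in Ap | A i in Ai
  ... | false | _     = contradiction γj<γp (ℕₚ.<-asym (proj₂ (h p j p→j) Ap))
  ... | true  | true  = contradiction γi<γp (ℕₚ.<-asym (proj₁ (h i p i→p) Ai))
  ... | true  | false = refl , i , i→p , Ai
  back-peak : InPeakOf A p → IsPeak γ p
  back-peak (Ap , i , i→p , Ai) = i , j , i→p , p→j , proj₂ (h i p i→p) Ai , proj₁ (h p j p→j) Ap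
    where
    -- `GapSet` keeps p away from the last position, where no peak can be.
    j : Fin n
    j = fromℕ< (gapSet p Ap)
    p→j : Next p j
    p→j = Finₚ.toℕ-fromℕ< (gapSet p Ap)

Fin-<-induction : ∀ {R : Fin n → Fin n → Set} → (∀ i j → Next i j → R i j) →
  (∀ {i j k} → R i j → R j k → R i k) → ∀ {i j} → i Fin.< j → R i j
Fin-<-induction {n} {R} next R-trans {i} {j} i<j = go (toℕ j ℕ.∸ suc (toℕ i)) j (sym (ℕₚ.m+[n∸m]≡n i<j))
  where
  go : ∀ k j → toℕ j ≡ suc (toℕ i) ℕ.+ k → R i j
  go zero    j eq = next i j (trans eq (cong suc (ℕₚ.+-identityʳ (toℕ i))))
  go (suc k) j eq = R-trans (go k j′ (Finₚ.toℕ-fromℕ< j′<n)) (next j′ j (trans eq′ (cong suc (sym (Finₚ.toℕ-fromℕ< j′<n)))))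
    where
    eq′ : toℕ j ≡ suc (suc (toℕ i) ℕ.+ k)
    eq′ = trans eq (ℕₚ.+-suc (suc (toℕ i)) k)
    j′<n : suc (toℕ i) ℕ.+ k < n
    j′<n = ℕₚ.<-trans (ℕₚ.≤-reflexive (sym eq′)) (Finₚ.toℕ<n j)
    j′ : Fin n
    j′ = fromℕ< j′<n

-- The condition that M_φ imposes on consecutive positions of the sorted word, where F has a weak or
-- a strict inequality.
Step : Bool → ℕ → ℕ → Set
Step true  a b = a < b
Step false a b = a ≡ b

step? : ∀ s a b → Dec (Step s a b)
step? true  a b = a ℕ.<? b
step? false a b = a ℕ.≟ b

ι-ascent-true : ∀ a b → ι (ascent? true a b) ≡ ι (a ℕ.<? b)
ι-ascent-true a b = ι-cong (ascent? true a b) (a ℕ.<? b) (λ (_ , lt) → lt refl) (λ lt → ℕₚ.<⇒≤ lt , λ _ → lt)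

ι-≡ : ∀ a b → ι (ascent? false a b) + - 1ℚ · ι (ascent? true a b) ≡ ι (a ℕ.≟ b)
ι-≡ a b with ℕₚ.<-cmp a b
... | tri< a<b a≢b _ = begin
  ι (ascent? false a b) + - 1ℚ · ι (ascent? true a b)
    ≡⟨ cong₂ (λ s t → s + - 1ℚ · t) (ι-true (ascent? false a b) (ℕₚ.<⇒≤ a<b , λ ())) (ι-true (ascent? true a b) (ℕₚ.<⇒≤ a<b , λ _ → a<b)) ⟩
  1ℚ + - 1ℚ · 1ℚ ≡⟨ trans (cong (1ℚ +_) (neg-· 1ℚ)) (Q.-‿inverseʳ 1ℚ) ⟩
  0ℚ             ≡⟨ sym (ι-false (a ℕ.≟ b) a≢b) ⟩
  ι (a ℕ.≟ b)    ∎
... | tri≈ a≮b a≡b _ = begin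
  ι (ascent? false a b) + - 1ℚ · ι (ascent? true a b)
    ≡⟨ cong₂ (λ s t → s + - 1ℚ · t) (ι-true (ascent? false a b) (ℕₚ.≤-reflexive a≡b , λ ())) (ι-false (ascent? true a b) (λ (_ , lt) → a≮b (lt refl))) ⟩
  1ℚ + - 1ℚ · 0ℚ ≡⟨ trans (cong (1ℚ +_) (Q.zeroʳ _)) (Q.+-identityʳ 1ℚ) ⟩
  1ℚ             ≡⟨ sym (ι-true (a ℕ.≟ b) a≡b) ⟩
  ι (a ℕ.≟ b)    ∎
... | tri> a≮b a≢b b<a = begin
  ι (ascent? false a b) + - 1ℚ · ι (ascent? true a b)
    ≡⟨ cong₂ (λ s t → s + - 1ℚ · t) (ι-false (ascent? false a b) (λ (le , _) → ℕₚ.<⇒≱ b<a le)) (ι-false (ascent? true a b) (λ (_ , lt) → a≮b (lt refl))) ⟩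
  0ℚ + - 1ℚ · 0ℚ ≡⟨ trans (cong (0ℚ +_) (Q.zeroʳ _)) (Q.+-identityʳ 0ℚ) ⟩
  0ℚ             ≡⟨ sym (ι-false (a ℕ.≟ b) a≢b) ⟩
  ι (a ℕ.≟ b)    ∎

prependGap : Bool → ℚ × (Fin n → Bool) → List (ℚ × (Fin (suc n) → Bool))
prependGap true  (c , A) = (c , true F.∷ A) ∷ []
prependGap false (c , A) = (c , false F.∷ A) ∷ (- 1ℚ · c , true F.∷ A) ∷ []

-- Möbius inversion over the gap sets A ⊇ S: a gap outside S is forced to be
-- an equality by [a ≤ b] − [a < b].
gapSets : (Fin n → Bool) → List (ℚ × (Fin n → Bool))
gapSets {zero}        S = (1ℚ , λ _ → false) ∷ []
-- No gap follows the last position, which therefore stays outside every A.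
gapSets {suc zero}    S = (1ℚ , λ _ → false) ∷ []
gapSets {suc (suc n)} S = concatMap (prependGap (S zero)) (gapSets (S ∘ suc))

∑-gapSets : ∀ (S : Fin n → Bool) (v : Fin n → ℕ) →
  ∑ (gapSets S) (λ (c , A) → c · chain (λ i j → ι (ascent? (A i) (v i) (v j)))) ≡ chain (λ i j → ι (step? (S i) (v i) (v j)))
∑-gapSets {zero}        S v = trans (Q.+-identityʳ _) (Q.*-identityʳ 1ℚ)
∑-gapSets {suc zero}    S v = trans (Q.+-identityʳ _) (Q.*-identityʳ 1ℚ)
∑-gapSets {suc (suc n)} S v = begin
  ∑ (concatMap (prependGap (S zero)) (gapSets (S ∘ suc))) term
    ≡⟨ ∑-concatMap (prependGap (S zero)) (gapSets (S ∘ suc)) term ⟩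
  ∑ (gapSets (S ∘ suc)) (λ cA → ∑ (prependGap (S zero) cA) term)
    ≡⟨ ∑-cong (gapSets (S ∘ suc)) (∑-split (S zero)) ⟩
  ∑ (gapSets (S ∘ suc)) (λ cA → ι (step? (S zero) v₀ v₁) · term′ cA)
    ≡⟨ sym (·-∑ _ (gapSets (S ∘ suc)) term′) ⟩
  ι (step? (S zero) v₀ v₁) · ∑ (gapSets (S ∘ suc)) term′
    ≡⟨ cong (ι (step? (S zero) v₀ v₁) ·_) (∑-gapSets (S ∘ suc) (v ∘ suc)) ⟩
  chain (λ i j → ι (step? (S i) (v i) (v j))) ∎
  where
  v₀ = v zero
  v₁ = v (suc zero)
  term : ℚ × (Fin (suc (suc n)) → Bool) → ℚ
  term (c , A) = c · chain (λ i j → ι (ascent? (A i) (v i) (v j)))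
  term′ : ℚ × (Fin (suc n) → Bool) → ℚ
  term′ (c , A) = c · chain (λ i j → ι (ascent? (A i) (v (suc i)) (v (suc j))))
  ∑-split : ∀ s cA → ∑ (prependGap s cA) term ≡ ι (step? s v₀ v₁) · term′ cA
  ∑-split true (c , A) = begin
    c · (ι (ascent? true v₀ v₁) · X) + 0ℚ ≡⟨ cong (λ t → c · (t · X) + 0ℚ) (ι-ascent-true v₀ v₁) ⟩
    c · (ι (v₀ ℕ.<? v₁) · X) + 0ℚ         ≡⟨ solve 3 (λ c a x → c :* (a :* x) :+ con 0 := a :* (c :* x)) refl c (ι (v₀ ℕ.<? v₁)) X ⟩
    ι (v₀ ℕ.<? v₁) · (c · X)              ∎
    where X = chain (λ i j → ι (ascent? (A i) (v (suc i)) (v (suc j))))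
  ∑-split false (c , A) = begin
    c · (ι (ascent? false v₀ v₁) · X) + ((- 1ℚ · c) · (ι (ascent? true v₀ v₁) · X) + 0ℚ)
      ≡⟨ solve 5 (λ c a b m x → c :* (a :* x) :+ ((m :* c) :* (b :* x) :+ con 0) := (a :+ m :* b) :* (c :* x)) refl
           c (ι (ascent? false v₀ v₁)) (ι (ascent? true v₀ v₁)) (- 1ℚ) X ⟩
    (ι (ascent? false v₀ v₁) + - 1ℚ · ι (ascent? true v₀ v₁)) · (c · X)
      ≡⟨ cong (_· (c · X)) (ι-≡ v₀ v₁) ⟩
    ι (v₀ ℕ.≟ v₁) · (c · X) ∎
    where X = chain (λ i j → ι (ascent? (A i) (v (suc i)) (v (suc j))))

Contains : (S A : Fin n → Bool) → Set
Contains S A = ∀ i j → Next i j → S i ≡ true → A i ≡ true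

gapSets-valid : ∀ (S : Fin n → Bool) → All (λ (c , A) → GapSet A × Contains S A) (gapSets S)
gapSets-valid {zero}        S = ((λ _ ()) , λ ()) ∷ []
gapSets-valid {suc zero}    S = ((λ _ ()) , λ { zero zero () }) ∷ []
gapSets-valid {suc (suc n)} S = Allₚ.concat⁺ (Allₚ.map⁺ (All.map (split-valid (S zero) refl) (gapSets-valid (S ∘ suc))))
  where
  gapSet-∷ : ∀ {A} b → GapSet A → GapSet {suc (suc n)} (b F.∷ A)
  gapSet-∷ b gapSet zero    _  = s≤s (s≤s z≤n)
  gapSet-∷ b gapSet (suc i) Ai = s≤s (gapSet i Ai)
  split-valid : ∀ s → S zero ≡ s → ∀ {cA} → GapSet (proj₂ cA) × Contains (S ∘ suc) (proj₂ cA) →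
    All (λ (c , A) → GapSet A × Contains S A) (prependGap s cA)
  split-valid true  _ {c , A} (gapSet , cont) =
    (gapSet-∷ true gapSet , λ { zero j _ _ → refl ; (suc i) (suc j) i→j → cont i j (ℕₚ.suc-injective i→j) }) ∷ []
  split-valid false S0 {c , A} (gapSet , cont) =
    (gapSet-∷ false gapSet , λ { zero j _ S0′ → contradiction (trans (sym S0) S0′) λ () ; (suc i) (suc j) i→j → cont i j (ℕₚ.suc-injective i→j) }) ∷
    (gapSet-∷ true gapSet , λ { zero j _ _ → refl ; (suc i) (suc j) i→j → cont i j (ℕₚ.suc-injective i→j) }) ∷ []

module _ (u : Word n) where

  sort : Permutation′ n
  sort = proj₁ (stableSort u)

  private
    u∘sort : Word n
    u∘sort k = u (sort ⟨$⟩ʳ k)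

  increase? : ∀ i → Dec (∃[ j ] Next i j × u∘sort i < u∘sort j)
  increase? i = any? (λ j → (toℕ j ℕ.≟ suc (toℕ i)) ×-dec (u∘sort i ℕ.<? u∘sort j))

  increases : Fin n → Bool
  increases i = does (increase? i)

  Next⇒< : ∀ {i j : Fin n} → Next i j → i Fin.< j
  Next⇒< i→j = ℕₚ.≤-reflexive (sym i→j)

  increases-step : ∀ i j → Next i j → Step (increases i) (u∘sort i) (u∘sort j)
  increases-step i j i→j with increase? i
  ... | no ¬inc = ℕₚ.≤-antisym (proj₁ (proj₂ (stableSort u) (Next⇒< i→j))) (ℕₚ.≮⇒≥ (λ lt → ¬inc (j , i→j , lt)))
  ... | yes (j′ , i→j′ , lt) with refl ← Finₚ.toℕ-injective (trans i→j′ (sym i→j)) = lt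

  sameOrder⇒step : ∀ {w} → SameOrder u w → ∀ i j → Next i j → Step (increases i) (w (sort ⟨$⟩ʳ i)) (w (sort ⟨$⟩ʳ j))
  sameOrder⇒step same i j i→j with increases i | increases-step i j i→j
  ... | true  | lt = proj₁ same _ _ lt
  ... | false | eq = proj₂ same _ _ eq

  step⇒sameOrder : ∀ {w} → (∀ i j → Next i j → Step (increases i) (w (sort ⟨$⟩ʳ i)) (w (sort ⟨$⟩ʳ j))) → SameOrder u w
  step⇒sameOrder {w} steps =
    (λ p q → subst₂ (λ a b → u a < u b → w a < w b) (Perm.inverseʳ sort) (Perm.inverseʳ sort) (proj₁ (both (sort ⟨$⟩ˡ p) (sort ⟨$⟩ˡ q)))) ,
    (λ p q → subst₂ (λ a b → u a ≡ u b → w a ≡ w b) (Perm.inverseʳ sort) (Perm.inverseʳ sort) (proj₂ (both (sort ⟨$⟩ˡ p) (sort ⟨$⟩ˡ q))))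
    where
    w∘sort : Word n
    w∘sort k = w (sort ⟨$⟩ʳ k)
    -- Being ordered alike and upwards in u and w is transitive, so it spreads from consecutive
    -- positions to all pairs.
    R : Fin n → Fin n → Set
    R i j = (u∘sort i < u∘sort j × w∘sort i < w∘sort j) ⊎ (u∘sort i ≡ u∘sort j × w∘sort i ≡ w∘sort j)
    R-trans : ∀ {i j k} → R i j → R j k → R i k
    R-trans {i} (inj₁ (a , b)) (inj₁ (c , d)) = inj₁ (ℕₚ.<-trans a c , ℕₚ.<-trans b d)
    R-trans {i} (inj₁ (a , b)) (inj₂ (c , d)) = inj₁ (subst (u∘sort i <_) c a , subst (w∘sort i <_) d b)
    R-trans {k = k} (inj₂ (a , b)) (inj₁ (c , d)) = inj₁ (subst (_< u∘sort k) (sym a) c , subst (_< w∘sort k) (sym b) d)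
    R-trans (inj₂ (a , b)) (inj₂ (c , d)) = inj₂ (trans a c , trans b d)
    R-next : ∀ i j → Next i j → R i j
    R-next i j i→j with increases i | increases-step i j i→j | steps i j i→j
    ... | true  | lt | lt′ = inj₁ (lt , lt′)
    ... | false | eq | eq′ = inj₂ (eq , eq′)
    both : ∀ i j → (u∘sort i < u∘sort j → w∘sort i < w∘sort j) × (u∘sort i ≡ u∘sort j → w∘sort i ≡ w∘sort j)
    both i j with Finₚ.<-cmp i j
    ... | tri≈ _ refl _ = (λ lt → contradiction lt (ℕₚ.<-irrefl refl)) , λ _ → refl
    ... | tri< i<j _ _ with Fin-<-induction {R = R} R-next R-trans i<j
    ...   | inj₁ (lt , lt′) = (λ _ → lt′) , λ eq → contradiction eq (ℕₚ.<⇒≢ lt)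
    ...   | inj₂ (eq , eq′) = (λ lt → contradiction lt (ℕₚ.<-irrefl eq)) , λ _ → eq′
    both i j | tri> _ _ j<i with Fin-<-induction {R = R} R-next R-trans j<i
    ...   | inj₁ (lt , lt′) = (λ gt → contradiction gt (ℕₚ.<-asym lt)) , λ eq → contradiction lt (ℕₚ.<-irrefl (sym eq))
    ...   | inj₂ (eq , eq′) = (λ lt → contradiction lt (ℕₚ.<-irrefl (sym eq))) , λ _ → sym eq′

  monomialTerm : ℚ → ℚ × (Fin n → Bool) → FTerm n
  monomialTerm c (m , A) = record { fcoef = c · m ; gaps = A ; perm = sort ; pkPerm = proj₁ (descents-realisable A) }

  -- Stability of the sort gives Des(σ) ⊆ A: where the sorted word does not increase, σ ascends, so
  -- every descent of σ is an increase of u and lies in A.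
  monomialTerm-valid : ∀ c {mA} → GapSet (proj₂ mA) × Contains increases (proj₂ mA) → ValidFTerm (monomialTerm c mA)
  monomialTerm-valid c {m , A} (gapSet , cont) = gapSet , desIn , descents⇒peaks {A = A} {proj₁ (descents-realisable A)} gapSet (proj₂ (descents-realisable A))
    where
    desIn : DesIn sort A
    desIn i j i→j desc = cont i j i→j (go (increase? i) (increases-step i j i→j))
      where
      go : (d : Dec (∃[ j ] Next i j × u∘sort i < u∘sort j)) → Step (does d) (u∘sort i) (u∘sort j) → does d ≡ true
      go (yes _) _  = refl
      go (no _)  eq = contradiction desc (ℕₚ.<-asym (proj₂ (proj₂ (stableSort u) (Next⇒< i→j)) eq))

  monomialTerms : ℚ → List (FTerm n)
  monomialTerms c = map (monomialTerm c) (gapSets increases)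

  -- The terms add up to c times the monomial series M of the order pattern of u. When u is its own
  -- rank, w has this pattern exactly if its rank is u.
  ∑-monomialTerms : ∀ c w → (∀ i → rank u i ≡ u i) →
    ∑ (monomialTerms c) (λ t → fcoef t · FCoeff (gaps t) (perm t) w) ≡ ι (_≗?_ ℕ._≟_ u (rank w)) · c
  ∑-monomialTerms c w ranked = begin
    ∑ (monomialTerms c) (λ t → fcoef t · FCoeff (gaps t) (perm t) w)
      ≡⟨ ∑-map (monomialTerm c) (gapSets increases) _ ⟩
    ∑ (gapSets increases) (λ (m , A) → (c · m) · FCoeff A sort w)
      ≡⟨ ∑-cong (gapSets increases) (λ (m , A) → trans (Q.*-assoc c m _)
           (cong (λ t → c · (m · t)) (ι-chain (λ i j → ascent? (A i) (v i) (v j))))) ⟩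
    ∑ (gapSets increases) (λ (m , A) → c · (m · chain (λ i j → ι (ascent? (A i) (v i) (v j)))))
      ≡⟨ sym (·-∑ c (gapSets increases) _) ⟩
    c · ∑ (gapSets increases) (λ (m , A) → m · chain (λ i j → ι (ascent? (A i) (v i) (v j))))
      ≡⟨ trans (cong (c ·_) (∑-gapSets increases v)) (Q.*-comm c _) ⟩
    chain (λ i j → ι (step? (increases i) (v i) (v j))) · c
      ≡⟨ cong (_· c) (sym (ι-chain (λ i j → step? (increases i) (v i) (v j)))) ⟩
    ι steps? · c
      ≡⟨ cong (_· c) (ι-cong steps? (_≗?_ ℕ._≟_ u (rank w))
           (λ steps i → trans (sym (ranked i)) (rank-cong (step⇒sameOrder {w} steps) i))
           (λ u≗rank → sameOrder⇒step (SameOrder-back u≗rank))) ⟩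
    ι (_≗?_ ℕ._≟_ u (rank w)) · c ∎
    where
    v : Word n
    v k = w (sort ⟨$⟩ʳ k)
    steps? : Dec (∀ i j → Next i j → Step (increases i) (v i) (v j))
    steps? = all? λ i → all? λ j → (toℕ j ℕ.≟ suc (toℕ i)) →-dec step? (increases i) (v i) (v j)
    SameOrder-back : (∀ i → u i ≡ rank w i) → SameOrder u w
    SameOrder-back eq =
      (λ i j lt → SameOrder-reflects-< (SameOrder-rank w) i j (subst₂ _<_ (eq i) (eq j) lt)) ,
      (λ i j e → reflect-≡ i j (trans (sym (eq i)) (trans e (eq j))))
      where
      reflect-≡ : ∀ i j → rank w i ≡ rank w j → w i ≡ w j
      reflect-≡ i j e = ℕₚ.≤-antisym (ℕₚ.≮⇒≥ (λ lt → ℕₚ.<⇒≢ (rank-mono-< w lt) (sym e))) (ℕₚ.≮⇒≥ (λ lt → ℕₚ.<⇒≢ (rank-mono-< w lt) e))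

-- An order invariant series takes one value on each pattern, so it is a combination of the series
-- M, one for each word that is its own rank. Other words receive no terms, lest a pattern be
-- counted twice.
F-expansion : ∀ {x : Series n} → OrderInvariant x →
  ∃[ ts ] All ValidFTerm ts × (x ≋ λ w → ∑ ts (λ t → fcoef t · FCoeff (gaps t) (perm t) w))
F-expansion {n} {x} inv = concatMap terms words , Allₚ.concat⁺ (Allₚ.map⁺ (All.universal (λ u → terms-valid u (ranked? u)) words)) , λ w → begin
    x w
      ≡⟨ inv w (rank w) (SameOrder-rank w) ⟩
    x (rank w)
      ≡⟨ sym (∑-funs-δ ℕ._≟_ (downFrom⁺ n) (rank w) (λ i → ∈-downFrom⁺ (rank<n w i)) (λ eq → inv _ _ (≗⇒SameOrder eq))) ⟩
    ∑ words (λ u → ι (_≗?_ ℕ._≟_ u (rank w)) · x u)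
      ≡⟨ ∑-cong words (λ u → sym (∑-terms w u (ranked? u))) ⟩
    ∑ words (λ u → ∑ (terms u) (λ t → fcoef t · FCoeff (gaps t) (perm t) w))
      ≡⟨ sym (∑-concatMap terms words _) ⟩
    ∑ (concatMap terms words) (λ t → fcoef t · FCoeff (gaps t) (perm t) w) ∎
  where
  words : List (Word n)
  words = funs (downFrom n) n
  ranked? : ∀ (u : Word n) → Dec (∀ i → rank u i ≡ u i)
  ranked? u = _≗?_ ℕ._≟_ (rank u) u
  termsIf : ∀ (u : Word n) → Dec (∀ i → rank u i ≡ u i) → List (FTerm n)
  termsIf u (yes _) = monomialTerms u (x u)
  termsIf u (no _)  = []
  terms : Word n → List (FTerm n)
  terms u = termsIf u (ranked? u)
  terms-valid : ∀ u d → All ValidFTerm (termsIf u d)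
  terms-valid u (yes _) = Allₚ.map⁺ (All.map (λ {mA} → monomialTerm-valid u (x u) {mA}) (gapSets-valid (increases u)))
  terms-valid u (no _)  = []
  ∑-terms : ∀ w u d → ∑ (termsIf u d) (λ t → fcoef t · FCoeff (gaps t) (perm t) w) ≡ ι (_≗?_ ℕ._≟_ u (rank w)) · x u
  ∑-terms w u (yes ranked) = ∑-monomialTerms u (x u) w ranked
  ∑-terms w u (no ¬ranked) = sym (trans (cong (_· x u) (ι-false (_≗?_ ℕ._≟_ u (rank w)) (λ u≗rank → ¬ranked (λ i →
    trans (rank-cong (≗⇒SameOrder u≗rank) i) (trans (sym (rank-cong {w = w} (SameOrder-rank w) i)) (sym (u≗rank i)))))))
    (Q.zeroˡ (x u)))

-- The operator ω on the h-basis

∑ᶠ-0 : ∀ {f : Fin n → ℚ} → (∀ i → f i ≡ 0ℚ) → ∑ᶠ f ≡ 0ℚ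
∑ᶠ-0 {zero}  eq = refl
∑ᶠ-0 {suc n} eq = trans (cong₂ _+_ (eq zero) (∑ᶠ-0 (eq ∘ suc))) (Q.+-identityˡ 0ℚ)

∑ᶠ-single : ∀ {f : Fin n → ℚ} i → (∀ j → j ≢ i → f j ≡ 0ℚ) → ∑ᶠ f ≡ f i
∑ᶠ-single {suc n} {f} zero    eq = trans (cong (f zero +_) (∑ᶠ-0 (λ j → eq (suc j) λ ()))) (Q.+-identityʳ _)
∑ᶠ-single {suc n} {f} (suc i) eq = trans (cong₂ _+_ (eq zero λ ()) (∑ᶠ-single i (λ j j≢i → eq (suc j) (j≢i ∘ Finₚ.suc-injective)))) (Q.+-identityˡ _)

∑-∑ᶠ : ∀ (xs : List A) (f : A → Fin n → ℚ) → ∑ xs (λ x → ∑ᶠ (f x)) ≡ ∑ᶠ (λ j → ∑ xs (λ x → f x j))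
∑-∑ᶠ {n = zero}  xs f = ∑-0 xs
∑-∑ᶠ {n = suc n} xs f = trans (∑-+ xs _ _) (cong (∑ xs (λ x → f x zero) +_) (∑-∑ᶠ xs (λ x → f x ∘ suc)))

-- ∏_i (a + ∑_{j>i} R i j). For the indicator R of an equivalence relation, a = 1 gives the product
-- of the factorials of the class sizes, and a = -1 gives, up to the sign (-1)^n, the indicator that
-- all classes are singletons.
pairProduct : ℚ → (Fin n → Fin n → ℚ) → ℚ
pairProduct {zero}  a R = 1ℚ
pairProduct {suc n} a R = (a + ∑ᶠ (λ j → R zero (suc j))) · pairProduct a (λ i j → R (suc i) (suc j))

pairProduct-cong : ∀ a {R S : Fin n → Fin n → ℚ} → (∀ i j → R i j ≡ S i j) → pairProduct a R ≡ pairProduct a S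
pairProduct-cong {zero}  a eq = refl
pairProduct-cong {suc n} a eq = cong₂ (λ s t → (a + s) · t) (∑ᶠ-cong (λ j → eq zero (suc j))) (pairProduct-cong a (λ i j → eq (suc i) (suc j)))

Poly-pairProduct : ∀ n {a : ℕ → ℚ} (R : Fin n → Fin n → ℚ) → Poly 1 a → Poly n (λ i → pairProduct (a i) R)
Poly-pairProduct zero    R h i = refl
Poly-pairProduct (suc n) {a} R h =
  Poly-· {λ i → a i + ∑ᶠ (λ j → R zero (suc j))} 1 n (Poly-+ {a} 1 h (Poly-const 1 _)) (Poly-pairProduct n _ h)

-- Only the first factor involves the first copy. Summing that copy over its N values turns the
-- constant 1 into N and each [d_i = d_j] into 1.
∑-pairProduct : ∀ N n (R : Fin n → Fin n → ℚ) →
  ∑ (funs (downFrom N) n) (λ d → pairProduct 1ℚ (λ i j → R i j · ι (d i ℕ.≟ d j))) ≡ pairProduct (ℕ→ℚ N) R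
∑-pairProduct N zero    R = Q.+-identityʳ 1ℚ
∑-pairProduct N (suc n) R = begin
  ∑ (funs L (suc n)) (λ d → pairProduct 1ℚ (λ i j → R i j · ι (d i ℕ.≟ d j)))
    ≡⟨ ∑-funs-suc L n _ ⟩
  ∑ L (λ x → ∑ (funs L n) (λ d → (1ℚ + ∑ᶠ (λ j → R zero (suc j) · ι (x ℕ.≟ d j))) · rest d))
    ≡⟨ ∑-swap L (funs L n) _ ⟩
  ∑ (funs L n) (λ d → ∑ L (λ x → (1ℚ + ∑ᶠ (λ j → R zero (suc j) · ι (x ℕ.≟ d j))) · rest d))
    ≡⟨ ∑-funs-cong∈ L n (λ d d∈ → trans (sym (∑-· (rest d) L _)) (cong (_· rest d) (head-sum d d∈))) ⟩
  ∑ (funs L n) (λ d → (ℕ→ℚ N + ∑ᶠ (λ j → R zero (suc j))) · rest d)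
    ≡⟨ sym (·-∑ _ (funs L n) rest) ⟩
  (ℕ→ℚ N + ∑ᶠ (λ j → R zero (suc j))) · ∑ (funs L n) rest
    ≡⟨ cong ((ℕ→ℚ N + ∑ᶠ (λ j → R zero (suc j))) ·_) (∑-pairProduct N n (λ i j → R (suc i) (suc j))) ⟩
  pairProduct (ℕ→ℚ N) R ∎
  where
  L : List ℕ
  L = downFrom N
  rest : Word n → ℚ
  rest d = pairProduct 1ℚ (λ i j → R (suc i) (suc j) · ι (d i ℕ.≟ d j))
  ∑-1 : ∀ N → ∑ (downFrom N) (λ _ → 1ℚ) ≡ ℕ→ℚ N
  ∑-1 zero    = refl
  ∑-1 (suc N) = trans (cong (1ℚ +_) (∑-1 N)) (sym (ℕ→ℚ-suc N))
  head-sum : ∀ d → (∀ j → d j ∈ L) → ∑ L (λ x → 1ℚ + ∑ᶠ (λ j → R zero (suc j) · ι (x ℕ.≟ d j))) ≡ ℕ→ℚ N + ∑ᶠ (λ j → R zero (suc j))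
  head-sum d d∈ = begin
    ∑ L (λ x → 1ℚ + ∑ᶠ (λ j → R zero (suc j) · ι (x ℕ.≟ d j)))
      ≡⟨ ∑-+ L _ _ ⟩
    ∑ L (λ _ → 1ℚ) + ∑ L (λ x → ∑ᶠ (λ j → R zero (suc j) · ι (x ℕ.≟ d j)))
      ≡⟨ cong₂ _+_ (∑-1 N) (∑-∑ᶠ L (λ x j → R zero (suc j) · ι (x ℕ.≟ d j))) ⟩
    ℕ→ℚ N + ∑ᶠ (λ j → ∑ L (λ x → R zero (suc j) · ι (x ℕ.≟ d j)))
      ≡⟨ cong (ℕ→ℚ N +_) (∑ᶠ-cong (λ j → trans (∑-cong L (λ x → Q.*-comm _ _)) (∑-δ (ℕ._≟ d j) (downFrom⁺ N) (d∈ j) (λ _ → R zero (suc j))))) ⟩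
    ℕ→ℚ N + ∑ᶠ (λ j → R zero (suc j)) ∎

ℕ→ℚ-+ : ∀ a b → ℕ→ℚ (a ℕ.+ b) ≡ ℕ→ℚ a + ℕ→ℚ b
ℕ→ℚ-+ zero    b = sym (Q.+-identityˡ _)
ℕ→ℚ-+ (suc a) b = trans (ℕ→ℚ-suc (a ℕ.+ b)) (trans (cong (1ℚ +_) (ℕ→ℚ-+ a b)) (trans (sym (Q.+-assoc 1ℚ _ _)) (cong (_+ ℕ→ℚ b) (sym (ℕ→ℚ-suc a)))))

ℕ→ℚ-* : ∀ a b → ℕ→ℚ (a ℕ.* b) ≡ ℕ→ℚ a · ℕ→ℚ b
ℕ→ℚ-* zero    b = sym (Q.zeroˡ _)
ℕ→ℚ-* (suc a) b = begin
  ℕ→ℚ (b ℕ.+ a ℕ.* b)    ≡⟨ trans (ℕ→ℚ-+ b (a ℕ.* b)) (cong (ℕ→ℚ b +_) (ℕ→ℚ-* a b)) ⟩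
  ℕ→ℚ b + ℕ→ℚ a · ℕ→ℚ b  ≡⟨ solve 2 (λ a b → b :+ a :* b := (con 1 :+ a) :* b) refl (ℕ→ℚ a) (ℕ→ℚ b) ⟩
  (1ℚ + ℕ→ℚ a) · ℕ→ℚ b   ≡⟨ cong (_· ℕ→ℚ b) (sym (ℕ→ℚ-suc a)) ⟩
  ℕ→ℚ (suc a) · ℕ→ℚ b    ∎

∏ᴸ : List A → (A → ℚ) → ℚ
∏ᴸ []       f = 1ℚ
∏ᴸ (x ∷ xs) f = f x · ∏ᴸ xs f

ℕ→ℚ-prod : ∀ (f : A → ℕ) xs → ℕ→ℚ (prodℕ (map f xs)) ≡ ∏ᴸ xs (ℕ→ℚ ∘ f)
ℕ→ℚ-prod f []       = refl
ℕ→ℚ-prod f (x ∷ xs) = trans (ℕ→ℚ-* (f x) _) (cong (ℕ→ℚ (f x) ·_) (ℕ→ℚ-prod f xs))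

∏ᴸ-cong : ∀ (xs : List A) {f g : A → ℚ} → (∀ x → f x ≡ g x) → ∏ᴸ xs f ≡ ∏ᴸ xs g
∏ᴸ-cong []       eq = refl
∏ᴸ-cong (x ∷ xs) eq = cong₂ _·_ (eq x) (∏ᴸ-cong xs eq)

∏ᴸ-· : ∀ (xs : List A) f g → ∏ᴸ xs (λ x → f x · g x) ≡ ∏ᴸ xs f · ∏ᴸ xs g
∏ᴸ-· []       f g = sym (Q.*-identityˡ 1ℚ)
∏ᴸ-· (x ∷ xs) f g = trans (cong (f x · g x ·_) (∏ᴸ-· xs f g))
  (solve 4 (λ a b c d → (a :* b) :* (c :* d) := (a :* c) :* (b :* d)) refl (f x) (g x) (∏ᴸ xs f) (∏ᴸ xs g))

∏ᴸ-1 : ∀ {xs : List A} {f : A → ℚ} → (∀ {x} → x ∈ xs → f x ≡ 1ℚ) → ∏ᴸ xs f ≡ 1ℚ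
∏ᴸ-1 {xs = []}     eq = refl
∏ᴸ-1 {xs = x ∷ xs} eq = trans (cong₂ _·_ (eq (here refl)) (∏ᴸ-1 (eq ∘ there))) (Q.*-identityˡ 1ℚ)

∏ᴸ-++ : ∀ (xs ys : List A) f → ∏ᴸ (xs Data.List.++ ys) f ≡ ∏ᴸ xs f · ∏ᴸ ys f
∏ᴸ-++ []       ys f = sym (Q.*-identityˡ _)
∏ᴸ-++ (x ∷ xs) ys f = trans (cong (f x ·_) (∏ᴸ-++ xs ys f)) (sym (Q.*-assoc (f x) _ _))

∏ᴸ-map : ∀ (h : A → B) xs f → ∏ᴸ (map h xs) f ≡ ∏ᴸ xs (f ∘ h)
∏ᴸ-map h []       f = refl
∏ᴸ-map h (x ∷ xs) f = cong (f (h x) ·_) (∏ᴸ-map h xs f)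

∏ᴸ-product : ∀ (xs : List A) (ys : List B) f → ∏ᴸ xs (λ x → ∏ᴸ ys (λ y → f (x , y))) ≡ ∏ᴸ (cartesianProduct xs ys) f
∏ᴸ-product []       ys f = refl
∏ᴸ-product (x ∷ xs) ys f = sym (trans (∏ᴸ-++ (map (x ,_) ys) _ f) (cong₂ _·_ (∏ᴸ-map (x ,_) ys f) (sym (∏ᴸ-product xs ys f))))

∏ᴸ-indicator : ∀ {xs : List A} {P : A → Set} (P? : ∀ x → Dec (P x)) {a} → P a → (∀ x → P x → a ≡ x) → Unique xs → a ∈ xs →
  ∀ (f : A → ℚ) → ∏ᴸ xs (λ x → if does (P? x) then f x else 1ℚ) ≡ f a
∏ᴸ-indicator {xs = x ∷ xs} P? Pa uniq (x∉ ∷ u) (here refl) f = trans (cong₂ _·_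
  (cong (if_then f x else 1ℚ) (dec-true (P? x) Pa))
  (∏ᴸ-1 (λ {y} y∈ → cong (if_then f y else 1ℚ) (dec-false (P? y) (λ Py → All.lookup x∉ y∈ (uniq y Py))))))
  (Q.*-identityʳ (f x))
∏ᴸ-indicator {xs = x ∷ xs} P? {a} Pa uniq (x∉ ∷ u) (there a∈) f = trans (cong₂ _·_
  (cong (if_then f x else 1ℚ) (dec-false (P? x) (λ Px → All.lookup x∉ a∈ (sym (uniq x Px)))))
  (∏ᴸ-indicator P? Pa uniq u a∈ f))
  (Q.*-identityˡ (f a))

filter-tabulate : ∀ {m} {P : A → Set} (P? : ∀ x → Dec (P x)) (f : Fin n → A) (g : Fin m → Fin n) →
  length (filter P? (tabulate (f ∘ g))) ≡ length (filter (P? ∘ f) (tabulate g))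
filter-tabulate {m = zero}  P? f g = refl
filter-tabulate {m = suc m} P? f g with does (P? (f (g zero)))
... | true  = cong suc (filter-tabulate P? f (g ∘ suc))
... | false = filter-tabulate P? f (g ∘ suc)

ℕ→ℚ-countFin : ∀ {P : Fin n → Set} (P? : ∀ i → Dec (P i)) → ℕ→ℚ (countFin P?) ≡ ∑ᶠ (λ i → ι (P? i))
ℕ→ℚ-countFin {zero}  P? = refl
ℕ→ℚ-countFin {suc n} P? with P? zero
... | yes _ = trans (ℕ→ℚ-suc (length (filter P? (tabulate suc))))
  (cong (1ℚ +_) (trans (cong ℕ→ℚ (filter-tabulate P? suc (λ i → i))) (ℕ→ℚ-countFin (P? ∘ suc))))
... | no _  = trans (cong ℕ→ℚ (filter-tabulate P? suc (λ i → i))) (trans (ℕ→ℚ-countFin (P? ∘ suc)) (sym (Q.+-identityˡ _)))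

countFin-!-suc : ∀ {P : Fin (suc n) → Set} (P? : ∀ i → Dec (P i)) →
  ℕ→ℚ (countFin P? !) ≡ (if does (P? zero) then 1ℚ + ∑ᶠ (λ j → ι (P? (suc j))) else 1ℚ) · ℕ→ℚ (countFin (P? ∘ suc) !)
countFin-!-suc {n} P? with P? zero
... | no _  = trans (cong (λ k → ℕ→ℚ (k !)) (filter-tabulate P? suc (λ i → i))) (sym (Q.*-identityˡ _))
... | yes _ = trans (cong (λ k → ℕ→ℚ (suc k !)) (filter-tabulate P? suc (λ i → i)))
  (trans (ℕ→ℚ-* (suc c) (c !)) (cong (_· ℕ→ℚ (c !)) (trans (ℕ→ℚ-suc c) (cong (1ℚ +_) (ℕ→ℚ-countFin (P? ∘ suc))))))
  where c = countFin (P? ∘ suc)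

-- Adding position i to the positions after it multiplies the factorial of its
-- class by the new size of the class.
∏-factorials : ∀ {C : Set} {cs : List C} → Unique cs → ∀ {n} {P : Fin n → C → Set} (P? : ∀ i c → Dec (P i c)) (κ : Fin n → C) →
  (∀ i → P i (κ i)) → (∀ i c → P i c → κ i ≡ c) → (∀ i → κ i ∈ cs) →
  ∏ᴸ cs (λ c → ℕ→ℚ (countFin (λ i → P? i c) !)) ≡ pairProduct 1ℚ (λ i j → ι (P? j (κ i)))
∏-factorials {cs = cs} u {zero} P? κ Pκ uniq κ∈ = ∏ᴸ-1 {xs = cs} (λ _ → refl)
∏-factorials {cs = cs} u {suc n} P? κ Pκ uniq κ∈ = begin
  ∏ᴸ cs (λ c → ℕ→ℚ (countFin (λ i → P? i c) !))
    ≡⟨ ∏ᴸ-cong cs (λ c → countFin-!-suc (λ i → P? i c)) ⟩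
  ∏ᴸ cs (λ c → (if does (P? zero c) then later c else 1ℚ) · ℕ→ℚ (countFin (λ i → P? (suc i) c) !))
    ≡⟨ ∏ᴸ-· cs _ _ ⟩
  ∏ᴸ cs (λ c → if does (P? zero c) then later c else 1ℚ) · ∏ᴸ cs (λ c → ℕ→ℚ (countFin (λ i → P? (suc i) c) !))
    ≡⟨ cong₂ _·_ (∏ᴸ-indicator (P? zero) (Pκ zero) (uniq zero) u (κ∈ zero) later)
         (∏-factorials u (P? ∘ suc) (κ ∘ suc) (Pκ ∘ suc) (uniq ∘ suc) (κ∈ ∘ suc)) ⟩
  pairProduct 1ℚ (λ i j → ι (P? j (κ i))) ∎
  where
  later : _ → ℚ
  later c = 1ℚ + ∑ᶠ (λ j → ι (P? (suc j) c))

sumℕ-bound : ∀ {A : Set} (f : A → ℕ) {x xs} → x ∈ xs → f x ≤ sumℕ (map f xs)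
sumℕ-bound f (here refl) = ℕₚ.m≤m+n _ _
sumℕ-bound f {xs = y ∷ xs} (there x∈) = ℕₚ.≤-trans (sumℕ-bound f x∈) (ℕₚ.m≤n+m _ (f y))

module _ (π : SetPartition n) where

  Alike : Word n → Fin n → Fin n → Set
  Alike w i j = blk π i ≡ blk π j × w i ≡ w j

  alike? : ∀ w i j → Dec (Alike w i j)
  alike? w i j = (blk π i Fin.≟ blk π j) ×-dec (w i ℕ.≟ w j)

  hCoeff-pairProduct : ∀ w → hCoeff π w ≡ pairProduct 1ℚ (λ i j → ι (alike? w i j))
  hCoeff-pairProduct w = begin
    hCoeff π w
      ≡⟨ trans (ℕ→ℚ-prod (λ b → prodℕ (map (count! b) vs)) bs) (∏ᴸ-cong bs (λ b → ℕ→ℚ-prod (count! b) vs)) ⟩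
    ∏ᴸ bs (λ b → ∏ᴸ vs (λ v → ℕ→ℚ (count! b v)))
      ≡⟨ ∏ᴸ-product bs vs _ ⟩
    ∏ᴸ (cartesianProduct bs vs) (λ c → ℕ→ℚ (countFin (λ i → P? i c) !))
      ≡⟨ ∏-factorials (cartesianProduct⁺ (allFin⁺ (ℓ π)) (upTo⁺ _)) P? (λ i → blk π i , w i) (λ _ → refl , refl)
           (λ { i (b , v) (refl , refl) → refl })
           (λ i → ∈-cartesianProduct⁺ (∈-allFin (blk π i)) (∈-upTo⁺ (s≤s (sumℕ-bound w (∈-allFin i))))) ⟩
    pairProduct 1ℚ (λ i j → ι (P? j (blk π i , w i)))
      ≡⟨ pairProduct-cong 1ℚ (λ i j → ι-cong (P? j (blk π i , w i)) (alike? w i j) (λ (p , q) → sym p , sym q) (λ (p , q) → sym p , sym q)) ⟩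
    pairProduct 1ℚ (λ i j → ι (alike? w i j)) ∎
    where
    bs : List (Fin (ℓ π))
    bs = allFin (ℓ π)
    vs : List ℕ
    vs = upTo (suc (sumℕ (map w (allFin n))))
    P? : ∀ i ((b , v) : Fin (ℓ π) × ℕ) → Dec (blk π i ≡ b × w i ≡ v)
    P? i (b , v) = (blk π i Fin.≟ b) ×-dec (w i ℕ.≟ v)
    count! : Fin (ℓ π) → ℕ → ℕ
    count! b v = countFin (λ i → P? i (b , v)) !

unrelated? : ∀ {S : Fin n → Fin n → Set} (S? : ∀ i j → Dec (S i j)) → Dec (∀ i j → i ≢ j → ¬ S i j)
unrelated? S? = all? λ i → all? λ j → ¬? (i Fin.≟ j) →-dec ¬? (S? i j)

-- If the later positions are pairwise unrelated, the head is related to at most one of them.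
pairProduct-neg : ∀ {S : Fin n → Fin n → Set} (S? : ∀ i j → Dec (S i j)) →
  (∀ {i j} → S i j → S j i) → (∀ {i j k} → S i j → S j k → S i k) →
  ∏ {n} (λ _ → - 1ℚ) · pairProduct (- 1ℚ) (λ i j → ι (S? i j)) ≡ ι (unrelated? S?)
pairProduct-neg {zero} S? S-sym S-trans = trans (Q.*-identityˡ 1ℚ) (sym (ι-true (unrelated? S?) (λ ())))
pairProduct-neg {suc n} {S} S? S-sym S-trans = begin
  (- 1ℚ · ∏ {n} (λ _ → - 1ℚ)) · ((- 1ℚ + c) · pairProduct (- 1ℚ) (λ i j → ι (S? (suc i) (suc j))))
    ≡⟨ solve 4 (λ a b c d → (a :* b) :* (c :* d) := (a :* c) :* (b :* d)) refl (- 1ℚ) (∏ {n} (λ _ → - 1ℚ)) _ _ ⟩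
  (- 1ℚ · (- 1ℚ + c)) · (∏ {n} (λ _ → - 1ℚ) · pairProduct (- 1ℚ) (λ i j → ι (S? (suc i) (suc j))))
    ≡⟨ cong₂ _·_ (trans (Q.distribˡ (- 1ℚ) (- 1ℚ) c) (cong₂ _+_ (trans (neg-· (- 1ℚ)) (-‿involutive 1ℚ)) (neg-· c)))
         (pairProduct-neg (λ i j → S? (suc i) (suc j)) S-sym S-trans) ⟩
  (1ℚ + - c) · ι tail?
    ≡⟨ head-factor tail? ⟩
  ι head? · ι tail?
    ≡⟨ sym (ι-× head? tail?) ⟩
  ι (head? ×-dec tail?)
    ≡⟨ ι-cong (head? ×-dec tail?) (unrelated? S?) (λ (h , t) → join h t)
         (λ h → (λ j → h zero (suc j) λ ()) , λ i j i≢j → h (suc i) (suc j) (i≢j ∘ Finₚ.suc-injective)) ⟩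
  ι (unrelated? S?) ∎
  where
  c = ∑ᶠ (λ j → ι (S? zero (suc j)))
  head? : Dec (∀ j → ¬ S zero (suc j))
  head? = all? λ j → ¬? (S? zero (suc j))
  tail? : Dec (∀ i j → i ≢ j → ¬ S (suc i) (suc j))
  tail? = unrelated? (λ i j → S? (suc i) (suc j))
  join : (∀ j → ¬ S zero (suc j)) → (∀ i j → i ≢ j → ¬ S (suc i) (suc j)) → ∀ i j → i ≢ j → ¬ S i j
  join h t zero    zero    i≢j = contradiction refl i≢j
  join h t zero    (suc j) _   = h j
  join h t (suc i) zero    _   = h i ∘ S-sym
  join h t (suc i) (suc j) i≢j = t i j (i≢j ∘ cong suc)
  head-factor : ∀ (d : Dec (∀ i j → i ≢ j → ¬ S (suc i) (suc j))) → (1ℚ + - c) · ι d ≡ ι head? · ι d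
  head-factor (no _)  = trans (Q.zeroʳ _) (sym (Q.zeroʳ _))
  head-factor (yes t) = cong (_· 1ℚ) (go (any? (λ j → S? zero (suc j))))
    where
    go : Dec (∃[ j ] S zero (suc j)) → 1ℚ + - c ≡ ι head?
    go (no ¬related) = begin
      1ℚ + - c  ≡⟨ cong (λ t → 1ℚ + - t) (∑ᶠ-0 (λ j → ι-false (S? zero (suc j)) (λ s → ¬related (j , s)))) ⟩
      1ℚ + - 0ℚ ≡⟨ trans (cong (1ℚ +_) neg-0) (Q.+-identityʳ 1ℚ) ⟩
      1ℚ        ≡⟨ sym (ι-true head? (λ j s → ¬related (j , s))) ⟩
      ι head?   ∎
    go (yes (j , s)) = begin
      1ℚ + - c  ≡⟨ cong (λ t → 1ℚ + - t) (trans (∑ᶠ-single j (λ k k≢j → ι-false (S? zero (suc k)) (λ s′ → t k j k≢j (S-trans (S-sym s′) s)))) (ι-true (S? zero (suc j)) s)) ⟩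
      1ℚ + - 1ℚ ≡⟨ Q.-‿inverseʳ 1ℚ ⟩
      0ℚ        ≡⟨ sym (ι-false head? (λ h → h j s)) ⟩
      ι head?   ∎

module ωSubst = Substitution (λ N → N) (λ _ _ → - 1ℚ)
open ωSubst using () renaming (substitute to ω)

-- Refined positions are alike when they were alike before and received the same copy, so summing
-- over the copies puts N in place of the 1 in every factor. At N = -1 the n weights absorb the
-- sign.
ω-hCoeff : ∀ (π : SetPartition n) → ω (hCoeff π) ≋ eCoeff π
ω-hCoeff {n} π w = trans
  (ωSubst.substitute-Poly {x = hCoeff π} {w} (λ i → s · pairProduct (affine (- 1ℚ) 1ℚ i) R)
    (Poly-scale n s (Poly-pairProduct n R (Poly-affine (- 1ℚ) 1ℚ))) at)
  (trans (cong (λ a → s · pairProduct a R) (affine-0 (- 1ℚ) 1ℚ))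
  (trans (pairProduct-neg {S = Alike π w} (alike? π w) (λ (p , q) → sym p , sym q) (λ (p , q) (p′ , q′) → trans p p′ , trans q q′))
  (ι-cong (unrelated? {S = Alike π w} (alike? π w)) (all? λ j → all? λ k → (¬? (j Fin.≟ k) ×-dec (blk π j Fin.≟ blk π k)) →-dec ¬? (w j ℕ.≟ w k))
    (λ h j k (j≢k , b) e → h j k j≢k (b , e)) (λ h j k j≢k (b , e) → h j k (j≢k , b) e))))
  where
  s : ℚ
  s = ∏ {n} (λ _ → - 1ℚ)
  R : Fin n → Fin n → ℚ
  R i j = ι (alike? π w i j)
  affine-N : ∀ N → affine (- 1ℚ) 1ℚ (suc N) ≡ ℕ→ℚ N
  affine-N N = begin
    affine (- 1ℚ) 1ℚ (suc N)  ≡⟨ affine-suc (- 1ℚ) 1ℚ N ⟩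
    1ℚ + (- 1ℚ + ℕ→ℚ N · 1ℚ)  ≡⟨ sym (Q.+-assoc 1ℚ (- 1ℚ) _) ⟩
    (1ℚ + - 1ℚ) + ℕ→ℚ N · 1ℚ  ≡⟨ cong₂ _+_ (Q.-‿inverseʳ 1ℚ) (Q.*-identityʳ _) ⟩
    0ℚ + ℕ→ℚ N                ≡⟨ Q.+-identityˡ _ ⟩
    ℕ→ℚ N                     ∎
  refined : ∀ N d → (∀ i → d i < N) → hCoeff π (ωSubst.refine N w d) ≡ pairProduct 1ℚ (λ i j → R i j · ι (d i ℕ.≟ d j))
  refined N d d< = trans (hCoeff-pairProduct π (ωSubst.refine N w d)) (pairProduct-cong 1ℚ (λ i j → trans
    (ι-cong (alike? π (ωSubst.refine N w d) i j) (alike? π w i j ×-dec (d i ℕ.≟ d j))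
      (λ (p , q) → let a , b = lex-injective N {w i} {d i} {w j} {d j} (d< i) (d< j) q in (p , a) , b)
      (λ ((p , a) , b) → p , cong₂ (λ a b → a ℕ.* N ℕ.+ b) a b))
    (ι-× (alike? π w i j) (d i ℕ.≟ d j))))
  at : ∀ N → ωSubst.substituteAt N (hCoeff π) w ≡ s · pairProduct (affine (- 1ℚ) 1ℚ (suc N)) R
  at N = begin
    ∑ (funs (downFrom N) n) (λ d → s · hCoeff π (ωSubst.refine N w d))
      ≡⟨ ∑-funs-cong∈ (downFrom N) n (λ d d∈ → cong (s ·_) (refined N d (∈-downFrom⁻ ∘ d∈))) ⟩
    ∑ (funs (downFrom N) n) (λ d → s · pairProduct 1ℚ (λ i j → R i j · ι (d i ℕ.≟ d j)))
      ≡⟨ sym (·-∑ s (funs (downFrom N) n) _) ⟩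
    s · ∑ (funs (downFrom N) n) (λ d → pairProduct 1ℚ (λ i j → R i j · ι (d i ℕ.≟ d j)))
      ≡⟨ cong (s ·_) (trans (∑-pairProduct N n R) (cong (λ a → pairProduct a R) (sym (affine-N N)))) ⟩
    s · pairProduct (affine (- 1ℚ) 1ℚ (suc N)) R ∎

-- Changes of basis in NCSym

comboOf : (SetPartition n → Series n) → List (PTerm n) → Series n
comboOf b ts w = ∑ ts (λ t → coef t · b (part t) w)

Span : (SetPartition n → Series n) → Series n → Set
Span b x = ∃[ ts ] x ≋ comboOf b ts

module _ {b : SetPartition n → Series n} where

  Span-cong : ∀ {x y} → x ≋ y → Span b x → Span b y
  Span-cong x≋y (ts , h) = ts , λ w → trans (sym (x≋y w)) (h w)

  Span-basis : ∀ π → Span b (b π)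
  Span-basis π = record { coef = 1ℚ ; part = π } ∷ [] , λ w → sym (trans (Q.+-identityʳ _) (Q.*-identityˡ _))

  Span-0 : Span b (λ _ → 0ℚ)
  Span-0 = [] , λ _ → refl

  Span-+ : ∀ {x y} → Span b x → Span b y → Span b (λ w → x w + y w)
  Span-+ (ts , h) (us , g) = ts ++ us , λ w → trans (cong₂ _+_ (h w) (g w)) (sym (∑-++ ts us _))

  Span-· : ∀ {x} c → Span b x → Span b (λ w → c · x w)
  Span-· {x} c (ts , h) = map scale ts , λ w → begin
    c · x w                                     ≡⟨ cong (c ·_) (h w) ⟩
    c · comboOf b ts w                          ≡⟨ ·-∑ c ts _ ⟩
    ∑ ts (λ t → c · (coef t · b (part t) w))    ≡⟨ ∑-cong ts (λ t → sym (Q.*-assoc c (coef t) _)) ⟩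
    ∑ ts (λ t → (c · coef t) · b (part t) w)    ≡⟨ sym (∑-map scale ts _) ⟩
    comboOf b (map scale ts) w                  ∎
    where
    scale : PTerm n → PTerm n
    scale t = record { coef = c · coef t ; part = part t }

  Span-∑ : ∀ (xs : List A) {f : A → Series n} → (∀ x → Span b (f x)) → Span b (λ w → ∑ xs (λ x → f x w))
  Span-∑ []       h = Span-0
  Span-∑ (x ∷ xs) h = Span-+ (h x) (Span-∑ xs h)

Span-⊆ : ∀ {b b′ : SetPartition n → Series n} → (∀ π → Span b′ (b π)) → ∀ {x} → Span b x → Span b′ x
Span-⊆ h (ts , eq) = Span-cong (λ w → sym (eq w)) (Span-∑ ts (λ t → Span-· (coef t) (h (part t))))

record Kernel (u : Word n) : Set where
  field
    partition : SetPartition n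
    blk⇒≡ : ∀ i j → blk partition i ≡ blk partition j → u i ≡ u j
    ≡⇒blk : ∀ i j → u i ≡ u j → blk partition i ≡ blk partition j

open Kernel

kernel : ∀ (u : Word n) → Kernel u
kernel {zero} u = record { partition = record { ℓ = 0 ; blk = λ () ; surj = λ () } ; blk⇒≡ = λ () ; ≡⇒blk = λ () }
kernel {suc n} u with kernel (u ∘ suc) | any? (λ j → u (suc j) ℕ.≟ u zero)
... | record { partition = π ; blk⇒≡ = f ; ≡⇒blk = g } | yes (j , uj≡u0) = record
  { partition = record
    { ℓ = ℓ π
    ; blk = λ { zero → blk π j ; (suc i) → blk π i }
    ; surj = λ b → suc (proj₁ (surj π b)) , proj₂ (surj π b) }
  ; blk⇒≡ = λ { zero zero _ → refl ; zero (suc i) e → trans (sym uj≡u0) (f j i e)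
              ; (suc i) zero e → trans (f i j e) uj≡u0 ; (suc i) (suc k) e → f i k e }
  ; ≡⇒blk = λ { zero zero _ → refl ; zero (suc i) e → g j i (trans uj≡u0 e)
              ; (suc i) zero e → g i j (trans e (sym uj≡u0)) ; (suc i) (suc k) e → g i k e } }
... | record { partition = π ; blk⇒≡ = f ; ≡⇒blk = g } | no ¬old = record
  { partition = record
    { ℓ = suc (ℓ π)
    ; blk = λ { zero → zero ; (suc i) → suc (blk π i) }
    ; surj = λ { zero → zero , refl ; (suc b) → suc (proj₁ (surj π b)) , cong suc (proj₂ (surj π b)) } }
  ; blk⇒≡ = λ { zero zero _ → refl ; zero (suc i) () ; (suc i) zero () ; (suc i) (suc k) e → f i k (Finₚ.suc-injective e) }
  ; ≡⇒blk = λ { zero zero _ → refl ; zero (suc i) e → contradiction (i , sym e) ¬old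
              ; (suc i) zero e → contradiction (i , e) ¬old ; (suc i) (suc k) e → cong suc (g i k e) } }

-- p of the partition into level sets of u. Words are easier to merge and extend than partitions,
-- whose block maps must stay surjective; `kernel` translates back.
pWord : Word n → Series n
pWord u w = ι (all? λ j → all? λ k → (u j ℕ.≟ u k) →-dec (w j ℕ.≟ w k))

pWord? : ∀ (u w : Word n) → Dec (∀ j k → u j ≡ u k → w j ≡ w k)
pWord? u w = all? λ j → all? λ k → (u j ℕ.≟ u k) →-dec (w j ℕ.≟ w k)

pWord-cong : ∀ {u v : Word n} → (∀ j k → u j ≡ u k → v j ≡ v k) → (∀ j k → v j ≡ v k → u j ≡ u k) → pWord u ≋ pWord v
pWord-cong {u = u} {v} f g w = ι-cong (pWord? u w) (pWord? v w) (λ h j k e → h j k (g j k e)) (λ h j k e → h j k (f j k e))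

pCoeff-kernel : ∀ (u : Word n) → pCoeff (partition (kernel u)) ≋ pWord u
pCoeff-kernel u w = ι-cong (constant? (partition (kernel u)) w) (pWord? u w)
  (λ h j k e → h j k (≡⇒blk (kernel u) j k e)) (λ h j k e → h j k (blk⇒≡ (kernel u) j k e))

labels : SetPartition n → Word n
labels π i = toℕ (blk π i)

pCoeff-labels : ∀ (π : SetPartition n) → pCoeff π ≋ pWord (labels π)
pCoeff-labels π w = ι-cong (constant? π w) (pWord? (labels π) w)
  (λ h j k e → h j k (Finₚ.toℕ-injective e)) (λ h j k e → h j k (cong toℕ e))

pWord∈Span : ∀ (u : Word n) → Span pCoeff (pWord u)
pWord∈Span u = Span-cong (pCoeff-kernel u) (Span-basis (partition (kernel u)))

merge : Fin n → Fin n → Word n → Word n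
merge j k u i = if does (u i ℕ.≟ u k) then u j else u i

-- Imposing w_j = w_k joins the blocks of j and k, so the span of the p's is closed under
-- multiplication by such indicators.
pWord-merge : ∀ (u : Word n) j k w → pWord u w · ι (w j ℕ.≟ w k) ≡ pWord (merge j k u) w
pWord-merge u j k w = trans (sym (ι-× (pWord? u w) (w j ℕ.≟ w k)))
  (ι-cong (pWord? u w ×-dec (w j ℕ.≟ w k)) (pWord? (merge j k u) w) to from)
  where
  merge-k : ∀ i → u i ≡ u k → merge j k u i ≡ u j
  merge-k i e = cong (if_then u j else u i) (dec-true (u i ℕ.≟ u k) e)
  merge-other : ∀ i → u i ≢ u k → merge j k u i ≡ u i
  merge-other i u≢ = cong (if_then u j else u i) (dec-false (u i ℕ.≟ u k) u≢)
  to : (∀ a b → u a ≡ u b → w a ≡ w b) × w j ≡ w k → ∀ a b → merge j k u a ≡ merge j k u b → w a ≡ w b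
  to (h , wj≡wk) a b e = go (u a ℕ.≟ u k) (u b ℕ.≟ u k)
    where
    go : Dec (u a ≡ u k) → Dec (u b ≡ u k) → w a ≡ w b
    go (yes p) (yes q) = h a b (trans p (sym q))
    go (yes p) (no ¬q) = trans (h a k p) (trans (sym wj≡wk) (h j b (trans (sym (merge-k a p)) (trans e (merge-other b ¬q)))))
    go (no ¬p) (yes q) = trans (h a j (trans (sym (merge-other a ¬p)) (trans e (merge-k b q)))) (trans wj≡wk (h k b (sym q)))
    go (no ¬p) (no ¬q) = h a b (trans (sym (merge-other a ¬p)) (trans e (merge-other b ¬q)))
  from : (∀ a b → merge j k u a ≡ merge j k u b → w a ≡ w b) → (∀ a b → u a ≡ u b → w a ≡ w b) × w j ≡ w k
  from h = (λ a b e → h a b (cong (λ t → if does (t ℕ.≟ u k) then u j else t) e)) , h j k (trans merge-j (sym (merge-k k refl)))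
    where
    merge-j : merge j k u j ≡ u j
    merge-j with does (u j ℕ.≟ u k)
    ... | true  = refl
    ... | false = refl

Span-p-· : ∀ {x : Series n} j k → Span pCoeff x → Span pCoeff (λ w → x w · ι (w j ℕ.≟ w k))
Span-p-· j k (ts , h) = Span-cong
  (λ w → sym (trans (cong (_· ι (w j ℕ.≟ w k)) (h w)) (trans (∑-· _ ts _) (∑-cong ts (λ t → trans (Q.*-assoc (coef t) _ _)
    (cong (coef t ·_) (trans (cong (_· ι (w j ℕ.≟ w k)) (pCoeff-labels (part t) w)) (pWord-merge (labels (part t)) j k w))))))))
  (Span-∑ ts (λ t → Span-· (coef t) (pWord∈Span (merge j k (labels (part t))))))

Span-p-∏ : ∀ {m} {f : Fin m → Series n} → (∀ i {x} → Span pCoeff x → Span pCoeff (λ w → x w · f i w)) →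
  ∀ {x} → Span pCoeff x → Span pCoeff (λ w → x w · ∏ (λ i → f i w))
Span-p-∏ {m = zero}  h {x} hx = Span-cong (λ w → sym (Q.*-identityʳ (x w))) hx
Span-p-∏ {m = suc m} {f} h {x} hx = Span-cong (λ w → Q.*-assoc (x w) (f zero w) _) (Span-p-∏ (h ∘ suc) (h zero hx))

-- m_π is the product over all pairs of positions of [w_j = w_k] or 1 − [w_j = w_k].
mCoeff∈Span : ∀ (π : SetPartition n) → Span pCoeff (mCoeff π)
mCoeff∈Span {n} π = Span-cong
  -- The product starts from the constant 1, which is p of the partition into singletons, given by
  -- the injective word `toℕ`.
  (λ w → trans (cong₂ _·_ (ι-true (pWord? toℕ w) (λ j k e → cong w (Finₚ.toℕ-injective e)))
      (trans (∏-cong (λ j → sym (ι-all (λ k → same? j k w)))) (sym (ι-all (λ j → all? (λ k → same? j k w))))))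
    (Q.*-identityˡ (mCoeff π w)))
  (Span-p-∏ (λ j → Span-p-∏ (λ k → factor j k)) (pWord∈Span toℕ))
  where
  same? : ∀ j k (w : Word n) → Dec ((blk π j ≡ blk π k → w j ≡ w k) × (w j ≡ w k → blk π j ≡ blk π k))
  same? j k w = ((blk π j Fin.≟ blk π k) →-dec (w j ℕ.≟ w k)) ×-dec ((w j ℕ.≟ w k) →-dec (blk π j Fin.≟ blk π k))
  factor : ∀ j k {x} → Span pCoeff x → Span pCoeff (λ w → x w · ι (same? j k w))
  factor j k {x} hx = go (blk π j Fin.≟ blk π k)
    where
    go : Dec (blk π j ≡ blk π k) → Span pCoeff (λ w → x w · ι (same? j k w))
    go (yes b) = Span-cong (λ w → cong (x w ·_) (ι-cong (w j ℕ.≟ w k) (same? j k w) (λ e → (λ _ → e) , (λ _ → b)) (λ (f , _) → f b)))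
      (Span-p-· j k hx)
    go (no ¬b) = Span-cong (λ w → trans (complement (x w) (ι (w j ℕ.≟ w k))) (cong (x w ·_) (negate w)))
      (Span-+ hx (Span-· (- 1ℚ) (Span-p-· j k hx)))
      where
      complement : ∀ a b → a + - 1ℚ · (a · b) ≡ a · (1ℚ + - 1ℚ · b)
      complement a b = solve 3 (λ a b m → a :+ m :* (a :* b) := a :* (con 1 :+ m :* b)) refl a b (- 1ℚ)
      negate : ∀ w → 1ℚ + - 1ℚ · ι (w j ℕ.≟ w k) ≡ ι (same? j k w)
      negate w = go′ (w j ℕ.≟ w k)
        where
        go′ : (d : Dec (w j ≡ w k)) → 1ℚ + - 1ℚ · ι d ≡ ι (same? j k w)
        go′ (yes e) = trans (trans (cong (1ℚ +_) (neg-· 1ℚ)) (Q.-‿inverseʳ 1ℚ)) (sym (ι-false (same? j k w) (λ (_ , g) → ¬b (g e))))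
        go′ (no ¬e) = trans (trans (cong (1ℚ +_) (Q.zeroʳ (- 1ℚ))) (Q.+-identityʳ 1ℚ)) (sym (ι-true (same? j k w) ((λ b → contradiction b ¬b) , λ e → contradiction e ¬e)))

∑-filter : ∀ {P : A → Set} (P? : ∀ x → Dec (P x)) xs f → ∑ (filter P? xs) f ≡ ∑ xs (λ x → ι (P? x) · f x)
∑-filter P? []       f = refl
∑-filter P? (x ∷ xs) f with P? x
... | yes _ = cong₂ _+_ (sym (Q.*-identityˡ (f x))) (∑-filter P? xs f)
... | no _  = trans (∑-filter P? xs f) (sym (trans (cong (_+ ∑ xs (λ x → ι (P? x) · f x)) (Q.zeroˡ (f x))) (Q.+-identityˡ _)))

∑-tabulate : ∀ (g : Fin n → A) f → ∑ (tabulate g) f ≡ ∑ᶠ (f ∘ g)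
∑-tabulate {zero}  g f = refl
∑-tabulate {suc n} g f = cong (f (g zero) +_) (∑-tabulate (g ∘ suc) f)

-- Expansion of h into p's and its inversion

Refines Coarsens : (Fin n → C) → Word n → Set
Refines  κ u = ∀ i j → u i ≡ u j → κ i ≡ κ j
Coarsens κ u = ∀ i j → κ i ≡ κ j → u i ≡ u j

module _ (_≟_ : DecidableEquality C) where

  attachments : (Fin (suc n) → C) → Word n → List (Word (suc n))
  attachments κ u = (0 F.∷ (suc ∘ u)) ∷ map (λ j → u j F.∷ u) (filter (λ j → κ zero ≟ κ (suc j)) (allFin _))

  -- Expanding ∏_i (1 + ∑_{j > i, κ j = κ i} [w_i = w_j]): every position is attached to a
  -- later one of its class or to none, and u labels the components of the resulting forest.
  forests : (Fin n → C) → List (Word n)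
  forests {zero}  κ = F.[] ∷ []
  forests {suc n} κ = concatMap (attachments κ) (forests (κ ∘ suc))

  pWord-fresh : ∀ (u : Word n) w → pWord (0 F.∷ (suc ∘ u)) w ≡ pWord u (w ∘ suc)
  pWord-fresh u w = ι-cong (pWord? (0 F.∷ (suc ∘ u)) w) (pWord? u (w ∘ suc))
    (λ h j k e → h (suc j) (suc k) (cong suc e))
    (λ { h zero zero _ → refl ; h zero (suc k) () ; h (suc j) zero () ; h (suc j) (suc k) e → h j k (ℕₚ.suc-injective e) })

  pWord-attach : ∀ (u : Word n) j w → pWord (u j F.∷ u) w ≡ ι (w zero ℕ.≟ w (suc j)) · pWord u (w ∘ suc)
  pWord-attach u j w = trans
    (ι-cong (pWord? (u j F.∷ u) w) ((w zero ℕ.≟ w (suc j)) ×-dec pWord? u (w ∘ suc))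
      (λ h → h zero (suc j) refl , λ i k e → h (suc i) (suc k) e)
      (λ { (p , h) zero zero _ → refl ; (p , h) zero (suc k) e → trans p (h j k e)
         ; (p , h) (suc i) zero e → trans (h i j e) (sym p) ; (p , h) (suc i) (suc k) e → h i k e }))
    (ι-× (w zero ℕ.≟ w (suc j)) (pWord? u (w ∘ suc)))

  ∑-forests : ∀ (κ : Fin n → C) w → ∑ (forests κ) (λ u → pWord u w) ≡ pairProduct 1ℚ (λ i j → ι ((κ i ≟ κ j) ×-dec (w i ℕ.≟ w j)))
  ∑-forests {zero}  κ w = trans (Q.+-identityʳ _) (ι-true (pWord? F.[] w) (λ ()))
  ∑-forests {suc n} κ w = begin
    ∑ (forests κ) (λ u → pWord u w)
      ≡⟨ ∑-concatMap (attachments κ) (forests (κ ∘ suc)) _ ⟩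
    ∑ (forests (κ ∘ suc)) (λ u → ∑ (attachments κ u) (λ v → pWord v w))
      ≡⟨ ∑-cong (forests (κ ∘ suc)) head-factor ⟩
    ∑ (forests (κ ∘ suc)) (λ u → (1ℚ + c) · pWord u (w ∘ suc))
      ≡⟨ sym (·-∑ (1ℚ + c) (forests (κ ∘ suc)) _) ⟩
    (1ℚ + c) · ∑ (forests (κ ∘ suc)) (λ u → pWord u (w ∘ suc))
      ≡⟨ cong ((1ℚ + c) ·_) (∑-forests (κ ∘ suc) (w ∘ suc)) ⟩
    pairProduct 1ℚ (λ i j → ι ((κ i ≟ κ j) ×-dec (w i ℕ.≟ w j))) ∎
    where
    c = ∑ᶠ (λ j → ι ((κ zero ≟ κ (suc j)) ×-dec (w zero ℕ.≟ w (suc j))))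
    head-factor : ∀ u → ∑ (attachments κ u) (λ v → pWord v w) ≡ (1ℚ + c) · pWord u (w ∘ suc)
    head-factor u = begin
      pWord (0 F.∷ (suc ∘ u)) w + ∑ (map (λ j → u j F.∷ u) (filter (λ j → κ zero ≟ κ (suc j)) (allFin n))) (λ v → pWord v w)
        ≡⟨ cong₂ _+_ (trans (pWord-fresh u w) (sym (Q.*-identityˡ pᵤ)))
             (trans (∑-map (λ j → u j F.∷ u) (filter (λ j → κ zero ≟ κ (suc j)) (allFin n)) _) (∑-filter (λ j → κ zero ≟ κ (suc j)) (allFin n) _)) ⟩
      1ℚ · pᵤ + ∑ (allFin n) (λ j → ι (κ zero ≟ κ (suc j)) · pWord (u j F.∷ u) w)
        ≡⟨ cong (1ℚ · pᵤ +_) (trans (∑-cong (allFin n) (λ j → trans (cong (ι (κ zero ≟ κ (suc j)) ·_) (pWord-attach u j w))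
             (trans (sym (Q.*-assoc _ _ pᵤ)) (cong (_· pᵤ) (sym (ι-× (κ zero ≟ κ (suc j)) (w zero ℕ.≟ w (suc j))))))))
             (sym (∑-· pᵤ (allFin n) _))) ⟩
      1ℚ · pᵤ + ∑ (allFin n) (λ j → ι ((κ zero ≟ κ (suc j)) ×-dec (w zero ℕ.≟ w (suc j)))) · pᵤ
        ≡⟨ cong (λ t → 1ℚ · pᵤ + t · pᵤ) (∑-tabulate (λ j → j) (λ j → ι ((κ zero ≟ κ (suc j)) ×-dec (w zero ℕ.≟ w (suc j))))) ⟩
      1ℚ · pᵤ + c · pᵤ
        ≡⟨ sym (Q.distribʳ pᵤ 1ℚ c) ⟩
      (1ℚ + c) · pᵤ ∎
      where pᵤ = pWord u (w ∘ suc)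

  forests-refine : ∀ (κ : Fin n → C) → All (Refines κ) (forests κ)
  forests-refine {zero}  κ = (λ ()) ∷ []
  forests-refine {suc n} κ = Allₚ.concat⁺ (Allₚ.map⁺ (All.map attach (forests-refine (κ ∘ suc))))
    where
    attach : ∀ {u} → Refines (κ ∘ suc) u → All (Refines κ) (attachments κ u)
    attach {u} h =
      (λ { zero zero _ → refl ; zero (suc k) () ; (suc j) zero () ; (suc j) (suc k) e → h j k (ℕₚ.suc-injective e) }) ∷
      Allₚ.map⁺ (All.map
        (λ { {j} κ0≡κj zero zero _ → refl ; {j} κ0≡κj zero (suc k) e → trans κ0≡κj (h j k e)
           ; {j} κ0≡κj (suc i) zero e → trans (h i j e) (sym κ0≡κj) ; κ0≡κj (suc i) (suc k) e → h i k e })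
        (Allₚ.all-filter (λ j → κ zero ≟ κ (suc j)) (allFin n)))

  -- Attaching every position that has a later one in its class makes the components equal to the
  -- classes. Hence p_π itself occurs in the expansion of h_π.
  forests-coarsen : ∀ (κ : Fin n → C) → Any (Coarsens κ) (forests κ)
  forests-coarsen {zero}  κ = here (λ ())
  forests-coarsen {suc n} κ
    with u , u∈ , h ← find (forests-coarsen (κ ∘ suc))
    with any? (λ j → κ zero ≟ κ (suc j))
  ... | yes (j , κ0≡κj) = lose
    (∈-concatMap⁺ (attachments κ) (lose u∈ (there (∈-map⁺ (λ j → u j F.∷ u) (∈-filter⁺ (λ j → κ zero ≟ κ (suc j)) (∈-allFin j) κ0≡κj)))))
    (λ { zero zero _ → refl ; zero (suc k) e → h j k (trans (sym κ0≡κj) e)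
       ; (suc i) zero e → h i j (trans e κ0≡κj) ; (suc i) (suc k) e → h i k e })
  ... | no ¬attached = lose
    (∈-concatMap⁺ (attachments κ) (lose u∈ (here refl)))
    (λ { zero zero _ → refl ; zero (suc k) e → contradiction (k , e) ¬attached
       ; (suc i) zero e → contradiction (i , sym e) ¬attached ; (suc i) (suc k) e → cong suc (h i k e) })

positionPairs : ∀ n → List (Fin n × Fin n)
positionPairs n = cartesianProduct (allFin n) (allFin n)

-- The measure of the induction: a strict refinement separates at least one pair of positions.
pairCount : Word n → ℕ
pairCount {n} u = length (filter (λ (i , j) → u i ℕ.≟ u j) (positionPairs n))

refines-trichotomy : ∀ (u v : Word n) → Refines u v → Coarsens u v ⊎ pairCount v < pairCount u
refines-trichotomy {n} u v ref with any? (λ i → any? (λ j → (u i ℕ.≟ u j) ×-dec ¬? (v i ℕ.≟ v j)))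
... | yes (i , j , ui≡uj , vi≢vj) = inj₂ (count-< (λ (i , j) → v i ℕ.≟ v j) (λ (i , j) → u i ℕ.≟ u j) (λ (i , j) → ref i j)
  (positionPairs n) (∈-cartesianProduct⁺ (∈-allFin i) (∈-allFin j)) vi≢vj ui≡uj)
... | no ¬split = inj₁ (λ i j e → decidable-stable (v i ℕ.≟ v j) (λ vi≢vj → ¬split (i , j , e , vi≢vj)))

Span-cancel : ∀ {b : SetPartition n → Series n} {x y r : Series n} c → Span b y → Span b r →
  (∀ w → y w ≡ ℕ→ℚ (suc c) · x w + r w) → Span b x
Span-cancel {x = x} {y} {r} c y∈ r∈ eq = Span-cong go (Span-· c⁻¹ (Span-+ y∈ (Span-· (- 1ℚ) r∈)))
  where
  c⁻¹ : ℚ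
  c⁻¹ = proj₁ (ℕ→ℚ-invertible c)
  go : ∀ w → c⁻¹ · (y w + - 1ℚ · r w) ≡ x w
  go w = begin
    c⁻¹ · (y w + - 1ℚ · r w)
      ≡⟨ cong₂ (λ a b → c⁻¹ · (a + b)) (eq w) (neg-· (r w)) ⟩
    c⁻¹ · ((ℕ→ℚ (suc c) · x w + r w) + - r w)
      ≡⟨ cong (c⁻¹ ·_) (trans (Q.+-assoc _ (r w) _) (trans (cong (ℕ→ℚ (suc c) · x w +_) (Q.-‿inverseʳ (r w))) (Q.+-identityʳ _))) ⟩
    c⁻¹ · (ℕ→ℚ (suc c) · x w)
      ≡⟨ trans (sym (Q.*-assoc c⁻¹ _ _)) (trans (cong (_· x w) (proj₂ (ℕ→ℚ-invertible c))) (Q.*-identityˡ _)) ⟩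
    x w ∎

-- Words with the level sets of u are counted by `count`; strictly finer ones go to `rest`, where
-- the induction hypothesis applies. Positivity is conditional because the witness may lie further
-- down the list.
record LeadingTerm (u : Word n) (vs : List (Word n)) : Set where
  field
    count    : ℕ
    rest     : Series n
    rest∈    : Span hCoeff rest
    equation : ∀ w → ∑ vs (λ v → pWord v w) ≡ ℕ→ℚ count · pWord u w + rest w
    positive : Any (Coarsens u) vs → ∃[ c ] count ≡ suc c

open LeadingTerm

leadingTerm : ∀ (u : Word n) → (∀ v → pairCount v < pairCount u → Span hCoeff (pWord v)) →
  ∀ vs → All (Refines u) vs → LeadingTerm u vs
leadingTerm u IH [] [] = record
  { count = 0 ; rest = λ _ → 0ℚ ; rest∈ = Span-0
  ; equation = λ w → sym (trans (Q.+-identityʳ _) (Q.zeroˡ _)) ; positive = λ () }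
leadingTerm {n} u IH (v ∷ vs) (ref ∷ refs) = extend (refines-trichotomy u v ref)
  where
  t : LeadingTerm u vs
  t = leadingTerm u IH vs refs
  not-coarse : pairCount v < pairCount u → ¬ Coarsens u v
  not-coarse finer coarse = ℕₚ.<⇒≱ finer (count-≤ (λ (i , j) → u i ℕ.≟ u j) (λ (i , j) → v i ℕ.≟ v j) (λ (i , j) → coarse i j) (positionPairs n))
  extend : Coarsens u v ⊎ pairCount v < pairCount u → LeadingTerm u (v ∷ vs)
  extend (inj₁ coarse) = record
    { count = suc (count t) ; rest = rest t ; rest∈ = rest∈ t
    ; equation = λ w → begin
        pWord v w + ∑ vs (λ v → pWord v w)
          ≡⟨ cong₂ _+_ (pWord-cong {u = v} {u} ref coarse w) (equation t w) ⟩
        pWord u w + (ℕ→ℚ (count t) · pWord u w + rest t w)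
          ≡⟨ solve 3 (λ p c r → p :+ (c :* p :+ r) := (con 1 :+ c) :* p :+ r) refl (pWord u w) (ℕ→ℚ (count t)) (rest t w) ⟩
        (1ℚ + ℕ→ℚ (count t)) · pWord u w + rest t w
          ≡⟨ cong (λ s → s · pWord u w + rest t w) (sym (ℕ→ℚ-suc (count t))) ⟩
        ℕ→ℚ (suc (count t)) · pWord u w + rest t w ∎
    ; positive = λ _ → count t , refl }
  extend (inj₂ finer) = record
    { count = count t ; rest = λ w → pWord v w + rest t w ; rest∈ = Span-+ (IH v finer) (rest∈ t)
    ; equation = λ w → trans (cong (pWord v w +_) (equation t w))
        (solve 3 (λ a b r → a :+ (b :+ r) := b :+ (a :+ r)) refl (pWord v w) (ℕ→ℚ (count t) · pWord u w) (rest t w))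
    ; positive = λ { (here coarse) → contradiction coarse (not-coarse finer) ; (there any) → positive t any } }

-- h_π is a positive multiple of p_π plus p's of strictly finer partitions.
pWord∈Span-h : ∀ (u : Word n) → Acc _<_ (pairCount u) → Span hCoeff (pWord u)
pWord∈Span-h {n} u (acc rec) = Span-cancel (proj₁ count≡) (Span-basis π) (rest∈ t) (λ w → begin
    hCoeff π w
      ≡⟨ hCoeff-pairProduct π w ⟩
    pairProduct 1ℚ (λ i j → ι (alike? π w i j))
      ≡⟨ sym (∑-forests Fin._≟_ (blk π) w) ⟩
    ∑ (forests Fin._≟_ (blk π)) (λ v → pWord v w)
      ≡⟨ equation t w ⟩
    ℕ→ℚ (count t) · pWord u w + rest t w
      ≡⟨ cong (λ c → ℕ→ℚ c · pWord u w + rest t w) (proj₂ count≡) ⟩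
    ℕ→ℚ (suc (proj₁ count≡)) · pWord u w + rest t w ∎)
  where
  π : SetPartition n
  π = partition (kernel u)
  t : LeadingTerm u (forests Fin._≟_ (blk π))
  t = leadingTerm u (λ v finer → pWord∈Span-h v (rec finer)) (forests Fin._≟_ (blk π))
    (All.map (λ h i j e → blk⇒≡ (kernel u) i j (h i j e)) (forests-refine Fin._≟_ (blk π)))
  count≡ : ∃[ c ] count t ≡ suc c
  count≡ = positive t (Any.map (λ h i j e → h i j (≡⇒blk (kernel u) i j e)) (forests-coarsen Fin._≟_ (blk π)))

pCoeff∈Span-h : ∀ (π : SetPartition n) → Span hCoeff (pCoeff π)
pCoeff∈Span-h π = Span-cong (λ w → sym (pCoeff-labels π w)) (pWord∈Span-h (labels π) (<-wellFounded _))

-- ThetaOf and OmegaOf with the sealed operations.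
IsΘ Isω : Series n → Series n → Set
IsΘ x y =
  (∃[ ts ] All ValidFTerm ts × (x ≋ λ w → ∑ ts (λ t → fcoef t · FCoeff (gaps t) (perm t) w))) ×
  (∀ ts → All ValidFTerm ts × (x ≋ λ w → ∑ ts (λ t → fcoef t · FCoeff (gaps t) (perm t) w)) →
    (λ w → ∑ ts (λ t → fcoef t · KCoeff (pkPerm t) (perm t) w)) ≋ y)
Isω x y = Span hCoeff x × (∀ ts → x ≋ comboOf hCoeff ts → comboOf eCoeff ts ≋ y)

Θ-isΘ : ∀ {x y : Series n} → OrderInvariant x → Θ x ≋ y → IsΘ x y
Θ-isΘ {x = x} {y} inv Θx≋y = F-expansion inv , λ ts (valid , x≋) w → begin
  ∑ ts (λ t → fcoef t · KCoeff (pkPerm t) (perm t) w)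
    ≡⟨ ∑-cong∈ ts (λ {t} t∈ → cong (fcoef t ·_) (sym (Θ-FCoeff (gaps t) (perm t) (pkPerm t) (proj₂ (proj₂ (All.lookup valid t∈))) w))) ⟩
  ∑ ts (λ t → fcoef t · Θ (FCoeff (gaps t) (perm t)) w)
    ≡⟨ sym (ΘSubst.substitute-∑ ts fcoef (λ t → FCoeff (gaps t) (perm t)) w) ⟩
  Θ (λ w → ∑ ts (λ t → fcoef t · FCoeff (gaps t) (perm t) w)) w
    ≡⟨ sym (ΘSubst.substitute-cong x≋ w) ⟩
  Θ x w
    ≡⟨ Θx≋y w ⟩
  y w ∎

ω-isω : ∀ {x y : Series n} → Span hCoeff x → ω x ≋ y → Isω x y
ω-isω {x = x} {y} x∈ ωx≋y = x∈ , λ ts x≋ w → begin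
  comboOf eCoeff ts w                          ≡⟨ ∑-cong ts (λ t → cong (coef t ·_) (sym (ω-hCoeff (part t) w))) ⟩
  ∑ ts (λ t → coef t · ω (hCoeff (part t)) w)  ≡⟨ sym (ωSubst.substitute-∑ ts coef (λ t → hCoeff (part t)) w) ⟩
  ω (comboOf hCoeff ts) w                      ≡⟨ sym (ωSubst.substitute-cong x≋ w) ⟩
  ω x w                                        ≡⟨ ωx≋y w ⟩
  y w                                          ∎

-- Eigenvalues on the p-basis and commutation

sgn : ℕ → ℚ
sgn e = (- 1ℚ) ^ℚ e

∑-const : ∀ N c → ∑ (downFrom N) (λ _ → c) ≡ ℕ→ℚ N · c
∑-const zero    c = sym (Q.zeroˡ c)
∑-const (suc N) c = trans (cong (c +_) (∑-const N c))
  (trans (solve 2 (λ c t → c :+ t :* c := (con 1 :+ t) :* c) refl c (ℕ→ℚ N)) (cong (_· c) (sym (ℕ→ℚ-suc N))))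

Θ-power-sum : ∀ N e → ∑ (downFrom (suc N)) (λ k → wtΘ N k ^ℚ e) ≡ affine (1ℚ + - sgn e) (sgn e) (suc N)
Θ-power-sum N e = begin
  wtΘ N N ^ℚ e + ∑ (downFrom N) (λ k → wtΘ N k ^ℚ e)
    ≡⟨ cong₂ _+_ (trans (cong (_^ℚ e) (wtΘ-pos N)) (1^ e)) (trans (∑-cong∈ (downFrom N) (λ k∈ → cong (_^ℚ e) (wtΘ-neg (∈-downFrom⁻ k∈)))) (∑-const N (sgn e))) ⟩
  1ℚ + ℕ→ℚ N · s
    ≡⟨ cong (_+ ℕ→ℚ N · s) (sym (trans (cong (_+ 1ℚ) (Q.-‿inverseʳ s)) (Q.+-identityˡ 1ℚ))) ⟩
  ((s + - s) + 1ℚ) + ℕ→ℚ N · s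
    ≡⟨ solve 4 (λ s m o t → ((s :+ m) :+ o) :+ t := s :+ ((o :+ m) :+ t)) refl s (- s) 1ℚ (ℕ→ℚ N · s) ⟩
  s + affine (1ℚ + - s) s N
    ≡⟨ sym (affine-suc (1ℚ + - s) s N) ⟩
  affine (1ℚ + - s) s (suc N) ∎
  where
  s = sgn e
  1^ : ∀ e → 1ℚ ^ℚ e ≡ 1ℚ
  1^ zero    = refl
  1^ (suc e) = trans (Q.*-identityˡ _) (1^ e)

ω-power-sum : ∀ N e → ∑ (downFrom N) (λ _ → sgn e) ≡ affine (- sgn e) (sgn e) (suc N)
ω-power-sum N e = sym (begin
  affine (- s) s (suc N)      ≡⟨ affine-suc (- s) s N ⟩
  s + (- s + ℕ→ℚ N · s)       ≡⟨ sym (Q.+-assoc s (- s) _) ⟩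
  (s + - s) + ℕ→ℚ N · s       ≡⟨ trans (cong (_+ ℕ→ℚ N · s) (Q.-‿inverseʳ s)) (Q.+-identityˡ _) ⟩
  ℕ→ℚ N · s                   ≡⟨ sym (∑-const N s) ⟩
  ∑ (downFrom N) (λ _ → s)    ∎)
  where s = sgn e

Θ-eigenvalue ω-eigenvalue : SetPartition n → ℚ
Θ-eigenvalue π = ∏ (λ b → 1ℚ + - sgn (blockSize π b))
ω-eigenvalue π = ∏ (λ b → - sgn (blockSize π b))

Θ-pCoeff : ∀ (π : SetPartition n) → Θ (pCoeff π) ≋ λ w → Θ-eigenvalue π · pCoeff π w
Θ-pCoeff = ΘSubst.substitute-pCoeff (λ e → 1ℚ + - sgn e) sgn Θ-power-sum

ω-pCoeff : ∀ (π : SetPartition n) → ω (pCoeff π) ≋ λ w → ω-eigenvalue π · pCoeff π w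
ω-pCoeff = ωSubst.substitute-pCoeff (λ e → - sgn e) sgn ω-power-sum

sgn-2+ : ∀ e → sgn (2+ e) ≡ sgn e
sgn-2+ e = begin
  - 1ℚ · (- 1ℚ · sgn e)  ≡⟨ neg-· _ ⟩
  - (- 1ℚ · sgn e)       ≡⟨ cong -_ (neg-· (sgn e)) ⟩
  - - sgn e              ≡⟨ -‿involutive (sgn e) ⟩
  sgn e                  ∎

sgn-odd : ∀ e → e % 2 ≡ 1 → 1ℚ + - sgn e ≡ ℕ→ℚ 2
sgn-odd 1      _ = trans (cong (λ t → 1ℚ + - t) (Q.*-identityʳ (- 1ℚ))) (trans (cong (1ℚ +_) (-‿involutive 1ℚ)) (sym (ℕ→ℚ-suc 1)))
sgn-odd (2+ e) h = trans (cong (λ t → 1ℚ + - t) (sgn-2+ e)) (sgn-odd e h)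

sgn-even : ∀ e → e % 2 ≢ 1 → 1ℚ + - sgn e ≡ 0ℚ
sgn-even 0      _ = Q.-‿inverseʳ 1ℚ
sgn-even 1      h = contradiction refl h
sgn-even (2+ e) h = trans (cong (λ t → 1ℚ + - t) (sgn-2+ e)) (sgn-even e h)

∏-2 : ∀ {f : Fin n → ℚ} → (∀ i → f i ≡ ℕ→ℚ 2) → ∏ f ≡ ℕ→ℚ (2 ^ n)
∏-2 {zero}  h = refl
∏-2 {suc n} h = trans (cong₂ _·_ (h zero) (∏-2 (h ∘ suc))) (sym (ℕ→ℚ-* 2 (2 ^ n)))

Θ-eigenvalue-odd : ∀ (π : SetPartition n) → AllBlocksOdd π → Θ-eigenvalue π ≡ ℕ→ℚ (2 ^ ℓ π)
Θ-eigenvalue-odd π odd = ∏-2 (λ b → sgn-odd (blockSize π b) (odd b))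

Θ-eigenvalue-even : ∀ (π : SetPartition n) → ¬ AllBlocksOdd π → Θ-eigenvalue π ≡ 0ℚ
Θ-eigenvalue-even π ¬odd
  with b , even ← Finₚ.¬∀⟶∃¬ (ℓ π) (λ b → blockSize π b % 2 ≡ 1) (λ b → blockSize π b % 2 ℕ.≟ 1) ¬odd
  = ∏-0 b (sgn-even (blockSize π b) even)

pCoeff-invariant : ∀ (π : SetPartition n) → OrderInvariant (pCoeff π)
pCoeff-invariant π w w′ same = ι-cong (constant? π w) (constant? π w′)
  (λ h j k e → proj₂ same j k (h j k e)) (λ h j k e → reflects j k (h j k e))
  where
  reflects : ∀ j k → w′ j ≡ w′ k → w j ≡ w k
  reflects j k e = ℕₚ.≤-antisym (ℕₚ.≮⇒≥ (λ lt → ℕₚ.<⇒≢ (proj₁ same k j lt) (sym e))) (ℕₚ.≮⇒≥ (λ lt → ℕₚ.<⇒≢ (proj₁ same j k lt) e))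

Span-p-invariant : ∀ {x : Series n} → Span pCoeff x → OrderInvariant x
Span-p-invariant (ts , x≋) w w′ same = trans (x≋ w)
  (trans (∑-cong ts (λ t → cong (coef t ·_) (pCoeff-invariant (part t) w w′ same))) (sym (x≋ w′)))

module _ {T : Series n → Series n} {λᵀ : SetPartition n → ℚ}
  (T-cong : ∀ {x y : Series n} → x ≋ y → T x ≋ T y)
  (T-∑ : ∀ {A : Set} (ts : List A) (c : A → ℚ) (f : A → Series n) → T (λ w → ∑ ts (λ t → c t · f t w)) ≋ λ w → ∑ ts (λ t → c t · T (f t) w))
  (T-p : ∀ (π : SetPartition n) → T (pCoeff π) ≋ λ w → λᵀ π · pCoeff π w) where

  -- Coefficients and partitions are indexed by an arbitrary list, so the result has the form of the
  -- hypothesis and two operators can be applied in succession.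
  diagonal : ∀ {A : Set} (ts : List A) (c : A → ℚ) (π : A → SetPartition n) {x} → x ≋ (λ w → ∑ ts (λ t → c t · pCoeff (π t) w)) →
    T x ≋ λ w → ∑ ts (λ t → (c t · λᵀ (π t)) · pCoeff (π t) w)
  diagonal ts c π x≋ w = trans (T-cong x≋ w) (trans (T-∑ ts c (λ t → pCoeff (π t)) w)
    (∑-cong ts (λ t → trans (cong (c t ·_) (T-p (π t) w)) (sym (Q.*-assoc (c t) _ _)))))

Θ-diagonal : ∀ {A : Set} (ts : List A) c (π : A → SetPartition n) {x : Series n} → x ≋ (λ w → ∑ ts (λ t → c t · pCoeff (π t) w)) →
  Θ x ≋ λ w → ∑ ts (λ t → (c t · Θ-eigenvalue (π t)) · pCoeff (π t) w)
Θ-diagonal = diagonal ΘSubst.substitute-cong ΘSubst.substitute-∑ Θ-pCoeff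

ω-diagonal : ∀ {A : Set} (ts : List A) c (π : A → SetPartition n) {x : Series n} → x ≋ (λ w → ∑ ts (λ t → c t · pCoeff (π t) w)) →
  ω x ≋ λ w → ∑ ts (λ t → (c t · ω-eigenvalue (π t)) · pCoeff (π t) w)
ω-diagonal = diagonal ωSubst.substitute-cong ωSubst.substitute-∑ ω-pCoeff

-- Both intermediate series are again combinations of p's, hence order invariant and in the span of
-- the h's, so the second operator has an expansion to act on. The two results agree because the
-- eigenvalues commute.
Θ-ω-commute : ∀ {x : Series n} → Span pCoeff x → ∃[ y ] ∃[ z ] ∃[ u ] Isω x y × IsΘ y z × IsΘ x u × Isω u z
Θ-ω-commute {n} {x} (ts , x≋) = ω x , Θ (ω x) , Θ x ,
    ω-isω (p⇒h (ts , x≋)) (λ _ → refl) ,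
    Θ-isΘ (Span-p-invariant (diagonal∈ ω-eigenvalue {ts} (ω-diagonal ts coef part x≋))) (λ _ → refl) ,
    Θ-isΘ (Span-p-invariant (ts , x≋)) (λ _ → refl) ,
    ω-isω (p⇒h (diagonal∈ Θ-eigenvalue {ts} (Θ-diagonal ts coef part x≋))) (λ w → begin
      ω (Θ x) w
        ≡⟨ ω-diagonal ts (λ t → coef t · Θ-eigenvalue (part t)) part (Θ-diagonal ts coef part x≋) w ⟩
      ∑ ts (λ t → ((coef t · Θ-eigenvalue (part t)) · ω-eigenvalue (part t)) · pCoeff (part t) w)
        ≡⟨ ∑-cong ts (λ t → solve 4 (λ c a b p → ((c :* a) :* b) :* p := ((c :* b) :* a) :* p) refl
             (coef t) (Θ-eigenvalue (part t)) (ω-eigenvalue (part t)) (pCoeff (part t) w)) ⟩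
      ∑ ts (λ t → ((coef t · ω-eigenvalue (part t)) · Θ-eigenvalue (part t)) · pCoeff (part t) w)
        ≡⟨ sym (Θ-diagonal ts (λ t → coef t · ω-eigenvalue (part t)) part (ω-diagonal ts coef part x≋) w) ⟩
      Θ (ω x) w ∎)
  where
  p⇒h : ∀ {x : Series n} → Span pCoeff x → Span hCoeff x
  p⇒h = Span-⊆ pCoeff∈Span-h
  diagonal∈ : ∀ (λᵀ : SetPartition n → ℚ) {ts : List (PTerm n)} {y} →
    y ≋ (λ w → ∑ ts (λ t → (coef t · λᵀ (part t)) · pCoeff (part t) w)) → Span pCoeff y
  diagonal∈ λᵀ {ts} y≋ = Span-cong (λ w → sym (y≋ w)) (Span-∑ ts (λ t → Span-· (coef t · λᵀ (part t)) (Span-basis (part t))))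

Θ-p-odd : ∀ (π : SetPartition n) → AllBlocksOdd π → IsΘ (pCoeff π) (λ w → ℕ→ℚ (2 ^ ℓ π) · pCoeff π w)
Θ-p-odd π odd = Θ-isΘ (pCoeff-invariant π) (λ w → trans (Θ-pCoeff π w) (cong (_· pCoeff π w) (Θ-eigenvalue-odd π odd)))

Θ-p-even : ∀ (π : SetPartition n) → ¬ AllBlocksOdd π → IsΘ (pCoeff π) (λ _ → 0ℚ)
Θ-p-even π ¬odd = Θ-isΘ (pCoeff-invariant π) (λ w → trans (Θ-pCoeff π w)
  (trans (cong (_· pCoeff π w) (Θ-eigenvalue-even π ¬odd)) (Q.zeroˡ _)))

opaque
  unfolding _+_

  IsΘ⇒ThetaOf : ∀ {x y : Series n} → IsΘ x y → ThetaOf x y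
  IsΘ⇒ThetaOf h = h

  IsΘ⇒ThetaOf-scale : ∀ {x y : Series n} {c} → IsΘ x (λ w → c · y w) → ThetaOf x (λ w → c * y w)
  IsΘ⇒ThetaOf-scale h = h

  Isω⇒OmegaOf : ∀ {x y : Series n} → Isω x y → OmegaOf x y
  Isω⇒OmegaOf h = h

  InNCSym⇒Span : ∀ {x : Series n} → InNCSym x → Span mCoeff x
  InNCSym⇒Span h = h

theorem10p2 : ((n : ℕ) → 1 ≤ n → (π : SetPartition n) →
    (AllBlocksOdd π → ThetaOf (pCoeff π) (λ w → ℕ→ℚ (2 ^ ℓ π) * pCoeff π w)) ×
    (¬ AllBlocksOdd π → ThetaOf (pCoeff π) (λ w → 0ℚ)))
    ×
    ((n : ℕ) → (x : Series n) → InNCSym x →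
    Σ (Series n) λ y → Σ (Series n) λ z → Σ (Series n) λ u →
    OmegaOf x y × ThetaOf y z × ThetaOf x u × OmegaOf u z)
theorem10p2 =
  (λ n _ π → (λ odd → IsΘ⇒ThetaOf-scale (Θ-p-odd π odd)) , (λ ¬odd → IsΘ⇒ThetaOf (Θ-p-even π ¬odd))) ,
  λ n x x∈ → let y , z , u , x↦y , y↦z , x↦u , u↦z = Θ-ω-commute (Span-⊆ mCoeff∈Span (InNCSym⇒Span x∈)) in
    y , z , u , Isω⇒OmegaOf x↦y , IsΘ⇒ThetaOf y↦z , IsΘ⇒ThetaOf x↦u , Isω⇒OmegaOf u↦z
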